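{- Let $G$ be a $3$-connected $3$-regular planar graph and let $G^*$ be the dual of $G$ embedded on the sphere. Then there is a one-to-one correspondence between the inequivalent embeddings of $G$ on the torus and the subgraphs of $G^*$ that are isomorphic to $K_{2,2,2}$, to $K_{2,2m}$ for some positive integer $m$, or to $K_{1,1,2m-1}$ for some positive integer $m$.
   Context: All graphs are finite, simple and undirected. An embedding of a graph on a surface (a compact $2$-manifold without boundary) is assumed to be cellular, i.e. every face is homeomorphic to an open $2$-cell. Two embeddings $f_1,f_2\colon G\to F^2$ are equivalent if there is a homeomorphism $h\colon F^2\to F^2$ with $hf_1=f_2$. By Whitney's theorem a $3$-connected planar graph has a unique embedding on the sphere up to equivalence; its dual $G^*$ is the geometric dual of this spherical embedding. $K_{n_1,\dots,n_k}$ denotes the complete $k$-partite graph with parts of sizes $n_1,\dots,n_k$. Subgraphs are not required to be induced. -}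

module Defs where

open import Data.Nat using (ℕ; zero; suc; _+_; _*_; _∸_; _≤_; _<_)
open import Data.Bool using (Bool; true; false; T; if_then_else_)
open import Data.Fin using (Fin; zero; suc)
open import Data.Vec using (Vec; []; _∷_; lookup)
open import Data.Product using (Σ; _×_; _,_; proj₁; proj₂)
open import Data.Sum using (_⊎_)
open import Relation.Nullary using (¬_)
open import Relation.Binary.PropositionalEquality using (_≡_; _≢_; subst)

record Graph : Set where
  field
    n          : ℕ
    adj        : Fin n → Fin n → Bool
    adj-sym    : ∀ u v → adj u v ≡ adj v u
    adj-irrefl : ∀ v → adj v v ≡ false

countTrue : ∀ {k} → (Fin k → Bool) → ℕ
countTrue {zero}  f = 0
countTrue {suc k} f = (if f zero then 1 else 0) + countTrue (λ i → f (suc i))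

sumFin : ∀ {k} → (Fin k → ℕ) → ℕ
sumFin {zero}  f = 0
sumFin {suc k} f = f zero + sumFin (λ i → f (suc i))

iter : {A : Set} → (A → A) → ℕ → A → A
iter f zero    x = x
iter f (suc k) x = f (iter f k x)

module _ (G : Graph) where
  open Graph G

  degree : Fin n → ℕ
  degree v = countTrue (adj v)

  -- sum of degrees = 2 |E(G)|
  degreeSum : ℕ
  degreeSum = sumFin degree

  Regular : ℕ → Set
  Regular r = ∀ v → degree v ≡ r

  data ReachAvoiding (removed : Fin n → Set) : Fin n → Fin n → Set where
    here : ∀ {u} → ReachAvoiding removed u u
    step : ∀ {u v w} → T (adj u v) → ¬ removed v →
           ReachAvoiding removed v w → ReachAvoiding removed u w

  ConnectedAvoiding : (Fin n → Set) → Set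
  ConnectedAvoiding removed =
    ∀ u v → ¬ removed u → ¬ removed v → ReachAvoiding removed u v

  ThreeConnected : Set
  ThreeConnected =
    3 < n
    × ConnectedAvoiding (λ _ → Data.Empty.⊥)
    × (∀ a → ConnectedAvoiding (λ x → x ≡ a))
    × (∀ a b → ConnectedAvoiding (λ x → x ≡ a ⊎ x ≡ b))
    where import Data.Empty

  -- Darts (directed edges) and rotation systems (= cellular embeddings
  -- in orientable surfaces, Heffter–Edmonds–Ringel)

  Dart : Set
  Dart = Σ (Fin n × Fin n) λ p → T (adj (proj₁ p) (proj₂ p))

  tail : Dart → Fin n
  tail d = proj₁ (proj₁ d)

  rev : Dart → Dart
  rev ((u , v) , e) = (v , u) , subst T (adj-sym u v) e

  record RotationSystem : Set where
    field
      σ        : Dart → Dart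
      σ⁻¹      : Dart → Dart
      σσ⁻¹     : ∀ d → σ (σ⁻¹ d) ≡ d
      σ⁻¹σ     : ∀ d → σ⁻¹ (σ d) ≡ d
      σ-tail   : ∀ d → tail (σ d) ≡ tail d
      σ-cyclic : ∀ d d' → tail d ≡ tail d' → Σ ℕ λ k → iter σ k d ≡ d'

  open RotationSystem public

  faceStep : RotationSystem → Dart → Dart
  faceStep ρ d = σ ρ (rev d)

  SameFace : RotationSystem → Dart → Dart → Set
  SameFace ρ d d' = Σ ℕ λ k → iter (faceStep ρ) k d ≡ d'

  HasFaceCount : RotationSystem → ℕ → Set
  HasFaceCount ρ F =
    Σ (Fin F → Dart) λ rep →
      (∀ d → Σ (Fin F) λ i → SameFace ρ (rep i) d)
      × (∀ i j → SameFace ρ (rep i) (rep j) → i ≡ j)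

  -- embedding in the orientable surface of genus g (Euler: V − E + F = 2 − 2g)
  HasGenus : RotationSystem → ℕ → Set
  HasGenus ρ g = Σ ℕ λ F → HasFaceCount ρ F × (2 * (n + F) + 4 * g ≡ degreeSum + 4)

  -- equivalence of embeddings: same rotation system or its mirror image
  EquivEmb : RotationSystem → RotationSystem → Set
  EquivEmb ρ₁ ρ₂ = (∀ d → σ ρ₁ d ≡ σ ρ₂ d) ⊎ (∀ d → σ ρ₁ d ≡ σ⁻¹ ρ₂ d)

  -- Edge sets of G, i.e. edge sets of the dual G* (edges of G* ↔ edges of G)

  record EdgeSet : Set where
    field
      S     : Fin n → Fin n → Bool
      S-sym : ∀ u v → S u v ≡ S v u
      S-sub : ∀ u v → T (S u v) → T (adj u v)

  open EdgeSet public

  SameEdges : EdgeSet → EdgeSet → Set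
  SameEdges E₁ E₂ = ∀ u v → S E₁ u v ≡ S E₂ u v

  sdart : (E : EdgeSet) → ∀ u v → T (S E u v) → Dart
  sdart E u v e = (u , v) , S-sub E u v e

  -- vertices of the complete multipartite graph with given part sizes;
  -- two vertices are adjacent iff they lie in different parts
  KV : ∀ {k} → Vec ℕ k → Set
  KV {k} sizes = Σ (Fin k) λ p → Fin (lookup sizes p)

  -- The subgraph of the dual G* (w.r.t. the embedding ρ) formed by the
  -- dual edges in E (and their end-faces) is isomorphic to K_{sizes}.
  -- f sends each vertex of K to (a dart on) a face of ρ.
  DualSubgraphIso : RotationSystem → EdgeSet → ∀ {k} → Vec ℕ k → Set
  DualSubgraphIso ρ E sizes =
    Σ (KV sizes → Dart) λ f →
      (∀ x y → SameFace ρ (f x) (f y) → x ≡ y)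
      × (∀ u v (e : T (S E u v)) → Σ (KV sizes) λ x → Σ (KV sizes) λ y →
            proj₁ x ≢ proj₁ y
            × SameFace ρ (f x) (sdart E u v e)
            × SameFace ρ (f y) (rev (sdart E u v e)))
      × (∀ x y → proj₁ x ≢ proj₁ y →
            Σ (Fin n) λ u → Σ (Fin n) λ v → Σ (T (S E u v)) λ e →
              SameFace ρ (f x) (sdart E u v e)
              × SameFace ρ (f y) (rev (sdart E u v e)))
      × (∀ x y u v (e : T (S E u v)) u' v' (e' : T (S E u' v')) →
            SameFace ρ (f x) (sdart E u v e) →
            SameFace ρ (f y) (rev (sdart E u v e)) →
            SameFace ρ (f x) (sdart E u' v' e') →
            SameFace ρ (f y) (rev (sdart E u' v' e')) →
            u ≡ u' × v ≡ v')

  GoodDualSubgraph : RotationSystem → EdgeSet → Set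
  GoodDualSubgraph ρ E =
    DualSubgraphIso ρ E (2 ∷ 2 ∷ 2 ∷ [])
    ⊎ Σ ℕ (λ m → 1 ≤ m × DualSubgraphIso ρ E (2 ∷ 2 * m ∷ []))
    ⊎ Σ ℕ (λ m → 1 ≤ m × DualSubgraphIso ρ E (1 ∷ 1 ∷ 2 * m ∸ 1 ∷ []))

OneToOne : (A B : Set) → (A → A → Set) → (B → B → Set) → Set
OneToOne A B _≈A_ _≈B_ =
  Σ (A → B) λ Φ →
    (∀ a a' → a ≈A a' → Φ a ≈B Φ a')
    × (∀ a a' → Φ a ≈B Φ a' → a ≈A a')
    × (∀ b → Σ A λ a → Φ a ≈B b)

{-# OPTIONS --safe #-}

-- A rotation system of a cubic graph is obtained from ρ₀ by reversing the rotation at the vertices of a set X, which is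
-- unique up to complement once mirror images are identified; so embeddings correspond to edge cuts S = δX, that is, to
-- even subgraphs of G*.  Let A be the adjacency matrix over F2 of the dual subgraph S.  A function y on darts that is
-- constant on the faces of the flipped embedding has the form y(d) = a(tail d) + b(f), where f is the face of ρ₀ to the
-- left of d outside X and to its right inside X; such a pair (a , b) exists exactly when S·δb = δa, i.e. when b ∈ ker A.
-- Hence the flipped embedding has dim ker A faces, its genus is half the rank of A, and it is toroidal iff A has rank 2.
-- An alternating matrix of rank 2 over F2 comes from labelling the faces by vectors of F2², two faces being adjacent iff
-- their labels are nonzero and distinct, so S is complete bipartite or tripartite.  Evenness makes all part sizes
-- congruent mod 2, and planarity of G* excludes K₃,₃, which leaves exactly the three families.

module Submission where

open import Defs
open import Algebra using (CommutativeRing)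
open import Data.Bool using (Bool; true; false; T; if_then_else_; _xor_; _∧_; not)
open import Data.Bool.Properties using (xor-∧-commutativeRing; T-irrelevant; ∧-comm; ∧-zeroʳ; ∧-identityʳ)
import Data.Bool.Properties as Boolₚ
open import Data.Bool.Solver using (module xor-∧-Solver)
open import Data.Empty using (⊥; ⊥-elim)
open import Data.Unit using (tt)
open import Data.Fin using (Fin; zero; suc; toℕ; punchIn; punchOut; splitAt; _↑ˡ_; _↑ʳ_; combine; fromℕ<; inject≤; funToFin; finToFun)
open import Data.Fin.Patterns using (0F; 1F; 2F)
open import Data.Fin.Properties using (any?; all?; injective⇒≤; funToFin-finToFin; finToFun-funToFin; punchIn-punchOut)
import Data.Fin.Properties as Finₚ
open import Data.Fin.Permutation using (Permutation; permutation; _⟨$⟩ʳ_)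
open import Data.Nat using (ℕ; zero; suc; _+_; _*_; _∸_; _^_; _≤_; _<_; z≤n; s≤s)
import Data.Nat.Properties as ℕₚ
open import Data.Nat.DivMod using (_%_; _/_; m≡m%n+[m/n]*n; m%n<n)
open import Data.Product using (Σ; ∃; _×_; _,_; proj₁; proj₂)
open import Data.Sum using (_⊎_; inj₁; inj₂; [_,_]′)
open import Data.Vec using (Vec; []; _∷_; lookup)
open import Data.Vec.Functional using (insertAt; removeAt)
open import Data.Vec.Functional.Properties using (insertAt-lookup; insertAt-punchIn)
open import Function using (_∘_; id; _$_; case_of_; flip)
open import Relation.Nullary using (¬_; Dec; yes; no; contradiction; does)
open import Relation.Nullary.Decidable using (dec-true; dec-false; from-yes; _→-dec_; ¬?)
open import Relation.Binary.Definitions using (DecidableEquality)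
open import Relation.Binary.PropositionalEquality
import Algebra.Properties.Semiring.Sum

-- For rotation systems the sphere leaves only one trace, Euler's equation. It enters through a
-- single dimension count: exactness of the mod 2 cochain complex. The count is carried out for an
-- abstract pair of permutations, so that exchanging vertices and faces gives both halves of planar
-- duality: even edge sets of `G` bound sets of faces, and even subgraphs of G* are cuts of `G`. By
-- the second half, loops and parallel edges of G* would be cuts of `G` with one or two edges, which
-- 3-connectivity forbids; a pair of faces therefore determines the edge between them, and a mod 2
-- sum over darts is an honest adjacency matrix. Vectors are Boolean functions compared pointwise,
-- and dimensions are compared by counting: an injection between cubes, linear or not, bounds the
-- exponents, and the number of faces is compared with a rank by injections in both directions. K₃,₃
-- is excluded without looking at the faces of a subgraph. Each of its 4-cycles in G* is a cut of
-- `G`, and the side of this cut is followed along the boundaries of faces.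

private module Σₚ = Algebra.Properties.Semiring.Sum (CommutativeRing.semiring xor-∧-commutativeRing)
open Σₚ using (sum)
open xor-∧-Solver using (solve; _:+_; _:*_; _:=_; con)

-- Linear algebra over F2

xor-self : ∀ a → a xor a ≡ false
xor-self false = refl
xor-self true  = refl

xor≡false⇒≡ : ∀ {a b} → a xor b ≡ false → a ≡ b
xor≡false⇒≡ {false} {false} _ = refl
xor≡false⇒≡ {true}  {true}  _ = refl

≢⇒xor≡true : ∀ {a b} → a ≢ b → a xor b ≡ true
≢⇒xor≡true {false} {false} p = contradiction refl p
≢⇒xor≡true {false} {true}  p = refl
≢⇒xor≡true {true}  {false} p = refl
≢⇒xor≡true {true}  {true}  p = contradiction refl p

xor≡true⇒≢ : ∀ {a b} → a xor b ≡ true → a ≢ b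
xor≡true⇒≢ {false} () refl
xor≡true⇒≢ {true}  () refl

≢true⇒≡false : ∀ {a} → a ≢ true → a ≡ false
≢true⇒≡false {false} _ = refl
≢true⇒≡false {true}  p = contradiction refl p

∧-true : ∀ {a b} → a ∧ b ≡ true → a ≡ true × b ≡ true
∧-true {true} {true} _ = refl , refl

≡true⇔⇒≡ : ∀ {a b} → (a ≡ true → b ≡ true) → (b ≡ true → a ≡ true) → a ≡ b
≡true⇔⇒≡ {false} {false} f g = refl
≡true⇔⇒≡ {false} {true}  f g = g refl
≡true⇔⇒≡ {true}  {_}     f g = sym (f refl)

T⇒true : ∀ {b} → T b → b ≡ true
T⇒true {true} _ = refl

true⇒T : ∀ {b} → b ≡ true → T b
true⇒T refl = tt

does-true : {P : Set} (d : Dec P) → does d ≡ true → P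
does-true (yes p) _ = p

_≟F_ : ∀ {n} → DecidableEquality (Fin n)
_≟F_ = Finₚ._≟_

δ : ∀ {n} → Fin n → Fin n → Bool
δ i j = does (i ≟F j)

δ-refl : ∀ {n} (i : Fin n) → δ i i ≡ true
δ-refl i = dec-true (i ≟F i) refl

δ-≢ : ∀ {n} {i j : Fin n} → i ≢ j → δ i j ≡ false
δ-≢ {i = i} {j} = dec-false (i ≟F j)

δ-≡ : ∀ {n} {i j : Fin n} → δ i j ≡ true → i ≡ j
δ-≡ {i = i} {j} = does-true (i ≟F j)

abstract
  -- Sealed by `abstract` so that sums stay folded during type checking; `∑-empty` and `∑-suc` hand
  -- back the computation rules.
  ∑ : ∀ {n} → (Fin n → Bool) → Bool
  ∑ {zero}  f = false
  ∑ {suc n} f = f zero xor ∑ (f ∘ suc)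

  ∑≡sum : ∀ {n} (f : Fin n → Bool) → ∑ f ≡ sum f
  ∑≡sum {zero}  f = refl
  ∑≡sum {suc n} f = cong (f zero xor_) (∑≡sum (f ∘ suc))

  ∑-cong : ∀ {n} {f g : Fin n → Bool} → (∀ i → f i ≡ g i) → ∑ f ≡ ∑ g
  ∑-cong {zero}  h = refl
  ∑-cong {suc n} h = cong₂ _xor_ (h zero) (∑-cong (h ∘ suc))

  ∑-empty : (f : Fin 0 → Bool) → ∑ f ≡ false
  ∑-empty f = refl

  ∑-suc : ∀ {n} (f : Fin (suc n) → Bool) → ∑ f ≡ f zero xor ∑ (f ∘ suc)
  ∑-suc f = refl

  ∑-zero : ∀ {n} {f : Fin n → Bool} → (∀ i → f i ≡ false) → ∑ f ≡ false
  ∑-zero {zero}  h = refl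
  ∑-zero {suc n} h = cong₂ _xor_ (h zero) (∑-zero (h ∘ suc))


∑-xor : ∀ {n} (f g : Fin n → Bool) → ∑ (λ i → f i xor g i) ≡ ∑ f xor ∑ g
∑-xor f g = trans (∑≡sum (λ i → f i xor g i))
  (trans (Σₚ.∑-distrib-+ f g) (sym (cong₂ _xor_ (∑≡sum f) (∑≡sum g))))

∑-∧ˡ : ∀ {n} a (f : Fin n → Bool) → ∑ (λ i → a ∧ f i) ≡ a ∧ ∑ f
∑-∧ˡ a f = trans (∑≡sum (λ i → a ∧ f i)) (trans (sym (Σₚ.*-distribˡ-sum a f)) (cong (a ∧_) (sym (∑≡sum f))))

∑-swap : ∀ {m n} (f : Fin m → Fin n → Bool) → ∑ (λ i → ∑ (λ j → f i j)) ≡ ∑ (λ j → ∑ (λ i → f i j))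
∑-swap f = trans (double f) (trans (Σₚ.∑-comm f) (sym (double (flip f))))
  where
  double : ∀ {m n} (f : Fin m → Fin n → Bool) → ∑ (λ i → ∑ (f i)) ≡ sum (λ i → sum (f i))
  double f = trans (∑-cong (λ i → ∑≡sum (f i))) (∑≡sum (λ i → sum (f i)))

∑-permute : ∀ {m n} (π : Permutation m n) (f : Fin n → Bool) → ∑ (λ i → f (π ⟨$⟩ʳ i)) ≡ ∑ f
∑-permute π f = trans (∑≡sum (λ i → f (π ⟨$⟩ʳ i))) (trans (sym (Σₚ.sum-permute f π)) (sym (∑≡sum f)))

∑-remove : ∀ {n} (i : Fin (suc n)) (f : Fin (suc n) → Bool) → ∑ f ≡ f i xor ∑ (λ j → f (punchIn i j))
∑-remove i f = trans (∑≡sum f) (trans (Σₚ.sum-remove {i = i} f) (cong (f i xor_) (sym (∑≡sum (λ j → f (punchIn i j))))))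

∑-single : ∀ {n} {f : Fin n → Bool} i → (∀ j → j ≢ i → f j ≡ false) → ∑ f ≡ f i
∑-single {suc n} {f} zero h = trans (∑-suc f) $
  trans (cong (f zero xor_) (∑-zero (λ j → h (suc j) (λ ())))) (Boolₚ.xor-identityʳ (f zero))
∑-single {suc n} {f} (suc i) h = trans (∑-suc f) $
  trans (cong (_xor ∑ (f ∘ suc)) (h zero (λ ())))
        (∑-single i (λ j j≢i → h (suc j) (j≢i ∘ Finₚ.suc-injective)))

∑-true : ∀ {n} {f : Fin n → Bool} → ∑ f ≡ true → ∃ λ i → f i ≡ true
∑-true {zero}  {f} h = contradiction (trans (sym h) (∑-empty f)) λ ()
∑-true {suc n} {f} h with f zero in eq
... | true  = zero , eq
... | false = let i , p = ∑-true {f = f ∘ suc} (trans (cong (_xor ∑ (f ∘ suc)) (sym eq)) (trans (sym (∑-suc f)) h))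
              in suc i , p

∑-δ : ∀ {n} (i : Fin n) (f : Fin n → Bool) → ∑ (λ j → δ i j ∧ f j) ≡ f i
∑-δ i f = trans (∑-single i (λ j j≢i → cong (_∧ f j) (δ-≢ (j≢i ∘ sym)))) (cong (_∧ f i) (δ-refl i))

-- Boolean cubes and dimension by counting.

Cube : ℕ → Set
Cube k = Fin k → Bool

bit : Bool → Fin 2
bit false = 0F
bit true  = 1F

unbit : Fin 2 → Bool
unbit 0F = false
unbit 1F = true

unbit-bit : ∀ b → unbit (bit b) ≡ b
unbit-bit false = refl
unbit-bit true  = refl

bit-unbit : ∀ i → bit (unbit i) ≡ i
bit-unbit 0F = refl
bit-unbit 1F = refl

funToFin-cong : ∀ {m n} {f g : Fin m → Fin n} → f ≗ g → funToFin f ≡ funToFin g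
funToFin-cong {zero}  h = refl
funToFin-cong {suc m} h = cong₂ combine (h zero) (funToFin-cong (h ∘ suc))

encode : ∀ {k} → Cube k → Fin (2 ^ k)
encode c = funToFin (bit ∘ c)

decode : ∀ {k} → Fin (2 ^ k) → Cube k
decode {k} i = unbit ∘ finToFun {2} {k} i

decode-encode : ∀ {k} (c : Cube k) → decode (encode c) ≗ c
decode-encode c i = trans (cong unbit (finToFun-funToFin (bit ∘ c) i)) (unbit-bit (c i))

encode-decode : ∀ {k} (i : Fin (2 ^ k)) → encode {k} (decode i) ≡ i
encode-decode {k} i = trans (funToFin-cong {k} {2} (λ j → bit-unbit (finToFun {2} {k} i j))) (funToFin-finToFin {k} {2} i)

encode-cong : ∀ {k} {c c′ : Cube k} → c ≗ c′ → encode c ≡ encode c′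
encode-cong h = funToFin-cong (cong bit ∘ h)

encode-injective : ∀ {k} {c c′ : Cube k} → encode c ≡ encode c′ → c ≗ c′
encode-injective {c = c} {c′} eq i =
  trans (sym (decode-encode c i)) (trans (cong (λ e → decode e i) eq) (decode-encode c′ i))

CubeInjective : ∀ {k l} → (Cube k → Cube l) → Set
CubeInjective f = ∀ x y → f x ≗ f y → x ≗ y

module _ {k l} (f : Cube k → Cube l) (inj : CubeInjective f) where

  private
    code : Fin (2 ^ k) → Fin (2 ^ l)
    code i = encode (f (decode i))

    code-injective : ∀ {i j} → code i ≡ code j → i ≡ j
    code-injective {i} {j} eq =
      trans (sym (encode-decode {k} i))
            (trans (encode-cong (inj (decode i) (decode j) (encode-injective eq))) (encode-decode {k} j))

  -- Pigeonhole on `2 ^ k` and `2 ^ l` points; this stands in for invariance of dimension.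
  cube-injective⇒≤ : k ≤ l
  cube-injective⇒≤ with k ℕₚ.≤? l
  ... | yes p = p
  ... | no ¬p = contradiction (injective⇒≤ code-injective)
                  (ℕₚ.<⇒≱ (ℕₚ.^-monoʳ-< 2 (s≤s (s≤s z≤n)) (ℕₚ.≰⇒> ¬p)))

  cube-injective⇒surjective : l ≤ k → ∀ c → ∃ λ x → f x ≗ c
  cube-injective⇒surjective l≤k c with any? (λ i → code i ≟F encode c)
  ... | yes (i , eq) = decode i , encode-injective eq
  -- With `c` missed, `code⁺` would inject `2 ^ k + 1` points into `2 ^ l`, which is at most
  -- `2 ^ k`.
  ... | no ¬hit = contradiction (injective⇒≤ {f = code⁺} code⁺-injective)
                    (ℕₚ.<⇒≱ (s≤s (ℕₚ.^-monoʳ-≤ 2 l≤k)))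
    where
    code⁺ : Fin (suc (2 ^ k)) → Fin (2 ^ l)
    code⁺ zero    = encode c
    code⁺ (suc i) = code i
    code⁺-injective : ∀ {i j} → code⁺ i ≡ code⁺ j → i ≡ j
    code⁺-injective {zero}  {zero}  eq = refl
    code⁺-injective {zero}  {suc j} eq = contradiction (j , sym eq) ¬hit
    code⁺-injective {suc i} {zero}  eq = contradiction (i , eq) ¬hit
    code⁺-injective {suc i} {suc j} eq = cong suc (code-injective eq)

-- Kernels of matrices and elimination.

Matrix : ℕ → ℕ → Set
Matrix m n = Fin m → Fin n → Bool

_·_ : ∀ {m n} → Matrix m n → Cube n → Cube m
(M · x) i = ∑ λ j → M i j ∧ x j

Kernel : ∀ {m n} → Matrix m n → Cube n → Set
Kernel M x = ∀ i → (M · x) i ≡ false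

-- Says that the kernel has dimension `k`, by a bijection with the cube instead of a basis;
-- `congruent` is a field because vectors are compared pointwise.
record Parametrisation {m n} (M : Matrix m n) (k : ℕ) : Set where
  field
    vector     : Cube k → Cube n
    congruent  : ∀ {c c′} → c ≗ c′ → vector c ≗ vector c′
    kernel     : ∀ c → Kernel M (vector c)
    injective  : CubeInjective vector
    surjective : ∀ x → Kernel M x → ∃ λ c → vector c ≗ x

·-congˡ : ∀ {m n} {M M′ : Matrix m n} → (∀ i j → M i j ≡ M′ i j) → ∀ x → M · x ≗ M′ · x
·-congˡ h x i = ∑-cong λ j → cong (_∧ x j) (h i j)

·-congʳ : ∀ {m n} (M : Matrix m n) {x x′ : Cube n} → x ≗ x′ → M · x ≗ M · x′
·-congʳ M h i = ∑-cong λ j → cong (M i j ∧_) (h j)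

parametrisation-cong : ∀ {m n k} {M M′ : Matrix m n} → (∀ i j → M i j ≡ M′ i j) →
                       Parametrisation M k → Parametrisation M′ k
parametrisation-cong h P = record
  { vector     = vector
  ; congruent  = congruent
  ; kernel     = λ c i → trans (sym (·-congˡ h (vector c) i)) (kernel c i)
  ; injective  = injective
  ; surjective = λ x kx → surjective x λ i → trans (·-congˡ h x i) (kx i)
  } where open Parametrisation P

zero-parametrisation : ∀ {m n} {M : Matrix m n} → (∀ i j → M i j ≡ false) → Parametrisation M n
zero-parametrisation h = record
  { vector     = id
  ; congruent  = id
  ; kernel     = λ c i → ∑-zero λ j → cong (_∧ c j) (h i j)
  ; injective  = λ x y eq → eq
  ; surjective = λ x _ → x , λ _ → refl
  }

-- One elimination step with pivot `M p q`: row `p` is added to each row with a nonzero entry in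
-- column `q`, then row `p` and column `q` are dropped. The formula is symmetric under
-- transposition, so the same step reduces `flip M`.
schur : ∀ {m n} → Matrix (suc m) (suc n) → Fin (suc m) → Fin (suc n) → Matrix m n
schur M p q i j = M (punchIn p i) (punchIn q j) xor (M (punchIn p i) q ∧ M p (punchIn q j))

module _ {m n} (M : Matrix (suc m) (suc n)) (p : Fin (suc m)) (q : Fin (suc n)) (pivot : M p q ≡ true) where

  private
    row : Fin (suc m) → Cube n → Bool
    row i x = ∑ λ j → M i (punchIn q j) ∧ x j

    split-row : ∀ x i → (M · x) i ≡ (M i q ∧ x q) xor row i (removeAt x q)
    split-row x i = ∑-remove q (λ j → M i j ∧ x j)

    schur-row : ∀ x i → (schur M p q · x) i ≡ row (punchIn p i) x xor (M (punchIn p i) q ∧ row p x)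
    schur-row x i = begin
      (schur M p q · x) i
        ≡⟨ ∑-cong (λ j → solve 4 (λ a b c y → (a :+ (b :* c)) :* y := (a :* y) :+ (b :* (c :* y))) refl
             (M (punchIn p i) (punchIn q j)) (M (punchIn p i) q) (M p (punchIn q j)) (x j)) ⟩
      ∑ (λ j → (M (punchIn p i) (punchIn q j) ∧ x j) xor (M (punchIn p i) q ∧ (M p (punchIn q j) ∧ x j)))
        ≡⟨ ∑-xor _ _ ⟩
      row (punchIn p i) x xor ∑ (λ j → M (punchIn p i) q ∧ (M p (punchIn q j) ∧ x j))
        ≡⟨ cong (row (punchIn p i) x xor_) (∑-∧ˡ (M (punchIn p i) q) (λ j → M p (punchIn q j) ∧ x j)) ⟩
      row (punchIn p i) x xor (M (punchIn p i) q ∧ row p x) ∎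
      where open ≡-Reasoning

    extend : Cube n → Cube (suc n)
    extend x = insertAt x q (row p x)

    row-extend : ∀ i x → row i (removeAt (extend x) q) ≡ row i x
    row-extend i x = ∑-cong λ j → cong (M i (punchIn q j) ∧_) (insertAt-punchIn x q (row p x) j)

    extend-row : ∀ x i → (M · extend x) i ≡ (M i q ∧ row p x) xor row i x
    extend-row x i = trans (split-row (extend x) i)
      (cong₂ (λ a b → (M i q ∧ a) xor b) (insertAt-lookup x q (row p x)) (row-extend i x))

    extend-kernel : ∀ x → Kernel (schur M p q) x → Kernel M (extend x)
    extend-kernel x kx i with p ≟F i
    ... | yes refl = trans (extend-row x p) (trans (cong (λ a → (a ∧ row p x) xor row p x) pivot) (xor-self (row p x)))
    ... | no p≢i   = subst (λ i → (M · extend x) i ≡ false) (punchIn-punchOut p≢i)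
      (trans (extend-row x _) (trans (Boolₚ.xor-comm (M _ q ∧ row p x) (row _ x))
        (trans (sym (schur-row x (punchOut p≢i))) (kx (punchOut p≢i)))))

    pivot-coordinate : ∀ x → Kernel M x → x q ≡ row p (removeAt x q)
    pivot-coordinate x kx =
      xor≡false⇒≡ (trans (cong (λ a → (a ∧ x q) xor row p (removeAt x q)) (sym pivot)) (trans (sym (split-row x p)) (kx p)))

    remove-kernel : ∀ x → Kernel M x → Kernel (schur M p q) (removeAt x q)
    remove-kernel x kx i = trans (schur-row (removeAt x q) i)
      (trans (Boolₚ.xor-comm (row (punchIn p i) (removeAt x q)) _)
      (trans (cong (λ a → (M (punchIn p i) q ∧ a) xor row (punchIn p i) (removeAt x q)) (sym (pivot-coordinate x kx)))
      (trans (sym (split-row x (punchIn p i))) (kx (punchIn p i)))))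

    extend-unique : ∀ x → x q ≡ row p (removeAt x q) → ∀ y → y ≗ removeAt x q → extend y ≗ x
    extend-unique x xq y eq j with q ≟F j
    ... | yes refl = trans (insertAt-lookup y q (row p y))
                       (trans (∑-cong λ l → cong (M p (punchIn q l) ∧_) (eq l)) (sym xq))
    ... | no q≢j   = subst (λ j → extend y j ≡ x j) (punchIn-punchOut q≢j)
                       (trans (insertAt-punchIn y q (row p y) _) (eq _))

    extend-cong : ∀ {x y} → x ≗ y → extend x ≗ extend y
    extend-cong {x} {y} eq = extend-unique (extend y)
      (trans (insertAt-lookup y q (row p y)) (sym (row-extend p y)))
      x (λ j → trans (eq j) (sym (insertAt-punchIn y q (row p y) j)))

  -- Row `p` expresses coordinate `q` of a kernel vector through the others, so deleting that
  -- coordinate and restoring it by `extend` are inverse maps between the two kernels.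
  schur-parametrisation : ∀ {k} → Parametrisation (schur M p q) k → Parametrisation M k
  schur-parametrisation P = record
    { vector     = extend ∘ vector
    ; congruent  = extend-cong ∘ congruent
    ; kernel     = λ c → extend-kernel (vector c) (kernel c)
    ; injective  = λ c c′ eq → injective c c′ λ j →
        trans (sym (insertAt-punchIn (vector c) q _ j)) (trans (eq (punchIn q j)) (insertAt-punchIn (vector c′) q _ j))
    ; surjective = λ x kx → let c , eq = surjective (removeAt x q) (remove-kernel x kx)
                            in c , extend-unique x (pivot-coordinate x kx) (vector c) eq
    } where open Parametrisation P

-- Rank-nullity for M and its transpose at once: n − k and m − l are both the rank of M.
rank-nullity : ∀ {m n} (M : Matrix m n) →
               ∃ λ k → ∃ λ l → Parametrisation M k × Parametrisation (flip M) l × k + m ≡ l + n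
rank-nullity {zero}  {n}     M = n , 0 , zero-parametrisation (λ ()) , zero-parametrisation (λ _ ()) , ℕₚ.+-comm n 0
rank-nullity {suc m} {zero}  M = 0 , suc m , zero-parametrisation (λ _ ()) , zero-parametrisation (λ ()) , sym (ℕₚ.+-comm (suc m) 0)
rank-nullity {suc m} {suc n} M with any? (λ i → any? (λ j → M i j Boolₚ.≟ true))
... | no ¬p = suc n , suc m , zero-parametrisation M≡0 , zero-parametrisation (λ j i → M≡0 i j) , ℕₚ.+-comm (suc n) (suc m)
  where
  M≡0 : ∀ i j → M i j ≡ false
  M≡0 i j = ≢true⇒≡false (λ eq → ¬p (i , j , eq))
... | yes (p , q , pivot) with rank-nullity (schur M p q)
...   | k , l , P , Q , eq =
  k , l , schur-parametrisation M p q pivot P ,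
  -- The Schur complement of the transpose is the transposed Schur complement, up to the order of a
  -- conjunction.
  schur-parametrisation (flip M) q p pivot
    (parametrisation-cong (λ j i → cong (M (punchIn p i) (punchIn q j) xor_) (∧-comm (M (punchIn p i) q) (M p (punchIn q j)))) Q) ,
  trans (ℕₚ.+-suc k m) (trans (cong suc eq) (sym (ℕₚ.+-suc l n)))

prepend : ∀ {l} → Bool → Cube l → Cube (suc l)
prepend b c zero    = b
prepend b c (suc i) = c i

abstract
  -- The image of ν has dimension f − 1, the kernel of the transpose at most e − v + 1, and euler makes these equal.
  exactness : ∀ {e v f} (M : Matrix e v) (v₀ : Fin v) (f₀ : Fin f) (ν : Cube f → Cube e) →
              v + f ≡ e + 2 →
              (∀ a → Kernel M a → ∀ i → a i ≡ a v₀) →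
              (∀ b → Kernel (flip M) (ν b)) →
              (∀ b b′ → ν b ≗ ν b′ → b f₀ ≡ b′ f₀ → b ≗ b′) →
              ∀ z → Kernel (flip M) z → ∀ c → ∃ λ b → ν b ≗ z × b f₀ ≡ c
  exactness {e} {v} {f} M v₀ f₀ ν euler const orth inj z kz c with rank-nullity M
  ... | k , l , P , Q , eq = let b , hit = cube-injective⇒surjective g g-injective l<f (prepend c (coordinates z kz))
                             in b , (λ i → trans (coordinates-vector (ν b) (orth b) i)
                                      (trans (Q.congruent (hit ∘ suc) i) (sym (coordinates-vector z kz i)))) , hit zero
    where
    module P = Parametrisation P
    module Q = Parametrisation Q
    -- Kernel vectors of `M` are constant, so the one bit at `v₀` determines them.
    k≤1 : k ≤ 1
    k≤1 = cube-injective⇒≤ {k} {1} (λ x _ → P.vector x v₀) λ x y h → P.injective x y λ i →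
      trans (const _ (P.kernel x) i) (trans (h zero) (sym (const _ (P.kernel y) i)))
    l<f : suc l ≤ f
    l<f = ℕₚ.+-cancelˡ-≤ v (suc l) f (begin
      v + suc l    ≡⟨ ℕₚ.+-comm v (suc l) ⟩
      suc (l + v)  ≡⟨ cong suc (sym eq) ⟩
      suc (k + e)  ≤⟨ s≤s (ℕₚ.+-monoˡ-≤ e k≤1) ⟩
      2 + e        ≡⟨ ℕₚ.+-comm 2 e ⟩
      e + 2        ≡⟨ sym euler ⟩
      v + f        ∎) where open ℕₚ.≤-Reasoning
    coordinates : ∀ y → Kernel (flip M) y → Cube l
    coordinates y ky = proj₁ (Q.surjective y ky)
    coordinates-vector : ∀ y ky → y ≗ Q.vector (coordinates y ky)
    coordinates-vector y ky i = sym (proj₂ (Q.surjective y ky) i)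
    -- `ν` forgets an additive constant; the extra bit `b f₀` restores injectivity and lets
    -- surjectivity prescribe that constant as `c`.
    g : Cube f → Cube (suc l)
    g b = prepend (b f₀) (coordinates (ν b) (orth b))
    g-injective : CubeInjective g
    g-injective b b′ h = inj b b′
      (λ i → trans (coordinates-vector (ν b) (orth b) i)
               (trans (Q.congruent (h ∘ suc) i) (sym (coordinates-vector (ν b′) (orth b′) i))))
      (h zero)

-- Finite enumerations and orbits of permutations

record Enum (A : Set) (n : ℕ) : Set where
  field
    el    : Fin n → A
    ix    : A → Fin n
    el-ix : ∀ a → el (ix a) ≡ a
    ix-el : ∀ i → ix (el i) ≡ i

  ix-injective : ∀ {a b} → ix a ≡ ix b → a ≡ b
  ix-injective {a} {b} eq = trans (sym (el-ix a)) (trans (cong el eq) (el-ix b))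

  el-injective : ∀ {i j} → el i ≡ el j → i ≡ j
  el-injective {i} {j} eq = trans (sym (ix-el i)) (trans (cong ix eq) (ix-el j))

  _≟ᴱ_ : DecidableEquality A
  a ≟ᴱ b with ix a ≟F ix b
  ... | yes p = yes (ix-injective p)
  ... | no ¬p = no (¬p ∘ cong ix)

enum-size : ∀ {A m n} → Enum A m → Enum A n → m ≡ n
enum-size P Q = ℕₚ.≤-antisym
  (injective⇒≤ {f = Q.ix ∘ P.el} (P.el-injective ∘ Q.ix-injective))
  (injective⇒≤ {f = P.ix ∘ Q.el} (Q.el-injective ∘ P.ix-injective))
  where
  module P = Enum P
  module Q = Enum Q

enum-map : ∀ {A B n} (f : A → B) (g : B → A) → (∀ b → f (g b) ≡ b) → (∀ a → g (f a) ≡ a) → Enum A n → Enum B n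
enum-map f g fg gf P = record
  { el = f ∘ P.el ; ix = P.ix ∘ g
  ; el-ix = λ b → trans (cong f (P.el-ix (g b))) (fg b)
  ; ix-el = λ i → trans (cong P.ix (gf (P.el i))) (P.ix-el i) }
  where module P = Enum P

enum-Fin : ∀ {n} → Enum (Fin n) n
enum-Fin = record { el = id ; ix = id ; el-ix = λ _ → refl ; ix-el = λ _ → refl }

enum-⊎ : ∀ {A B m n} → Enum A m → Enum B n → Enum (A ⊎ B) (m + n)
enum-⊎ {A} {B} {m} {n} P Q = enum-map to from to-from from-to enum-Fin
  where
  module P = Enum P
  module Q = Enum Q
  to : Fin (m + n) → A ⊎ B
  to = [ inj₁ ∘ P.el , inj₂ ∘ Q.el ]′ ∘ splitAt m
  from : A ⊎ B → Fin (m + n)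
  from = [ (λ a → P.ix a ↑ˡ n) , (λ b → m ↑ʳ Q.ix b) ]′
  to-from : ∀ x → to (from x) ≡ x
  to-from (inj₁ a) rewrite Finₚ.splitAt-↑ˡ m (P.ix a) n = cong inj₁ (P.el-ix a)
  to-from (inj₂ b) rewrite Finₚ.splitAt-↑ʳ m n (Q.ix b) = cong inj₂ (Q.el-ix b)
  from-to : ∀ i → from (to i) ≡ i
  from-to i with splitAt m i in eq
  ... | inj₁ j = trans (cong (_↑ˡ n) (P.ix-el j)) (Finₚ.splitAt⁻¹-↑ˡ eq)
  ... | inj₂ j = trans (cong (m ↑ʳ_) (Q.ix-el j)) (Finₚ.splitAt⁻¹-↑ʳ eq)

enum-Σ : ∀ {k} {f : Fin k → ℕ} {B : Fin k → Set} → (∀ i → Enum (B i) (f i)) → Enum (Σ (Fin k) B) (sumFin f)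
enum-Σ {zero}          E = record { el = λ () ; ix = λ () ; el-ix = λ () ; ix-el = λ () }
enum-Σ {suc k} {f} {B} E = enum-map to from to-from from-to (enum-⊎ (E zero) (enum-Σ (E ∘ suc)))
  where
  to : B zero ⊎ Σ (Fin k) (B ∘ suc) → Σ (Fin (suc k)) B
  to (inj₁ b)       = zero , b
  to (inj₂ (i , b)) = suc i , b
  from : Σ (Fin (suc k)) B → B zero ⊎ Σ (Fin k) (B ∘ suc)
  from (zero , b)  = inj₁ b
  from (suc i , b) = inj₂ (i , b)
  to-from : ∀ x → to (from x) ≡ x
  to-from (zero , b)  = refl
  to-from (suc i , b) = refl
  from-to : ∀ x → from (to x) ≡ x
  from-to (inj₁ b)       = refl
  from-to (inj₂ (i , b)) = refl

countTrue≡sumFin : ∀ {k} (p : Fin k → Bool) → countTrue p ≡ sumFin (λ i → if p i then 1 else 0)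
countTrue≡sumFin {zero}  p = refl
countTrue≡sumFin {suc k} p = cong ((if p zero then 1 else 0) +_) (countTrue≡sumFin (p ∘ suc))

enum-T : ∀ b → Enum (T b) (if b then 1 else 0)
enum-T false = record { el = λ () ; ix = λ () ; el-ix = λ () ; ix-el = λ () }
enum-T true  = record { el = λ _ → tt ; ix = λ _ → zero ; el-ix = λ _ → refl ; ix-el = λ { zero → refl } }

enum-filter : ∀ {k} (p : Fin k → Bool) → Enum (Σ (Fin k) (T ∘ p)) (countTrue p)
enum-filter p = subst (Enum _) (sym (countTrue≡sumFin p)) (enum-Σ (enum-T ∘ p))

module EnumSum {A : Set} {n : ℕ} (enum : Enum A n) where
  open Enum enum

  abstract
    ∑ᴱ : (A → Bool) → Bool
    ∑ᴱ f = ∑ (f ∘ el)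

    ∑ᴱ-cong : ∀ {f g : A → Bool} → (∀ a → f a ≡ g a) → ∑ᴱ f ≡ ∑ᴱ g
    ∑ᴱ-cong h = ∑-cong (h ∘ el)

    ∑ᴱ-zero : ∀ {f : A → Bool} → (∀ a → f a ≡ false) → ∑ᴱ f ≡ false
    ∑ᴱ-zero h = ∑-zero (h ∘ el)

    ∑ᴱ-single : ∀ {f : A → Bool} a → (∀ b → b ≢ a → f b ≡ false) → ∑ᴱ f ≡ f a
    ∑ᴱ-single {f} a h = trans
      (∑-single (ix a) λ j j≢ → h (el j) λ eq → j≢ (trans (sym (ix-el j)) (cong ix eq)))
      (cong f (el-ix a))

    ∑ᴱ-true : ∀ {f : A → Bool} → ∑ᴱ f ≡ true → ∃ λ a → f a ≡ true
    ∑ᴱ-true h = let i , p = ∑-true h in el i , p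

    ∑ᴱ-xor : ∀ (f g : A → Bool) → ∑ᴱ (λ a → f a xor g a) ≡ ∑ᴱ f xor ∑ᴱ g
    ∑ᴱ-xor f g = ∑-xor (f ∘ el) (g ∘ el)

    ∑ᴱ-∧ˡ : ∀ b (f : A → Bool) → ∑ᴱ (λ a → b ∧ f a) ≡ b ∧ ∑ᴱ f
    ∑ᴱ-∧ˡ b f = ∑-∧ˡ b (f ∘ el)

    ∑ᴱ-permute : ∀ (π π⁻¹ : A → A) → (∀ a → π (π⁻¹ a) ≡ a) → (∀ a → π⁻¹ (π a) ≡ a) →
                 ∀ (f : A → Bool) → ∑ᴱ (f ∘ π) ≡ ∑ᴱ f
    ∑ᴱ-permute π π⁻¹ ππ⁻¹ π⁻¹π f = trans (∑-cong λ i → sym (cong f (el-ix (π (el i))))) (∑-permute perm (f ∘ el))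
      where
      inverse : ∀ (α β : A → A) → (∀ a → α (β a) ≡ a) → ∀ i → ix (α (el (ix (β (el i))))) ≡ i
      inverse α β αβ i = trans (cong (ix ∘ α) (el-ix (β (el i)))) (trans (cong ix (αβ (el i))) (ix-el i))
      perm : Permutation n n
      perm = permutation (λ i → ix (π (el i))) (λ i → ix (π⁻¹ (el i))) (inverse π π⁻¹ ππ⁻¹) (inverse π⁻¹ π π⁻¹π)

    δᴱ : A → A → Bool
    δᴱ a b = does (a ≟ᴱ b)

    δᴱ-refl : ∀ a → δᴱ a a ≡ true
    δᴱ-refl a = dec-true (a ≟ᴱ a) refl

    δᴱ-≢ : ∀ {a b} → a ≢ b → δᴱ a b ≡ false
    δᴱ-≢ {a} {b} = dec-false (a ≟ᴱ b)

    δᴱ-≡ : ∀ {a b} → δᴱ a b ≡ true → a ≡ b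
    δᴱ-≡ {a} {b} = does-true (a ≟ᴱ b)

    ∑ᴱ-δ : ∀ a (f : A → Bool) → ∑ᴱ (λ b → δᴱ b a ∧ f b) ≡ f a
    ∑ᴱ-δ a f = trans (∑ᴱ-single a λ b b≢a → cong (_∧ f b) (δᴱ-≢ b≢a)) (cong (_∧ f a) (δᴱ-refl a))

    ∑ᴱ-swap : ∀ {k} (f : A → Fin k → Bool) → ∑ᴱ (λ a → ∑ (f a)) ≡ ∑ (λ i → ∑ᴱ λ a → f a i)
    ∑ᴱ-swap f = ∑-swap (λ i → f (el i))

-- By induction: the new index `zero` joins an existing class if it is related to some later index,
-- and otherwise opens a class of its own.
quotient : ∀ {n} (R : Fin n → Fin n → Set) → (∀ i j → Dec (R i j)) →
           (∀ i → R i i) → (∀ {i j} → R i j → R j i) → (∀ {i j k} → R i j → R j k → R i k) →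
           ∃ λ F → Σ (Fin F → Fin n) λ rep → (∀ i → ∃ λ c → R (rep c) i) × (∀ c c′ → R (rep c) (rep c′) → c ≡ c′)
quotient {zero}  R R? rfl sm tr = 0 , (λ ()) , (λ ()) , λ ()
quotient {suc n} R R? rfl sm tr
  with quotient (λ i j → R (suc i) (suc j)) (λ i j → R? (suc i) (suc j)) (λ i → rfl (suc i)) sm tr
     | any? (λ i → R? zero (suc i))
... | F , rep , cls , distinct | yes (i , r) = F , suc ∘ rep , cls′ , distinct
  where
  cls′ : ∀ j → ∃ λ c → R (suc (rep c)) j
  cls′ zero    = let c , s = cls i in c , tr s (sm r)
  cls′ (suc j) = cls j
... | F , rep , cls , distinct | no ¬r = suc F , rep′ , cls′ , distinct′
  where
  rep′ : Fin (suc F) → Fin (suc n)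
  rep′ zero    = zero
  rep′ (suc c) = suc (rep c)
  cls′ : ∀ j → ∃ λ c → R (rep′ c) j
  cls′ zero    = zero , rfl zero
  cls′ (suc j) = let c , s = cls j in suc c , s
  distinct′ : ∀ c c′ → R (rep′ c) (rep′ c′) → c ≡ c′
  distinct′ zero    zero     _ = refl
  distinct′ zero    (suc c′) r = contradiction (rep c′ , r) ¬r
  distinct′ (suc c) zero     r = contradiction (rep c , sm r) ¬r
  distinct′ (suc c) (suc c′) r = cong suc (distinct c c′ r)

iter-+ : ∀ {A : Set} (f : A → A) m n x → iter f (m + n) x ≡ iter f m (iter f n x)
iter-+ f zero    n x = refl
iter-+ f (suc m) n x = cong f (iter-+ f m n x)

iter-invariant : ∀ {A B : Set} (g : A → B) (f : A → A) → (∀ a → g (f a) ≡ g a) → ∀ k a → g (iter f k a) ≡ g a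
iter-invariant g f inv zero    a = refl
iter-invariant g f inv (suc k) a = trans (inv (iter f k a)) (iter-invariant g f inv k a)

Reach : {A : Set} → (A → A) → A → A → Set
Reach π d d′ = Σ ℕ λ k → iter π k d ≡ d′

reach-trans : ∀ {A : Set} {π : A → A} {a b c} → Reach π a b → Reach π b c → Reach π a c
reach-trans {π = π} {a} (k , p) (l , q) = l + k , trans (iter-+ π l k a) (trans (cong (iter π l) p) q)

-- The numbered orbits of `π`. One record counts vertices (orbits of `σ`), edges (of `rev`) and
-- faces (of `faceStep`).
record Classes {A : Set} (π : A → A) (F : ℕ) : Set where
  field
    rep     : Fin F → A
    cls     : A → Fin F
    cls-rep : ∀ i → cls (rep i) ≡ i
    cls-π   : ∀ a → cls (π a) ≡ cls a
    reach   : ∀ a → Reach π (rep (cls a)) a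

  cls-reach : ∀ {a b} → Reach π a b → cls a ≡ cls b
  cls-reach {a} (k , p) = trans (sym (iter-invariant cls π cls-π k a)) (cong cls p)

  invariant-rep : ∀ {B : Set} (g : A → B) → (∀ a → g (π a) ≡ g a) → ∀ a → g a ≡ g (rep (cls a))
  invariant-rep g inv a = let k , p = reach a in trans (cong g (sym p)) (iter-invariant g π inv k (rep (cls a)))

module Orbits {A : Set} {n : ℕ} (enum : Enum A n) (π : A → A) (π-injective : ∀ {a b} → π a ≡ π b → a ≡ b) where
  open Enum enum

  iter-injective : ∀ k {a b} → iter π k a ≡ iter π k b → a ≡ b
  iter-injective zero    eq = eq
  iter-injective (suc k) eq = iter-injective k (π-injective eq)

  -- Two of the first `n + 1` iterates coincide; cancelling the common steps leaves a positive
  -- period.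
  period : ∀ a → ∃ λ k → iter π (suc k) a ≡ a
  period a with Finₚ.pigeonhole (ℕₚ.n<1+n n) (λ i → ix (iter π (toℕ i) a))
  ... | i , j , i<j , eq = let k , i+k = ℕₚ.m≤n⇒∃[o]m+o≡n i<j in
    k , iter-injective (toℕ i) (begin
      iter π (toℕ i) (iter π (suc k) a)  ≡⟨ sym (iter-+ π (toℕ i) (suc k) a) ⟩
      iter π (toℕ i + suc k) a           ≡⟨ cong (λ m → iter π m a) (trans (ℕₚ.+-suc (toℕ i) k) i+k) ⟩
      iter π (toℕ j) a                   ≡⟨ sym (ix-injective eq) ⟩
      iter π (toℕ i) a                   ∎)
    where open ≡-Reasoning

  iter-multiple : ∀ m p {a} → iter π p a ≡ a → iter π (m * p) a ≡ a
  iter-multiple zero    p     eq = refl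
  iter-multiple (suc m) p {a} eq = trans (iter-+ π p (m * p) a) (trans (cong (iter π p) (iter-multiple m p eq)) eq)

  -- Going back `k` steps is going forward `k * p` steps, since both together make `k * suc p`, a
  -- multiple of the period.
  reach-sym : ∀ {a b} → Reach π a b → Reach π b a
  reach-sym {a} {b} (k , eq) = let p , per = period a in k * p , (begin
    iter π (k * p) b             ≡⟨ cong (iter π (k * p)) (sym eq) ⟩
    iter π (k * p) (iter π k a)  ≡⟨ sym (iter-+ π (k * p) k a) ⟩
    iter π (k * p + k) a         ≡⟨ cong (λ m → iter π m a) (trans (ℕₚ.+-comm (k * p) k) (sym (ℕₚ.*-suc k p))) ⟩
    iter π (k * suc p) a         ≡⟨ iter-multiple k (suc p) per ⟩
    a                            ∎)
    where open ≡-Reasoning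

  -- The number of steps can be reduced modulo the period, which makes the search finite.
  reach? : ∀ a b → Dec (Reach π a b)
  reach? a b with period a
  ... | p , per with any? {n = suc p} (λ i → iter π (toℕ i) a ≟ᴱ b)
  ...   | yes (i , eq) = yes (toℕ i , eq)
  ...   | no ¬r = no λ (k , eq) → ¬r (fromℕ< (m%n<n k (suc p)) , (begin
    iter π (toℕ (fromℕ< (m%n<n k (suc p)))) a  ≡⟨ cong (λ m → iter π m a) (Finₚ.toℕ-fromℕ< (m%n<n k (suc p))) ⟩
    iter π (k % suc p) a                               ≡⟨ cong (iter π (k % suc p)) (sym (iter-multiple (k / suc p) (suc p) per)) ⟩
    iter π (k % suc p) (iter π (k / suc p * suc p) a)  ≡⟨ sym (iter-+ π (k % suc p) (k / suc p * suc p) a) ⟩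
    iter π (k % suc p + k / suc p * suc p) a           ≡⟨ cong (λ m → iter π m a) (sym (m≡m%n+[m/n]*n k (suc p))) ⟩
    iter π k a                                         ≡⟨ eq ⟩
    b                                                  ∎))
    where open ≡-Reasoning

  classes-from : ∀ {F} → (Σ (Fin F → A) λ rep → (∀ a → Σ (Fin F) λ i → Reach π (rep i) a) ×
                                                 (∀ i j → Reach π (rep i) (rep j) → i ≡ j)) → Classes π F
  classes-from (rep , cls , distinct) = record
    { rep     = rep
    ; cls     = proj₁ ∘ cls
    ; cls-rep = λ i → distinct _ _ (proj₂ (cls (rep i)))
    ; cls-π   = λ a → distinct _ _ (reach-trans (proj₂ (cls (π a)))
                  (reach-sym (reach-trans (proj₂ (cls a)) (1 , refl))))
    ; reach   = proj₂ ∘ cls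
    }

  orbits : ∃ λ F → Classes π F
  orbits with quotient (λ i j → Reach π (el i) (el j)) (λ i j → reach? (el i) (el j)) (λ i → 0 , refl) reach-sym reach-trans
  ... | F , rep , cls , distinct = F , classes-from
    (el ∘ rep , (λ a → let c , r = cls (ix a) in c , subst (Reach π (el (rep c))) (el-ix a) r) , distinct)

  same : ∀ {F} (C : Classes π F) {a b} → Classes.cls C a ≡ Classes.cls C b → Reach π a b
  same C {a} {b} eq = reach-trans (reach-sym (reach a)) (subst (λ i → Reach π (rep i) b) (sym eq) (reach b))
    where open Classes C

-- Exactness of the cellular cochain complex of a map on the sphere

module Edges {D : Set} {n : ℕ} (enum : Enum D n)
             (τ : D → D) (ττ : ∀ d → τ (τ d) ≡ d) (τ≢ : ∀ d → τ d ≢ d)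
             {E : ℕ} (Cτ : Classes τ E) where
  open Enum enum
  open EnumSum enum
  open Classes Cτ

  iter-τ : ∀ k d → iter τ k d ≡ d ⊎ iter τ k d ≡ τ d
  iter-τ zero    d = inj₁ refl
  iter-τ (suc k) d with iter-τ k d
  ... | inj₁ p = inj₂ (cong τ p)
  ... | inj₂ p = inj₁ (trans (cong τ p) (ττ d))

  edge-cases : ∀ d → d ≡ rep (cls d) ⊎ d ≡ τ (rep (cls d))
  edge-cases d with reach d
  ... | k , p with iter-τ k (rep (cls d))
  ...   | inj₁ q = inj₁ (trans (sym p) q)
  ...   | inj₂ q = inj₂ (trans (sym p) q)

  by-edges : (P : D → Set) → (∀ e → P (rep e)) → (∀ e → P (τ (rep e))) → ∀ d → P d
  by-edges P f g d with edge-cases d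
  ... | inj₁ p = subst P (sym p) (f (cls d))
  ... | inj₂ p = subst P (sym p) (g (cls d))

  -- The two darts of `e` are distinct because `τ` has no fixed point, so at most one summand is
  -- true and `xor` acts as a disjunction.
  δ-cls : ∀ e d → δ (cls d) e ≡ δᴱ d (rep e) xor δᴱ d (τ (rep e))
  δ-cls e d with cls d ≟F e
  ... | no ¬p = sym (cong₂ _xor_ (δᴱ-≢ λ { refl → ¬p (cls-rep e) })
                                 (δᴱ-≢ λ { refl → ¬p (trans (cls-π (rep e)) (cls-rep e)) }))
  ... | yes refl with edge-cases d
  ...   | inj₁ p = sym (cong₂ _xor_ (trans (cong (δᴱ d) (sym p)) (δᴱ-refl d))
                          (trans (cong (δᴱ d ∘ τ) (sym p)) (δᴱ-≢ (τ≢ d ∘ sym))))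
  ...   | inj₂ p = sym (cong₂ _xor_
                     (trans (cong (δᴱ d) (trans (sym (ττ _)) (cong τ (sym p)))) (δᴱ-≢ (τ≢ d ∘ sym)))
                     (trans (cong (δᴱ d) (sym p)) (δᴱ-refl d)))

  ∑ᴱ-edges : ∀ f → ∑ᴱ f ≡ ∑ (λ e → f (rep e) xor f (τ (rep e)))
  ∑ᴱ-edges f = begin
    ∑ᴱ f
      ≡⟨ ∑ᴱ-cong (λ d → sym (∑-δ (cls d) (λ _ → f d))) ⟩
    ∑ᴱ (λ d → ∑ λ e → δ (cls d) e ∧ f d)
      ≡⟨ ∑ᴱ-swap (λ d e → δ (cls d) e ∧ f d) ⟩
    ∑ (λ e → ∑ᴱ λ d → δ (cls d) e ∧ f d)
      ≡⟨ ∑-cong (λ e → begin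
        ∑ᴱ (λ d → δ (cls d) e ∧ f d)
          ≡⟨ ∑ᴱ-cong (λ d → trans (cong (_∧ f d) (δ-cls e d)) (Boolₚ.∧-distribʳ-xor (f d) (δᴱ d (rep e)) (δᴱ d (τ (rep e))))) ⟩
        ∑ᴱ (λ d → (δᴱ d (rep e) ∧ f d) xor (δᴱ d (τ (rep e)) ∧ f d))
          ≡⟨ ∑ᴱ-xor (λ d → δᴱ d (rep e) ∧ f d) (λ d → δᴱ d (τ (rep e)) ∧ f d) ⟩
        ∑ᴱ (λ d → δᴱ d (rep e) ∧ f d) xor ∑ᴱ (λ d → δᴱ d (τ (rep e)) ∧ f d)
          ≡⟨ cong₂ _xor_ (∑ᴱ-δ (rep e) f) (∑ᴱ-δ (τ (rep e)) f) ⟩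
        f (rep e) xor f (τ (rep e)) ∎) ⟩
    ∑ (λ e → f (rep e) xor f (τ (rep e))) ∎
    where open ≡-Reasoning

  twice-edges : n ≡ E + E
  twice-edges = enum-size enum (enum-map to from to-from from-to (enum-⊎ enum-Fin enum-Fin))
    where
    to : Fin E ⊎ Fin E → D
    to (inj₁ e) = rep e
    to (inj₂ e) = τ (rep e)
    from : D → Fin E ⊎ Fin E
    from d with d ≟ᴱ rep (cls d)
    ... | yes _ = inj₁ (cls d)
    ... | no _  = inj₂ (cls d)
    to-from : ∀ d → to (from d) ≡ d
    to-from d with d ≟ᴱ rep (cls d)
    ... | yes p = sym p
    ... | no ¬p with edge-cases d
    ...   | inj₁ p = contradiction p ¬p
    ...   | inj₂ p = sym p
    from-to : ∀ x → from (to x) ≡ x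
    from-to (inj₁ e) with rep e ≟ᴱ rep (cls (rep e))
    ... | yes _ = cong inj₁ (cls-rep e)
    ... | no ¬p = contradiction (cong rep (sym (cls-rep e))) ¬p
    from-to (inj₂ e) with τ (rep e) ≟ᴱ rep (cls (τ (rep e)))
    ... | yes p = contradiction (trans p (cong rep (trans (cls-π (rep e)) (cls-rep e)))) (τ≢ (rep e))
    ... | no _  = cong inj₂ (trans (cls-π (rep e)) (cls-rep e))

  -- As `τ` is an involution, `β` = `α` ∘ `τ` gives back `α` = `β` ∘ `τ`. Exchanging the two
  -- permutations passes to the dual map, so one proof yields exactness at vertices and at faces.
  -- Connectivity is phrased by invariant functions in order to be symmetric too.
  module Exact (α α⁻¹ β : D → D) (αα⁻¹ : ∀ d → α (α⁻¹ d) ≡ d) (α⁻¹α : ∀ d → α⁻¹ (α d) ≡ d)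
               (β≡ατ : ∀ d → β d ≡ α (τ d))
               (connected : ∀ (g : D → Bool) → (∀ d → g (α d) ≡ g d) → (∀ d → g (τ d) ≡ g d) → ∀ d d′ → g d ≡ g d′)
               {V F : ℕ} (Cα : Classes α V) (Cβ : Classes β F) (euler : V + F ≡ E + 2) where
    module A = Classes Cα
    module B = Classes Cβ

    -- The incidence matrix, acting as the coboundary from vertices to edges; its transpose is
    -- `boundary`.
    M : Matrix E V
    M e v = δ (A.cls (rep e)) v xor δ (A.cls (τ (rep e))) v

    M-value : ∀ a e → (M · a) e ≡ a (A.cls (rep e)) xor a (A.cls (τ (rep e)))
    M-value a e = trans (∑-cong λ v → Boolₚ.∧-distribʳ-xor (a v) (δ (A.cls (rep e)) v) (δ (A.cls (τ (rep e))) v))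
      (trans (∑-xor _ _) (cong₂ _xor_ (∑-δ (A.cls (rep e)) a) (∑-δ (A.cls (τ (rep e))) a)))

    boundary : (D → Bool) → Fin V → Bool
    boundary z v = ∑ᴱ λ d → δ (A.cls d) v ∧ z d

    boundary-value : ∀ z → (∀ d → z (τ d) ≡ z d) → ∀ v → (flip M · (z ∘ rep)) v ≡ boundary z v
    boundary-value z zτ v = trans
      (∑-cong λ e → trans (Boolₚ.∧-distribʳ-xor (z (rep e)) (δ (A.cls (rep e)) v) (δ (A.cls (τ (rep e))) v))
        (cong (λ y → (δ (A.cls (rep e)) v ∧ z (rep e)) xor (δ (A.cls (τ (rep e))) v ∧ y)) (sym (zτ (rep e)))))
      (sym (∑ᴱ-edges (λ d → δ (A.cls d) v ∧ z d)))

    coboundary : (Fin F → Bool) → D → Bool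
    coboundary b d = b (B.cls d) xor b (B.cls (τ d))

    coboundary-τ : ∀ b d → coboundary b (τ d) ≡ coboundary b d
    coboundary-τ b d = trans (cong (λ d′ → b (B.cls (τ d)) xor b (B.cls d′)) (ττ d))
                             (Boolₚ.xor-comm (b (B.cls (τ d))) (b (B.cls d)))

    clsβτ : ∀ d → B.cls (τ d) ≡ B.cls (α d)
    clsβτ d = trans (sym (B.cls-π (τ d))) (cong B.cls (trans (β≡ατ (τ d)) (cong α (ττ d))))

    -- By `clsβτ`, the far side of `d` is the near side of the next dart `α d` at the same vertex;
    -- reindexing by `α` shows that each value is counted twice.
    coboundary⇒closed : ∀ b v → boundary (coboundary b) v ≡ false
    coboundary⇒closed b v = begin
      boundary (coboundary b) v
        ≡⟨ ∑ᴱ-cong (λ d → Boolₚ.∧-distribˡ-xor (δ (A.cls d) v) (b (B.cls d)) (b (B.cls (τ d)))) ⟩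
      ∑ᴱ (λ d → h d xor (δ (A.cls d) v ∧ b (B.cls (τ d))))
        ≡⟨ ∑ᴱ-xor h (λ d → δ (A.cls d) v ∧ b (B.cls (τ d))) ⟩
      ∑ᴱ h xor ∑ᴱ (λ d → δ (A.cls d) v ∧ b (B.cls (τ d)))
        ≡⟨ cong (∑ᴱ h xor_) (trans
             (∑ᴱ-cong λ d → cong₂ (λ i f → δ i v ∧ b f) (sym (A.cls-π d)) (clsβτ d))
             (∑ᴱ-permute α α⁻¹ αα⁻¹ α⁻¹α h)) ⟩
      ∑ᴱ h xor ∑ᴱ h
        ≡⟨ xor-self (∑ᴱ h) ⟩
      false ∎
      where
      open ≡-Reasoning
      h : D → Bool
      h d = δ (A.cls d) v ∧ b (B.cls d)

    α-constant : ∀ a → (∀ d → a (A.cls d) ≡ a (A.cls (τ d))) → ∀ i j → a i ≡ a j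
    α-constant a aτ i j = subst₂ (λ i j → a i ≡ a j) (A.cls-rep i) (A.cls-rep j)
      (connected (a ∘ A.cls) (λ d → cong a (A.cls-π d)) (λ d → sym (aτ d)) (A.rep i) (A.rep j))

    coboundary-zero⇒constant : ∀ b → (∀ d → b (B.cls d) ≡ b (B.cls (τ d))) → ∀ i j → b i ≡ b j
    coboundary-zero⇒constant b bτ i j = subst₂ (λ i j → b i ≡ b j) (B.cls-rep i) (B.cls-rep j)
      (connected (b ∘ B.cls) (λ d → trans (cong b (sym (clsβτ d))) (sym (bτ d))) (λ d → sym (bτ d)) (B.rep i) (B.rep j))

    symmetric : ∀ {X : Set} (g : D → X) → (∀ e → g (rep e) ≡ g (τ (rep e))) → ∀ d → g d ≡ g (τ d)
    symmetric g h = by-edges (λ d → g d ≡ g (τ d)) h λ e → trans (sym (h e)) (cong g (sym (ττ (rep e))))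

    ν : Cube F → Cube E
    ν b e = coboundary b (rep e)

    const : D → ∀ a → Kernel M a → ∀ i j → a i ≡ a j
    const d₀ a ka = α-constant a (symmetric (a ∘ A.cls) λ e → xor≡false⇒≡ (trans (sym (M-value a e)) (ka e)))

    ν-injective : ∀ f₀ b b′ → ν b ≗ ν b′ → b f₀ ≡ b′ f₀ → b ≗ b′
    ν-injective f₀ b b′ eq eq₀ f = xor≡false⇒≡ (trans
      (coboundary-zero⇒constant (λ i → b i xor b′ i)
        (symmetric (λ d → b (B.cls d) xor b′ (B.cls d)) λ e → xor≡false⇒≡
          (trans (solve 4 (λ p q r s → (p :+ q) :+ (r :+ s) := (p :+ r) :+ (q :+ s)) refl
                   (b (B.cls (rep e))) (b′ (B.cls (rep e))) (b (B.cls (τ (rep e)))) (b′ (B.cls (τ (rep e)))))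
            (trans (cong (_xor ν b′ e) (eq e)) (xor-self (ν b′ e))))) f f₀)
      (trans (cong (_xor b′ f₀) eq₀) (xor-self (b′ f₀))))

    -- The function `b` is determined up to a constant only, so its value at one dart can be
    -- prescribed as `c`; later normalisations rely on this.
    closed⇒coboundary : ∀ z → (∀ d → z (τ d) ≡ z d) → (∀ v → ∑ᴱ (λ d → δ (A.cls d) v ∧ z d) ≡ false) →
                        ∀ d₀ c → ∃ λ (b : Fin F → Bool) → (∀ d → z d ≡ b (B.cls d) xor b (B.cls (τ d))) × b (B.cls d₀) ≡ c
    closed⇒coboundary z zτ closed d₀ c =
      let b , eq , eq₀ = exactness M (A.cls d₀) (B.cls d₀) ν euler
                           (λ a ka i → const d₀ a ka i (A.cls d₀))
                           (λ b v → trans (boundary-value (coboundary b) (coboundary-τ b) v) (coboundary⇒closed b v))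
                           (ν-injective (B.cls d₀)) (z ∘ rep) (λ v → trans (boundary-value z zτ v) (closed v)) c
      in b , by-edges (λ d → z d ≡ coboundary b d) (λ e → sym (eq e))
               (λ e → trans (zτ (rep e)) (trans (sym (eq e)) (sym (coboundary-τ b (rep e))))) , eq₀

-- Rotation systems of cubic graphs

module Darts (G : Graph) where
  open Graph G public

  head : Dart G → Fin n
  head d = proj₂ (proj₁ d)

  dart-≡ : {d d′ : Dart G} → tail G d ≡ tail G d′ → head d ≡ head d′ → d ≡ d′
  dart-≡ {(u , v) , e} {(_ , _) , e′} refl refl = cong ((u , v) ,_) (T-irrelevant e e′)

  rev-rev : ∀ d → rev G (rev G d) ≡ d
  rev-rev d = dart-≡ refl refl

  tail≢head : ∀ d → tail G d ≢ head d
  tail≢head ((u , .u) , e) refl = subst T (adj-irrefl u) e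

  rev-≢ : ∀ d → rev G d ≢ d
  rev-≢ d eq = tail≢head d (sym (cong (tail G) eq))

  rev-injective : ∀ {d d′} → rev G d ≡ rev G d′ → d ≡ d′
  rev-injective eq = dart-≡ (cong head eq) (cong (tail G) eq)

  neighbours : ∀ u → Enum (Σ (Fin n) (T ∘ adj u)) (degree G u)
  neighbours u = enum-filter (adj u)

  abstract
    darts : Enum (Dart G) (degreeSum G)
    darts = enum-map (λ (u , v , e) → (u , v) , e) (λ ((u , v) , e) → u , v , e) (λ _ → refl) (λ _ → refl) (enum-Σ neighbours)

  crosses : (Fin n → Bool) → Dart G → Bool
  crosses a d = a (tail G d) xor a (head d)

  crosses-rev : ∀ a d → crosses a (rev G d) ≡ crosses a d
  crosses-rev a d = Boolₚ.xor-comm (a (head d)) (a (tail G d))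

  -- Somewhere along the path the value of `a` changes, and both ends of that step lie on the path,
  -- hence outside `R`.
  crossing : ∀ {R u v} (a : Fin n → Bool) → ReachAvoiding G R u v → ¬ R u → a u ≢ a v →
             ∃ λ d → crosses a d ≡ true × ¬ R (tail G d) × ¬ R (head d)
  crossing a here                        ¬ru a≢ = contradiction refl a≢
  crossing a (step {u} {v} uv ¬rv v⇝w) ¬ru a≢ with a u Boolₚ.≟ a v
  ... | yes eq = crossing a v⇝w ¬rv (a≢ ∘ trans eq)
  ... | no ¬eq = ((u , v) , uv) , ≢⇒xor≡true ¬eq , ¬ru , ¬rv

  module Connected (conn : ConnectedAvoiding G (λ _ → ⊥)) where

    constant : ∀ (a : Fin n → Bool) → (∀ d → crosses a d ≡ false) → ∀ u v → a u ≡ a v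
    constant a h u v with a u Boolₚ.≟ a v
    ... | yes eq = eq
    ... | no ¬eq = let d , c , _ = crossing a (conn u v id id) id ¬eq in contradiction (trans (sym (h d)) c) λ ()

  module Cubic (cubic : Regular G 3) where

    neighbours₃ : ∀ u → Enum (Σ (Fin n) (T ∘ adj u)) 3
    neighbours₃ u = subst (Enum _) (cubic u) (neighbours u)

    dartAt : ∀ v → Fin 3 → Dart G
    dartAt v i = let w , e = Enum.el (neighbours₃ v) i in (v , w) , e

    dartAt-injective : ∀ v {i j} → dartAt v i ≡ dartAt v j → i ≡ j
    dartAt-injective v {i} {j} eq = Enum.el-injective (neighbours₃ v) (lemma (cong proj₁ eq))
      where
      lemma : ∀ {x y : Σ (Fin n) (T ∘ adj v)} → (v , proj₁ x) ≡ (v , proj₁ y) → x ≡ y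
      lemma {w , e} {.w , e′} refl = cong (w ,_) (T-irrelevant e e′)

    index : Dart G → Fin 3
    index ((u , v) , e) = Enum.ix (neighbours₃ u) (v , e)

    index-injective : ∀ {d d′} → tail G d ≡ tail G d′ → index d ≡ index d′ → d ≡ d′
    index-injective {(u , v) , e} {(.u , v′) , e′} refl eq =
      cong (λ (w , f) → (u , w) , f) (Enum.ix-injective (neighbours₃ u) eq)

    vdart : Fin n → Dart G
    vdart v = dartAt v 0F

    module Rotation (ρ : RotationSystem G) where

      s s⁻¹ : Dart G → Dart G
      s   = σ ρ
      s⁻¹ = σ⁻¹ ρ

      s-injective : ∀ {d d′} → s d ≡ s d′ → d ≡ d′
      s-injective {d} {d′} eq = trans (sym (σ⁻¹σ ρ d)) (trans (cong s⁻¹ eq) (σ⁻¹σ ρ d′))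

      tail-s⁻¹ : ∀ d → tail G (s⁻¹ d) ≡ tail G d
      tail-s⁻¹ d = trans (sym (σ-tail ρ (s⁻¹ d))) (cong (tail G) (σσ⁻¹ ρ d))

      private module O = Orbits darts s s-injective

      vertices : Classes s n
      vertices = record
        { rep     = vdart
        ; cls     = tail G
        ; cls-rep = λ _ → refl
        ; cls-π   = σ-tail ρ
        ; reach   = λ d → σ-cyclic ρ (vdart (tail G d)) d refl
        }

      -- All three darts at the vertex lie on the orbit of `d`, and their step counts stay distinct
      -- modulo the period.
      period≥3 : ∀ p d → iter s (suc p) d ≡ d → 3 ≤ suc p
      period≥3 p d per = injective⇒≤ {f = f} f-injective
        where
        k : Fin 3 → ℕ
        k i = proj₁ (σ-cyclic ρ d (dartAt (tail G d) i) refl)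
        f : Fin 3 → Fin (suc p)
        f i = fromℕ< (m%n<n (k i) (suc p))
        reduce : ∀ m → iter s m d ≡ iter s (m % suc p) d
        reduce m = begin
          iter s m d                                     ≡⟨ cong (λ m → iter s m d) (m≡m%n+[m/n]*n m (suc p)) ⟩
          iter s (m % suc p + m / suc p * suc p) d       ≡⟨ iter-+ s (m % suc p) _ d ⟩
          iter s (m % suc p) (iter s (m / suc p * suc p) d) ≡⟨ cong (iter s (m % suc p)) (O.iter-multiple (m / suc p) (suc p) per) ⟩
          iter s (m % suc p) d ∎
          where open ≡-Reasoning
        f-injective : ∀ {i j} → f i ≡ f j → i ≡ j
        f-injective {i} {j} eq = dartAt-injective (tail G d) (begin
          dartAt (tail G d) i     ≡⟨ sym (proj₂ (σ-cyclic ρ d (dartAt (tail G d) i) refl)) ⟩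
          iter s (k i) d          ≡⟨ reduce (k i) ⟩
          iter s (k i % suc p) d  ≡⟨ cong (λ m → iter s m d) (Finₚ.fromℕ<-injective _ _ (m%n<n (k i) (suc p)) (m%n<n (k j) (suc p)) eq) ⟩
          iter s (k j % suc p) d  ≡⟨ sym (reduce (k j)) ⟩
          iter s (k j) d          ≡⟨ proj₂ (σ-cyclic ρ d (dartAt (tail G d) j) refl) ⟩
          dartAt (tail G d) j     ∎)
          where open ≡-Reasoning

      s-≢ : ∀ d → s d ≢ d
      s-≢ d eq with period≥3 0 d eq
      ... | s≤s ()

      ss-≢ : ∀ d → s (s d) ≢ d
      ss-≢ d eq with period≥3 1 d eq
      ... | s≤s (s≤s ())

      tail-iter : ∀ k d → tail G (iter s k d) ≡ tail G d
      tail-iter = iter-invariant (tail G) s (σ-tail ρ)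

      -- Four iterates occupy three positions, so some positive period is at most 3, and `period≥3`
      -- forces equality.
      sss : ∀ d → s (s (s d)) ≡ d
      sss d with Finₚ.pigeonhole (ℕₚ.n<1+n 3) (λ (i : Fin 4) → index (iter s (toℕ i) d))
      ... | i , j , i<j , eq with ℕₚ.m≤n⇒∃[o]m+o≡n i<j
      ...   | k , i+k = subst (λ p → iter s p d ≡ d) (ℕₚ.≤-antisym sk≤3 (period≥3 k d per)) per
        where
        sk≤3 : suc k ≤ 3
        sk≤3 = ℕₚ.≤-trans (s≤s (ℕₚ.m≤n+m k (toℕ i))) (subst (_≤ 3) (sym i+k) (ℕₚ.≤-pred (Finₚ.toℕ<n j)))
        per : iter s (suc k) d ≡ d
        per = O.iter-injective (toℕ i) (begin
          iter s (toℕ i) (iter s (suc k) d)  ≡⟨ sym (iter-+ s (toℕ i) (suc k) d) ⟩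
          iter s (toℕ i + suc k) d           ≡⟨ cong (λ m → iter s m d) (trans (ℕₚ.+-suc (toℕ i) k) i+k) ⟩
          iter s (toℕ j) d                   ≡⟨ sym (index-injective (trans (tail-iter (toℕ i) d) (sym (tail-iter (toℕ j) d))) eq) ⟩
          iter s (toℕ i) d                   ∎)
          where open ≡-Reasoning

      s⁻¹-ss : ∀ d → s⁻¹ d ≡ s (s d)
      s⁻¹-ss d = trans (cong s⁻¹ (sym (sss d))) (σ⁻¹σ ρ (s (s d)))

      s⁻¹-≢ : ∀ d → s⁻¹ d ≢ s d
      s⁻¹-≢ d eq = s-≢ d (s-injective (trans (sym (s⁻¹-ss d)) eq))

      iter-cases : ∀ k d → iter s k d ≡ d ⊎ iter s k d ≡ s d ⊎ iter s k d ≡ s⁻¹ d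
      iter-cases zero    d = inj₁ refl
      iter-cases (suc k) d with iter-cases k d
      ... | inj₁ p        = inj₂ (inj₁ (cong s p))
      ... | inj₂ (inj₁ p) = inj₂ (inj₂ (trans (cong s p) (sym (s⁻¹-ss d))))
      ... | inj₂ (inj₂ p) = inj₁ (trans (cong s p) (σσ⁻¹ ρ d))

      tail-cases : ∀ d d′ → tail G d ≡ tail G d′ → d′ ≡ d ⊎ d′ ≡ s d ⊎ d′ ≡ s⁻¹ d
      tail-cases d d′ eq with σ-cyclic ρ d d′ eq
      ... | k , p = subst (λ x → x ≡ d ⊎ x ≡ s d ⊎ x ≡ s⁻¹ d) p (iter-cases k d)

-- Rotations of a cubic graph as flips of a fixed one.

module Flips (G : Graph) (cubic : Regular G 3) (ρ₀ : RotationSystem G) where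
  open Darts G
  open Cubic cubic
  open Rotation ρ₀

  IsFlip : RotationSystem G → (Fin n → Bool) → Set
  IsFlip ρ X = ∀ d → σ ρ d ≡ (if X (tail G d) then s⁻¹ d else s d)

  σ-choice : ∀ ρ d → σ ρ d ≡ s d ⊎ σ ρ d ≡ s⁻¹ d
  σ-choice ρ d with tail-cases d (σ ρ d) (sym (σ-tail ρ d))
  ... | inj₁ p = contradiction p (Rotation.s-≢ ρ d)
  ... | inj₂ q = q

  -- Otherwise `σ ρ` would follow `s` from `d` and then come straight back, a cycle of length 2.
  agreement-step : ∀ ρ d → σ ρ d ≡ s d → σ ρ (s d) ≡ s (s d)
  agreement-step ρ d eq with σ-choice ρ (s d)
  ... | inj₁ p = p
  ... | inj₂ p = contradiction (trans (cong (σ ρ) eq) (trans p (σ⁻¹σ ρ₀ d))) (Rotation.ss-≢ ρ d)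

  agreement : ∀ ρ d d′ → tail G d ≡ tail G d′ → σ ρ d ≡ s d → σ ρ d′ ≡ s d′
  agreement ρ d d′ eq h with σ-cyclic ρ₀ d d′ eq
  ... | k , p = subst (λ x → σ ρ x ≡ s x) p (go k)
    where
    go : ∀ k → σ ρ (iter s k d) ≡ s (iter s k d)
    go zero    = h
    go (suc k) = agreement-step ρ _ (go k)

  flipped : RotationSystem G → Fin n → Bool
  flipped ρ v = not (does (Enum._≟ᴱ_ darts (σ ρ (vdart v)) (s (vdart v))))

  flipped-isFlip : ∀ ρ → IsFlip ρ (flipped ρ)
  flipped-isFlip ρ d with Enum._≟ᴱ_ darts (σ ρ (vdart (tail G d))) (s (vdart (tail G d)))
  ... | yes p = agreement ρ (vdart (tail G d)) d refl p
  ... | no ¬p with σ-choice ρ d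
  ...   | inj₁ q = contradiction (agreement ρ d (vdart (tail G d)) refl q) ¬p
  ...   | inj₂ q = q

  private
    choose : Bool → Dart G → Dart G
    choose b d = if b then s⁻¹ d else s d

    choose-tail : ∀ b d → tail G (choose b d) ≡ tail G d
    choose-tail false d = σ-tail ρ₀ d
    choose-tail true  d = tail-s⁻¹ d

    choose-inverse : ∀ b d → choose b (choose (not b) d) ≡ d
    choose-inverse false d = σσ⁻¹ ρ₀ d
    choose-inverse true  d = σ⁻¹σ ρ₀ d

    choose-inverse′ : ∀ b d → choose (not b) (choose b d) ≡ d
    choose-inverse′ false d = σ⁻¹σ ρ₀ d
    choose-inverse′ true  d = σσ⁻¹ ρ₀ d

  flipRotation : (Fin n → Bool) → RotationSystem G
  flipRotation X = record
    { σ        = t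
    ; σ⁻¹      = t⁻¹
    ; σσ⁻¹     = λ d → trans (cong (λ v → choose (X v) (t⁻¹ d)) (choose-tail (not (X (tail G d))) d)) (choose-inverse (X (tail G d)) d)
    ; σ⁻¹σ     = λ d → trans (cong (λ v → choose (not (X v)) (t d)) (choose-tail (X (tail G d)) d)) (choose-inverse′ (X (tail G d)) d)
    ; σ-tail   = λ d → choose-tail (X (tail G d)) d
    ; σ-cyclic = cyclic
    }
    where
    t t⁻¹ : Dart G → Dart G
    t   d = choose (X (tail G d)) d
    t⁻¹ d = choose (not (X (tail G d))) d
    double : ∀ d b → X (tail G d) ≡ b → t (t d) ≡ choose b (choose b d)
    double d b refl = cong (λ v → choose (X v) (t d)) (choose-tail (X (tail G d)) d)
    cyclic : ∀ d d′ → tail G d ≡ tail G d′ → Σ ℕ λ k → iter t k d ≡ d′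
    cyclic d d′ eq with tail-cases d d′ eq | X (tail G d) in Xd
    ... | inj₁ refl        | _     = 0 , refl
    ... | inj₂ (inj₁ refl) | false = 1 , cong (λ b → choose b d) Xd
    -- One step of a rotation is two steps of its inverse, since it has order 3.
    ... | inj₂ (inj₁ refl) | true  = 2 , trans (double d true Xd)
      (trans (s⁻¹-ss (s⁻¹ d)) (cong s (σσ⁻¹ ρ₀ d)))
    ... | inj₂ (inj₂ refl) | false = 2 , trans (double d false Xd) (sym (s⁻¹-ss d))
    ... | inj₂ (inj₂ refl) | true  = 1 , cong (λ b → choose b d) Xd

  flipRotation-isFlip : ∀ X → IsFlip (flipRotation X) X
  flipRotation-isFlip X d = refl

  isFlip-inverse : ∀ {ρ X} → IsFlip ρ X → ∀ d → σ⁻¹ ρ d ≡ choose (not (X (tail G d))) d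
  isFlip-inverse {ρ} {X} h d = trans (cong (σ⁻¹ ρ) (sym σ-back)) (σ⁻¹σ ρ _)
    where
    b = X (tail G d)
    σ-back : σ ρ (choose (not b) d) ≡ d
    σ-back = trans (h (choose (not b) d))
      (trans (cong (λ v → choose (X v) (choose (not b) d)) (choose-tail (not b) d)) (choose-inverse b d))

  private
    choose-injective : ∀ b b′ d → choose b d ≡ choose b′ d → b ≡ b′
    choose-injective false false d eq = refl
    choose-injective false true  d eq = contradiction (sym eq) (s⁻¹-≢ d)
    choose-injective true  false d eq = contradiction eq (s⁻¹-≢ d)
    choose-injective true  true  d eq = refl

  module _ {ρ ρ′ X X′} (f : IsFlip ρ X) (f′ : IsFlip ρ′ X′) where

    equivalent⇒same-cut : EquivEmb G ρ ρ′ → ∀ d → crosses X d ≡ crosses X′ d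
    equivalent⇒same-cut (inj₁ eq) d = cong₂ _xor_ (same (tail G d)) (same (head d))
      where
      same : ∀ v → X v ≡ X′ v
      same v = choose-injective _ _ (vdart v) (trans (sym (f (vdart v))) (trans (eq (vdart v)) (f′ (vdart v))))
    equivalent⇒same-cut (inj₂ eq) d =
      trans (cong₂ _xor_ (opposite (tail G d)) (opposite (head d))) (not-xor (X′ (tail G d)) (X′ (head d)))
      where
      opposite : ∀ v → X v ≡ not (X′ v)
      opposite v = choose-injective _ _ (vdart v)
        (trans (sym (f (vdart v))) (trans (eq (vdart v)) (isFlip-inverse {ρ′} {X′} f′ (vdart v))))
      not-xor : ∀ a b → not a xor not b ≡ a xor b
      not-xor false b = Boolₚ.not-involutive b
      not-xor true  b = refl

    -- The sum `X` + `X′` has no crossings and is constant by connectivity: constant `false` gives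
    -- equal rotations, constant `true` mirror images. The vertex `v₀` decides; without vertices
    -- there are no darts to compare.
    same-cut⇒equivalent : ConnectedAvoiding G (λ _ → ⊥) → (∀ d → crosses X d ≡ crosses X′ d) → EquivEmb G ρ ρ′
    same-cut⇒equivalent conn h with 0 ℕₚ.<? n
    ... | no ¬0<n = inj₁ λ d → contradiction (ℕₚ.≤-trans (s≤s z≤n) (Finₚ.toℕ<n (tail G d))) ¬0<n
    ... | yes 0<n = go (X v₀ Boolₚ.≟ X′ v₀)
      where
      v₀ : Fin n
      v₀ = fromℕ< 0<n
      difference : ∀ v → X v xor X′ v ≡ X v₀ xor X′ v₀
      difference v = Connected.constant conn (λ v → X v xor X′ v)
        (λ d → trans (solve 4 (λ p q r t → (p :+ q) :+ (r :+ t) := (p :+ r) :+ (q :+ t)) refl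
                        (X (tail G d)) (X′ (tail G d)) (X (head d)) (X′ (head d)))
                 (trans (cong (_xor crosses X′ d) (h d)) (xor-self (crosses X′ d)))) v v₀
      go : Dec (X v₀ ≡ X′ v₀) → EquivEmb G ρ ρ′
      go (yes eq) = inj₁ λ d → trans (f d) (trans
        (cong (λ b → choose b d) (xor≡false⇒≡ (trans (difference (tail G d)) (trans (cong (_xor X′ v₀) eq) (xor-self (X′ v₀))))))
        (sym (f′ d)))
      go (no ¬eq) = inj₂ λ d → trans (f d) (trans
        (cong (λ b → choose b d) (xor≡true (trans (difference (tail G d)) (≢⇒xor≡true ¬eq))))
        (sym (isFlip-inverse {ρ′} {X′} f′ d)))
        where
        xor≡true : ∀ {a b} → a xor b ≡ true → a ≡ not b
        xor≡true {false} {true}  _ = refl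
        xor≡true {true}  {false} _ = refl

-- Absence of edge cuts with one or two edges.

module SmallCuts (G : Graph) (three : ThreeConnected G) (cubic : Regular G 3) where
  open Darts G
  open Cubic cubic

  private
    conn₁ : ∀ a → ConnectedAvoiding G (λ x → x ≡ a)
    conn₁ = proj₁ (proj₂ (proj₂ three))

    conn₂ : ∀ a b → ConnectedAvoiding G (λ x → x ≡ a ⊎ x ≡ b)
    conn₂ = proj₂ (proj₂ (proj₂ three))

  -- Taking `e′` equal to `e` describes a bridge, so bridges and 2-edge cuts are treated together.
  IsCutOf : (Fin n → Bool) → Dart G → Dart G → Set
  IsCutOf a e e′ = ∀ d → crosses a d ≡ true → d ≡ e ⊎ d ≡ rev G e ⊎ d ≡ e′ ⊎ d ≡ rev G e′

  private
    cases : ∀ {P : Dart G → Set} {e e′ d} → d ≡ e ⊎ d ≡ rev G e ⊎ d ≡ e′ ⊎ d ≡ rev G e′ →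
            P e → P (rev G e) → P e′ → P (rev G e′) → P d
    cases (inj₁ refl) p q r t = p
    cases (inj₂ (inj₁ refl)) p q r t = q
    cases (inj₂ (inj₂ (inj₁ refl))) p q r t = r
    cases (inj₂ (inj₂ (inj₂ refl))) p q r t = t

    avoid : ∀ d d′ → ∃ λ x → tail G x ≡ tail G d × x ≢ d × x ≢ d′
    avoid d d′ with go
      where
      v = tail G d
      go : ∃ λ i → dartAt v i ≢ d × dartAt v i ≢ d′
      go with Enum._≟ᴱ_ darts (dartAt v 0F) d | Enum._≟ᴱ_ darts (dartAt v 0F) d′
            | Enum._≟ᴱ_ darts (dartAt v 1F) d | Enum._≟ᴱ_ darts (dartAt v 1F) d′
      ... | no p  | no q  | _     | _     = 0F , p , q
      ... | _     | _     | no p  | no q  = 1F , p , q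
      ... | yes p | _     | yes q | _     = contradiction (dartAt-injective v (trans p (sym q))) λ ()
      ... | _     | yes p | _     | yes q = contradiction (dartAt-injective v (trans p (sym q))) λ ()
      ... | yes p | _     | _     | yes q = 2F , (λ r → contradiction (dartAt-injective v (trans p (sym r))) λ ())
                                             , (λ r → contradiction (dartAt-injective v (trans q (sym r))) λ ())
      ... | _     | yes p | yes q | _     = 2F , (λ r → contradiction (dartAt-injective v (trans q (sym r))) λ ())
                                             , (λ r → contradiction (dartAt-injective v (trans p (sym r))) λ ())
    ... | i , p , q = dartAt (tail G d) i , refl , p , q

    -- A further edge `x` at the common tail leads to a vertex on the same side of the cut. Deleting
    -- the tail removes every cut edge, yet that vertex would still have to reach `head e` on the
    -- other side.
    common-tail : ∀ a e e′ → IsCutOf a e e′ → crosses a e ≡ true → crosses a e′ ≡ true →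
                  tail G e ≡ tail G e′ → ⊥
    common-tail a e e′ cut ce ce′ eq with avoid e e′
    ... | x , tx , x≢e , x≢e′ =
      let d , c , ¬t , ¬h = crossing a (conn₁ (tail G e) (head x) (head e) w≢u v≢u) w≢u (λ aw → xor≡true⇒≢ ce (trans au≡aw aw))
      in cases {λ d → tail G d ≢ tail G e → head d ≢ tail G e → ⊥} (cut d c)
           (λ p _ → p refl) (λ _ q → q refl) (λ p _ → p (sym eq)) (λ _ q → q (sym eq)) ¬t ¬h
      where
      w≢u : head x ≢ tail G e
      w≢u p = tail≢head x (trans tx (sym p))
      v≢u : head e ≢ tail G e
      v≢u p = tail≢head e (sym p)
      not-crossing : crosses a x ≢ true
      not-crossing c = cases {λ d → d ≡ x → ⊥} (cut x c)
        (λ p → x≢e (sym p))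
        (λ p → v≢u (trans (cong (tail G) p) tx))
        (λ p → x≢e′ (sym p))
        (λ p → tail≢head e′ (sym (trans (cong (tail G) p) (trans tx eq)))) refl
      au≡aw : a (tail G e) ≡ a (head x)
      au≡aw = trans (cong a (sym tx)) (xor≡false⇒≡ (≢true⇒≡false not-crossing))

    rev-cut : ∀ {a e e′} → IsCutOf a e e′ → IsCutOf a (rev G e) (rev G e′)
    rev-cut {e = e} {e′} cut d c with cut d c
    ... | inj₁ p = inj₂ (inj₁ (trans p (sym (rev-rev e))))
    ... | inj₂ (inj₁ p) = inj₁ p
    ... | inj₂ (inj₂ (inj₁ p)) = inj₂ (inj₂ (inj₂ (trans p (sym (rev-rev e′)))))
    ... | inj₂ (inj₂ (inj₂ p)) = inj₂ (inj₂ (inj₁ p))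

    rev-cutʳ : ∀ {a e e′} → IsCutOf a e e′ → IsCutOf a e (rev G e′)
    rev-cutʳ {e = e} {e′} cut d c with cut d c
    ... | inj₁ p = inj₁ p
    ... | inj₂ (inj₁ p) = inj₂ (inj₁ p)
    ... | inj₂ (inj₂ (inj₁ p)) = inj₂ (inj₂ (inj₂ (trans p (sym (rev-rev e′)))))
    ... | inj₂ (inj₂ (inj₂ p)) = inj₂ (inj₂ (inj₁ p))

    -- Deletes one end of each cut edge, taken on opposite sides: `tail G e` and `head e′`. The
    -- surviving ends `tail G e′` and `head e` lie on different sides, and no cut edge is left to
    -- connect them. Shared ends go to `common-tail`.
    parallel : ∀ a e e′ → IsCutOf a e e′ → crosses a e ≡ true → crosses a e′ ≡ true → a (tail G e) ≡ a (tail G e′) → ⊥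
    parallel a e e′ cut ce ce′ eq with tail G e ≟F tail G e′ | head e ≟F head e′
    ... | yes p | _     = common-tail a e e′ cut ce ce′ p
    ... | _     | yes p = common-tail a (rev G e) (rev G e′) (rev-cut {a} cut)
                            (trans (crosses-rev a e) ce) (trans (crosses-rev a e′) ce′) p
    ... | no u≢u′ | no v≢v′ =
      let d , c , ¬t , ¬h = crossing a (conn₂ (tail G e) (head e′) (tail G e′) (head e) ok′ ok) ok′
                              (λ p → xor≡true⇒≢ ce (trans eq p))
      in cases {λ d → ¬ (tail G d ≡ tail G e ⊎ tail G d ≡ head e′) → ¬ (head d ≡ tail G e ⊎ head d ≡ head e′) → ⊥} (cut d c)
           (λ p _ → p (inj₁ refl)) (λ _ q → q (inj₁ refl)) (λ _ q → q (inj₂ refl)) (λ p _ → p (inj₂ refl)) ¬t ¬h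
      where
      ok′ : ¬ (tail G e′ ≡ tail G e ⊎ tail G e′ ≡ head e′)
      ok′ (inj₁ p) = u≢u′ (sym p)
      ok′ (inj₂ p) = tail≢head e′ p
      ok : ¬ (head e ≡ tail G e ⊎ head e ≡ head e′)
      ok (inj₁ p) = tail≢head e (sym p)
      ok (inj₂ p) = v≢v′ p

  no-small-cut : ∀ a e e′ → IsCutOf a e e′ → crosses a e ≡ true → crosses a e′ ≡ true → ⊥
  no-small-cut a e e′ cut ce ce′ with a (tail G e) Boolₚ.≟ a (tail G e′)
  ... | yes p = parallel a e e′ cut ce ce′ p
  -- Reversing `e′` brings both tails to the same side.
  ... | no ¬p = parallel a e (rev G e′) (rev-cutʳ {a} cut) ce (trans (crosses-rev a e′) ce′)
                  (xor-third ce′ (≢⇒xor≡true ¬p))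
    where
    xor-third : ∀ {x y z} → x xor y ≡ true → z xor x ≡ true → z ≡ y
    xor-third {false} {true} {true}  _ _ = refl
    xor-third {true} {false} {false} _ _ = refl

-- The dual of a 3-connected cubic plane graph

module FaceSteps (G : Graph) (ρ : RotationSystem G) where
  open Darts G

  φ φ⁻¹ : Dart G → Dart G
  φ   = faceStep G ρ
  φ⁻¹ = rev G ∘ σ⁻¹ ρ

  φφ⁻¹ : ∀ d → φ (φ⁻¹ d) ≡ d
  φφ⁻¹ d = trans (cong (σ ρ) (rev-rev (σ⁻¹ ρ d))) (σσ⁻¹ ρ d)

  φ⁻¹φ : ∀ d → φ⁻¹ (φ d) ≡ d
  φ⁻¹φ d = trans (cong (rev G) (σ⁻¹σ ρ (rev G d))) (rev-rev d)

  φ-injective : ∀ {d d′} → φ d ≡ φ d′ → d ≡ d′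
  φ-injective {d} {d′} eq = trans (sym (φ⁻¹φ d)) (trans (cong φ⁻¹ eq) (φ⁻¹φ d′))

  tail-φ : ∀ d → tail G (φ d) ≡ head d
  tail-φ d = σ-tail ρ (rev G d)

  open Orbits darts φ φ-injective public using (same; orbits; classes-from)

  faceCount : ∀ {F} → Classes φ F → HasFaceCount G ρ F
  faceCount C = rep , (λ d → cls d , reach d) , λ i j r → trans (sym (cls-rep i)) (trans (cls-reach r) (cls-rep j))
    where open Classes C

module Sphere (G : Graph) (three : ThreeConnected G) (cubic : Regular G 3) (ρ₀ : RotationSystem G)
              (F : ℕ) (faceCount₀ : HasFaceCount G ρ₀ F)
              (euler : 2 * (Graph.n G + F) + 4 * 0 ≡ degreeSum G + 4) where
  open Darts G
  open Connected (proj₁ (proj₂ three)) public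
  open Cubic cubic
  open Rotation ρ₀ hiding (s; s⁻¹)
  open FaceSteps G ρ₀
  open SmallCuts G three cubic
  open EnumSum darts

  abstract
    faces : Classes φ F
    faces = classes-from faceCount₀

  open Classes faces public using () renaming (cls to face; cls-π to face-φ)

  private
    edges = Orbits.orbits darts (rev G) rev-injective

    module E = Edges darts (rev G) rev-rev rev-≢ (proj₂ edges)

    euler′ : n + F ≡ proj₁ edges + 2
    euler′ = ℕₚ.*-cancelˡ-≡ (n + F) (proj₁ edges + 2) 2 (begin
      2 * (n + F)                        ≡⟨ sym (ℕₚ.+-identityʳ (2 * (n + F))) ⟩
      2 * (n + F) + 4 * 0                ≡⟨ euler ⟩
      degreeSum G + 4                    ≡⟨ cong (_+ 4) E.twice-edges ⟩
      (proj₁ edges + proj₁ edges) + 4    ≡⟨ cong (λ m → proj₁ edges + m + 4) (sym (ℕₚ.+-identityʳ (proj₁ edges))) ⟩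
      2 * proj₁ edges + 4                ≡⟨ sym (ℕₚ.*-distribˡ-+ 2 (proj₁ edges) 2) ⟩
      2 * (proj₁ edges + 2)              ∎)
      where open ≡-Reasoning

    dart-constant : ∀ (g : Dart G → Bool) → (∀ d → g (σ ρ₀ d) ≡ g d) → (∀ d → g (rev G d) ≡ g d) → ∀ d d′ → g d ≡ g d′
    dart-constant g gσ gτ d d′ = trans (by-tail d) (trans
      (constant (g ∘ vdart) (λ d → trans (cong (_xor g (vdart (head d))) (trans (sym (by-tail d)) (trans (sym (gτ d)) (by-tail (rev G d)))))
        (xor-self (g (vdart (head d))))) (tail G d) (tail G d′)) (sym (by-tail d′)))
      where
      by-tail : ∀ d → g d ≡ g (vdart (tail G d))
      by-tail = Classes.invariant-rep vertices g gσ

    σ≡φrev : ∀ d → σ ρ₀ d ≡ φ (rev G d)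
    σ≡φrev d = cong (σ ρ₀) (sym (rev-rev d))

    module ByVertices = E.Exact (σ ρ₀) (σ⁻¹ ρ₀) φ (σσ⁻¹ ρ₀) (σ⁻¹σ ρ₀) (λ _ → refl) dart-constant vertices faces euler′

    -- The dual map: `φ` takes the place of the rotation, and the rotation that of the face step.
    module ByFaces = E.Exact φ φ⁻¹ (σ ρ₀) φφ⁻¹ φ⁻¹φ σ≡φrev
      (λ g gφ gτ → dart-constant g (λ d → trans (cong g (σ≡φrev d)) (trans (gφ (rev G d)) (gτ d))) gτ)
      faces vertices (trans (ℕₚ.+-comm F n) euler′)

  abstract
    -- The mod 2 Jordan curve theorem: an edge set of even degree at every vertex separates the
    -- faces into two colours.
    vertex-closed⇒coboundary :
      ∀ (z : Dart G → Bool) → (∀ d → z (rev G d) ≡ z d) → (∀ v → ∑ᴱ (λ d → δ (tail G d) v ∧ z d) ≡ false) →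
      ∀ d₀ c → ∃ λ (b : Fin F → Bool) → (∀ d → z d ≡ b (face d) xor b (face (rev G d))) × b (face d₀) ≡ c
    vertex-closed⇒coboundary = ByVertices.closed⇒coboundary

    -- The dual form: an even subgraph of the dual is an edge cut of `G`.
    face-closed⇒cut :
      ∀ (z : Dart G → Bool) → (∀ d → z (rev G d) ≡ z d) → (∀ f → ∑ᴱ (λ d → δ (face d) f ∧ z d) ≡ false) →
      ∀ d₀ c → ∃ λ (a : Fin n → Bool) → (∀ d → z d ≡ crosses a d) × a (tail G d₀) ≡ c
    face-closed⇒cut = ByFaces.closed⇒coboundary

    cut⇒face-closed : ∀ (a : Fin n → Bool) f → ∑ᴱ (λ d → δ (face d) f ∧ crosses a d) ≡ false
    cut⇒face-closed = ByFaces.coboundary⇒closed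

    face-constant : ∀ (b : Fin F → Bool) → (∀ d → b (face d) ≡ b (face (rev G d))) → ∀ i j → b i ≡ b j
    face-constant = ByVertices.coboundary-zero⇒constant

  onEdge : Dart G → Dart G → Bool
  onEdge e d = δᴱ d e xor δᴱ d (rev G e)

  onEdge-rev : ∀ e d → onEdge e (rev G d) ≡ onEdge e d
  onEdge-rev e d = trans (cong₂ _xor_ (swap (rev-rev d)) (≡true⇔⇒≡ (f ∘ δᴱ-≡) (g ∘ δᴱ-≡))) (Boolₚ.xor-comm (δᴱ d (rev G e)) (δᴱ d e))
    where
    swap : rev G (rev G d) ≡ d → δᴱ (rev G d) e ≡ δᴱ d (rev G e)
    swap rr = ≡true⇔⇒≡
      (λ h → subst (λ x → δᴱ d x ≡ true) (trans (sym rr) (cong (rev G) (δᴱ-≡ h))) (δᴱ-refl d))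
      (λ h → subst (λ x → δᴱ (rev G d) x ≡ true) (trans (cong (rev G) (δᴱ-≡ h)) (rev-rev e)) (δᴱ-refl (rev G d)))
    f : rev G d ≡ rev G e → δᴱ d e ≡ true
    f p = subst (λ x → δᴱ d x ≡ true) (rev-injective p) (δᴱ-refl d)
    g : d ≡ e → δᴱ (rev G d) (rev G e) ≡ true
    g refl = δᴱ-refl (rev G d)

  onEdge-self : ∀ e → onEdge e e ≡ true
  onEdge-self e = cong₂ _xor_ (δᴱ-refl e) (δᴱ-≢ (rev-≢ e ∘ sym))

  onEdge-other : ∀ {e d} → d ≢ e → d ≢ rev G e → onEdge e d ≡ false
  onEdge-other p q = cong₂ _xor_ (δᴱ-≢ p) (δᴱ-≢ q)

  onEdge-true : ∀ {e d} → onEdge e d ≡ true → d ≡ e ⊎ d ≡ rev G e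
  onEdge-true {e} {d} h with δᴱ d e in eq
  ... | true  = inj₁ (δᴱ-≡ eq)
  ... | false = inj₂ (δᴱ-≡ h)

  onEdge-boundary : ∀ e f → ∑ᴱ (λ d → δ (face d) f ∧ onEdge e d) ≡ δ (face e) f xor δ (face (rev G e)) f
  onEdge-boundary e f = begin
    ∑ᴱ (λ d → δ (face d) f ∧ onEdge e d)
      ≡⟨ ∑ᴱ-cong (λ d → solve 3 (λ p x y → p :* (x :+ y) := (x :* p) :+ (y :* p)) refl
           (δ (face d) f) (δᴱ d e) (δᴱ d (rev G e))) ⟩
    ∑ᴱ (λ d → (δᴱ d e ∧ δ (face d) f) xor (δᴱ d (rev G e) ∧ δ (face d) f))
      ≡⟨ ∑ᴱ-xor (λ d → δᴱ d e ∧ δ (face d) f) (λ d → δᴱ d (rev G e) ∧ δ (face d) f) ⟩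
    ∑ᴱ (λ d → δᴱ d e ∧ δ (face d) f) xor ∑ᴱ (λ d → δᴱ d (rev G e) ∧ δ (face d) f)
      ≡⟨ cong₂ _xor_ (∑ᴱ-δ e (λ d → δ (face d) f)) (∑ᴱ-δ (rev G e) (λ d → δ (face d) f)) ⟩
    δ (face e) f xor δ (face (rev G e)) f ∎
    where open ≡-Reasoning

  boundary-xor : ∀ f (z w : Dart G → Bool) → ∑ᴱ (λ d → δ (face d) f ∧ (z d xor w d)) ≡
                 ∑ᴱ (λ d → δ (face d) f ∧ z d) xor ∑ᴱ (λ d → δ (face d) f ∧ w d)
  boundary-xor f z w = trans (∑ᴱ-cong λ d → Boolₚ.∧-distribˡ-xor (δ (face d) f) (z d) (w d))
    (∑ᴱ-xor (λ d → δ (face d) f ∧ z d) (λ d → δ (face d) f ∧ w d))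

  -- A loop of the dual is closed, so it would be a cut of `G` with a single edge.
  no-loop : ∀ e → face e ≢ face (rev G e)
  no-loop e eq =
    let a , cut , _ = face-closed⇒cut (onEdge e) (onEdge-rev e)
                        (λ f → trans (onEdge-boundary e f) (trans (cong (λ i → δ i f xor δ (face (rev G e)) f) eq) (xor-self (δ (face (rev G e)) f))))
                        e true
        ce = trans (sym (cut e)) (onEdge-self e)
    in no-small-cut a e e (λ d c → [ inj₁ , inj₂ ∘ inj₁ ]′ (onEdge-true (trans (cut d) c))) ce ce

  -- Two parallel dual edges form a closed set, hence would be a cut of `G` with two edges.
  dual-simple : ∀ e e′ → face e ≡ face e′ → face (rev G e) ≡ face (rev G e′) → e ≡ e′
  dual-simple e e′ p q with Enum._≟ᴱ_ darts e e′
  ... | yes eq = eq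
  ... | no e≢e′ =
    let a , cut , _ = face-closed⇒cut z
                        (λ d → cong₂ _xor_ (onEdge-rev e d) (onEdge-rev e′ d))
                        (λ f → trans (boundary-xor f (onEdge e) (onEdge e′)) (trans (cong₂ _xor_ (onEdge-boundary e f) (onEdge-boundary e′ f))
                          (trans (cong₂ (λ i j → (δ i f xor δ j f) xor (δ (face e′) f xor δ (face (rev G e′)) f)) p q)
             (xor-self (δ (face e′) f xor δ (face (rev G e′)) f))))) e true
    in ⊥-elim (no-small-cut a e e′ (λ d c → cases d (trans (cut d) c))
         (trans (sym (cut e)) (cong₂ _xor_ (onEdge-self e) (onEdge-other e≢e′ e≢re′)))
         (trans (sym (cut e′)) (cong₂ _xor_ (onEdge-other (e≢e′ ∘ sym) e′≢re) (onEdge-self e′))))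
    where
    z : Dart G → Bool
    z d = onEdge e d xor onEdge e′ d
    -- If one dart were the reverse of the other, the edge would be a dual loop; so the edges differ
    -- and their indicators do not cancel in `z`.
    e≢re′ : e ≢ rev G e′
    e≢re′ r = no-loop e′ (trans (sym p) (cong face r))
    e′≢re : e′ ≢ rev G e
    e′≢re r = no-loop e (trans p (cong face r))
    cases : ∀ d → z d ≡ true → d ≡ e ⊎ d ≡ rev G e ⊎ d ≡ e′ ⊎ d ≡ rev G e′
    cases d h with onEdge e d in eq
    ... | true  = [ inj₁ , inj₂ ∘ inj₁ ]′ (onEdge-true eq)
    ... | false = inj₂ (inj₂ (onEdge-true h))

-- The dual contains no K₃,₃.

module NoK₃₃ (G : Graph) (three : ThreeConnected G) (cubic : Regular G 3) (ρ₀ : RotationSystem G)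
             (F : ℕ) (faceCount₀ : HasFaceCount G ρ₀ F)
             (euler : 2 * (Graph.n G + F) + 4 * 0 ≡ degreeSum G + 4) where
  open Darts G
  open FaceSteps G ρ₀
  open EnumSum darts
  open Sphere G three cubic ρ₀ F faceCount₀ euler

  parity : (Dart G → Bool) → ℕ → Dart G → Bool
  parity c zero    x = false
  parity c (suc m) x = parity c m x xor c (iter φ m x)

  parity-false : ∀ m x → parity (λ _ → false) m x ≡ false
  parity-false zero    x = refl
  parity-false (suc m) x = trans (Boolₚ.xor-identityʳ _) (parity-false m x)

  module _ {a : Fin n → Bool} where

    tail-step : ∀ {c d} → crosses a d ≡ c → a (tail G (φ d)) ≡ a (tail G d) xor c
    tail-step {c} {d} eq = trans (cong a (tail-φ d)) (lemma (a (tail G d)) eq)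
      where
      lemma : ∀ x {y} → x xor y ≡ c → y ≡ x xor c
      lemma false refl = refl
      lemma true {y} refl = sym (Boolₚ.not-involutive y)

    walk : ∀ {f} c → (∀ d → face d ≡ f → crosses a d ≡ c d) → ∀ {x} → face x ≡ f →
           ∀ m → a (tail G (iter φ m x)) ≡ a (tail G x) xor parity c m x
    walk c h {x} fx zero    = sym (Boolₚ.xor-identityʳ (a (tail G x)))
    walk c h {x} fx (suc m) =
      trans (tail-step (h _ (trans (iter-invariant face φ face-φ m x) fx)))
        (trans (cong (_xor c (iter φ m x)) (walk c h fx m)) (Boolₚ.xor-assoc (a (tail G x)) (parity c m x) (c (iter φ m x))))

    constant-on-face : ∀ {f} → (∀ d → face d ≡ f → crosses a d ≡ false) →
                       ∀ {x y} → face x ≡ f → face y ≡ f → a (tail G x) ≡ a (tail G y)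
    constant-on-face h {x} fx fy = let m , p = same faces (trans fx (sym fy)) in
      sym (trans (cong (a ∘ tail G) (sym p)) (trans (walk (λ _ → false) h fx m)
        (trans (cong (a (tail G x) xor_) (parity-false m x)) (Boolₚ.xor-identityʳ (a (tail G x))))))

    -- After leaving x on the other side, the walk around the face can only return through x or y.
    two-crossings : ∀ {f x y} → x ≢ y → face x ≡ f → face y ≡ f → crosses a x ≡ true →
                    (∀ d → face d ≡ f → d ≢ x → d ≢ y → crosses a d ≡ false) → a (tail G x) ≢ a (tail G y)
    two-crossings {f} {x} {y} x≢y fx fy cx h eq with same faces (trans fx (sym fy))
    ... | zero  , p = x≢y p
    ... | suc m , p = contradiction (trans (sym (cong (a ∘ tail G) p)) (go m))
                        (not-flip (a (tail G x)) (a (tail G y)) eq)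
      where
      not-flip : ∀ b c → b ≡ c → c ≢ b xor true
      not-flip false .false refl ()
      not-flip true  .true  refl ()
      go : ∀ m → a (tail G (iter φ (suc m) x)) ≡ a (tail G x) xor true
      go zero    = tail-step cx
      go (suc m) = trans (tail-step (h _ (trans (iter-invariant face φ face-φ (suc m) x) fx)
          (λ q → not-flip _ _ refl (trans (cong (a ∘ tail G) (sym q)) (go m)))
          (λ q → not-flip _ _ eq (trans (cong (a ∘ tail G) (sym q)) (go m)))))
        (trans (Boolₚ.xor-identityʳ _) (go m))

  module _ (p q : Fin 3 → Fin F) (p-injective : ∀ {i j} → p i ≡ p j → i ≡ j) (q-injective : ∀ {i j} → q i ≡ q j → i ≡ j)
           (e : Fin 3 → Fin 3 → Dart G)
           (face-e : ∀ i j → face (e i j) ≡ p i) (face-rev-e : ∀ i j → face (rev G (e i j)) ≡ q j) where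

    private
      p≢q : ∀ i j → p i ≢ q j
      p≢q i j eq = no-loop (e i j) (trans (face-e i j) (trans eq (sym (face-rev-e i j))))

      -- Where the walk around `p i` crosses the cut given by a dual 4-cycle through `p i`, `q 1F`
      -- and `q 2F`. It is the same for every choice of the fourth vertex, which gives each `p i` a
      -- bit of its own.
      onDarts : Fin 3 → Dart G → Bool
      onDarts i d = δᴱ d (e i 1F) xor δᴱ d (e i 2F)

      steps : Fin 3 → ℕ
      steps i = proj₁ (same faces (trans (face-e i 0F) (sym (face-e i 2F))))

      -- Encodes the cyclic order in which the face p i meets q 0, q 1 and q 2.  Two of the p's must see opposite orders,
      -- which is impossible for three of them.
      orientation : Fin 3 → Bool
      orientation i = parity (onDarts i) (steps i) (e i 0F)

      off-face : ∀ {d d′ f} → face d ≡ f → face d′ ≢ f → δᴱ d d′ ≡ false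
      off-face fd fd′ = δᴱ-≢ λ { refl → fd′ fd }

      module Pair (i k : Fin 3) (i≢k : i ≢ k) where

        -- The dual 4-cycle through `p i`, `q 1F`, `p k` and `q 2F`; being closed, it is a cut `a`
        -- of `G`.
        quad : Dart G → Bool
        quad d = (onEdge (e i 1F) d xor onEdge (e k 1F) d) xor (onEdge (e i 2F) d xor onEdge (e k 2F) d)

        quad-rev : ∀ d → quad (rev G d) ≡ quad d
        quad-rev d = cong₂ _xor_ (cong₂ _xor_ (onEdge-rev (e i 1F) d) (onEdge-rev (e k 1F) d))
                                 (cong₂ _xor_ (onEdge-rev (e i 2F) d) (onEdge-rev (e k 2F) d))

        boundary : ∀ f i j → ∑ᴱ (λ d → δ (face d) f ∧ onEdge (e i j) d) ≡ δ (p i) f xor δ (q j) f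
        boundary f i j = trans (onEdge-boundary (e i j) f) (cong₂ (λ g h → δ g f xor δ h f) (face-e i j) (face-rev-e i j))

        quad-closed : ∀ f → ∑ᴱ (λ d → δ (face d) f ∧ quad d) ≡ false
        quad-closed f = begin
          ∑ᴱ (λ d → δ (face d) f ∧ quad d)
            ≡⟨ boundary-xor f (λ d → onEdge (e i 1F) d xor onEdge (e k 1F) d) (λ d → onEdge (e i 2F) d xor onEdge (e k 2F) d) ⟩
          ∑ᴱ (λ d → δ (face d) f ∧ (onEdge (e i 1F) d xor onEdge (e k 1F) d)) xor
          ∑ᴱ (λ d → δ (face d) f ∧ (onEdge (e i 2F) d xor onEdge (e k 2F) d))
            ≡⟨ cong₂ _xor_ (boundary-xor f (onEdge (e i 1F)) (onEdge (e k 1F))) (boundary-xor f (onEdge (e i 2F)) (onEdge (e k 2F))) ⟩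
          (∑ᴱ (λ d → δ (face d) f ∧ onEdge (e i 1F) d) xor ∑ᴱ (λ d → δ (face d) f ∧ onEdge (e k 1F) d)) xor
          (∑ᴱ (λ d → δ (face d) f ∧ onEdge (e i 2F) d) xor ∑ᴱ (λ d → δ (face d) f ∧ onEdge (e k 2F) d))
            ≡⟨ cong₂ _xor_ (cong₂ _xor_ (boundary f i 1F) (boundary f k 1F)) (cong₂ _xor_ (boundary f i 2F) (boundary f k 2F)) ⟩
          ((P xor Q) xor (K xor Q)) xor ((P xor R) xor (K xor R))
            ≡⟨ cancel P Q K R ⟩
          false ∎
          where
          open ≡-Reasoning
          P = δ (p i) f
          Q = δ (q 1F) f
          K = δ (p k) f
          R = δ (q 2F) f
          cancel : ∀ P Q K R → ((P xor Q) xor (K xor Q)) xor ((P xor R) xor (K xor R)) ≡ false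
          cancel = solve 4 (λ P Q K R → ((P :+ Q) :+ (K :+ Q)) :+ ((P :+ R) :+ (K :+ R)) := con false) refl

        cut : ∃ λ a → (∀ d → quad d ≡ crosses a d) × a (tail G (e i 0F)) ≡ true
        cut = face-closed⇒cut quad quad-rev quad-closed (e i 0F) true

        a : Fin n → Bool
        a = proj₁ cut

        crosses-quad : ∀ d → crosses a d ≡ quad d
        crosses-quad d = sym (proj₁ (proj₂ cut) d)

        off-edge : ∀ {d f} i j → face d ≡ f → f ≢ p i → f ≢ q j → onEdge (e i j) d ≡ false
        off-edge i j fd f≢p f≢q = onEdge-other
          (λ { refl → f≢p (trans (sym fd) (face-e i j)) }) (λ { refl → f≢q (trans (sym fd) (face-rev-e i j)) })

        on-pᵢ : ∀ d → face d ≡ p i → crosses a d ≡ onDarts i d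
        on-pᵢ d fd = trans (crosses-quad d) (cong₂ _xor_ (side 1F) (side 2F))
          where
          side : ∀ j → onEdge (e i j) d xor onEdge (e k j) d ≡ δᴱ d (e i j)
          side j = trans (cong₂ _xor_
            (cong (δᴱ d (e i j) xor_) (off-face fd λ fe → p≢q i j (trans (sym fe) (face-rev-e i j))))
            (off-edge k j fd (i≢k ∘ p-injective) (p≢q i j)))
            (trans (Boolₚ.xor-identityʳ _) (Boolₚ.xor-identityʳ _))

        on-pₖ : ∀ d → face d ≡ p k → crosses a d ≡ onDarts k d
        on-pₖ d fd = trans (crosses-quad d) (cong₂ _xor_ (side 1F) (side 2F))
          where
          side : ∀ j → onEdge (e i j) d xor onEdge (e k j) d ≡ δᴱ d (e k j)
          side j = trans (cong₂ _xor_
            (off-edge i j fd (i≢k ∘ sym ∘ p-injective) (p≢q k j))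
            (cong (δᴱ d (e k j) xor_) (off-face fd λ fe → p≢q k j (trans (sym fe) (face-rev-e k j)))))
            (Boolₚ.xor-identityʳ _)

        on-q₀ : ∀ d → face d ≡ q 0F → crosses a d ≡ false
        on-q₀ d fd = trans (crosses-quad d) (cong₂ _xor_ (cong₂ _xor_ (off i 1F (λ ())) (off k 1F (λ ()))) (cong₂ _xor_ (off i 2F (λ ())) (off k 2F (λ ()))))
          where
          off : ∀ i j → 0F ≢ j → onEdge (e i j) d ≡ false
          off i j 0≢j = off-edge i j fd (p≢q i 0F ∘ sym) (0≢j ∘ q-injective)

        on-q₂ : ∀ d → face d ≡ q 2F → d ≢ rev G (e i 2F) → d ≢ rev G (e k 2F) → crosses a d ≡ false
        on-q₂ d fd d≢i d≢k = trans (crosses-quad d) (cong₂ _xor_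
          (cong₂ _xor_ (off-edge i 1F fd (p≢q i 2F ∘ sym) λ eq → contradiction (q-injective eq) λ ())
                       (off-edge k 1F fd (p≢q k 2F ∘ sym) λ eq → contradiction (q-injective eq) λ ()))
          (cong₂ _xor_ (onEdge-other (off i) d≢i) (onEdge-other (off k) d≢k)))
          where
          off : ∀ i → d ≢ e i 2F
          off i refl = p≢q i 2F (trans (sym (face-e i 2F)) fd)

        crosses-e₂ : ∀ l → (∀ d → face d ≡ p l → crosses a d ≡ onDarts l d) → crosses a (e l 2F) ≡ true
        crosses-e₂ l h = trans (h (e l 2F) (face-e l 2F)) (cong₂ _xor_
          (off-rev l 1F 2F λ ()) (δᴱ-refl (e l 2F)))
          where
          off-rev : ∀ l j j′ → j ≢ j′ → δᴱ (e l j′) (e l j) ≡ false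
          off-rev l j j′ j≢j′ = δᴱ-≢ λ eq → j≢j′ (q-injective (trans (sym (face-rev-e l j)) (trans (cong (face ∘ rev G) (sym eq)) (face-rev-e l j′))))

        no-cross-e₀ : ∀ l → a (tail G (e l 0F)) ≡ a (head (e l 0F))
        no-cross-e₀ l = sym (xor≡false⇒≡ (on-q₀ (rev G (e l 0F)) (face-rev-e l 0F)))

        start : a (tail G (e i 0F)) ≡ a (tail G (e k 0F))
        start = trans (no-cross-e₀ i) (trans (constant-on-face {a} on-q₀ (face-rev-e i 0F) (face-rev-e k 0F)) (sym (no-cross-e₀ k)))

        heads-differ : a (head (e i 2F)) ≢ a (head (e k 2F))
        heads-differ = two-crossings {a} {x = rev G (e i 2F)} {y = rev G (e k 2F)}
          (λ eq → i≢k (p-injective (trans (sym (face-e i 2F)) (trans (cong face (rev-injective eq)) (face-e k 2F)))))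
          (face-rev-e i 2F) (face-rev-e k 2F)
          (trans (crosses-rev a (e i 2F)) (crosses-e₂ i on-pᵢ)) on-q₂

        finish : ∀ l → (∀ d → face d ≡ p l → crosses a d ≡ onDarts l d) →
                 a (tail G (e l 2F)) ≡ a (tail G (e l 0F)) xor orientation l
        finish l h = trans (cong (a ∘ tail G) (sym (proj₂ (same faces (trans (face-e l 0F) (sym (face-e l 2F)))))))
                           (walk {a} (onDarts l) h (face-e l 0F) (steps l))

        -- The cut avoids `q 0F`, so `e i 0F` and `e k 0F` start on the same side. Around `q 2F` it
        -- is crossed exactly twice, so the heads of `e i 2F` and `e k 2F` are separated, and with
        -- them the tails, both edges being in the cut. The walks around `p i` and `p k` from the
        -- first tails to the second thus differ in parity.
        opposite : orientation i ≢ orientation k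
        opposite eq = heads-differ (xor-cancel (crosses-e₂ i on-pᵢ) (crosses-e₂ k on-pₖ)
          (trans (finish i on-pᵢ) (trans (cong₂ _xor_ start eq) (sym (finish k on-pₖ)))))
          where
          xor-cancel : ∀ {x y x′ y′} → x xor y ≡ true → x′ xor y′ ≡ true → x ≡ x′ → y ≡ y′
          xor-cancel {false} {true}  {_} {true}  _ _ refl = refl
          xor-cancel {true}  {false} {_} {false} _ _ refl = refl

    no-K₃₃ : ⊥
    no-K₃₃ = three-bits (orientation 0F) (orientation 1F) (orientation 2F)
      (Pair.opposite 0F 1F λ ()) (Pair.opposite 1F 2F λ ()) (Pair.opposite 0F 2F λ ())
      where
      three-bits : ∀ x y z → x ≢ y → y ≢ z → x ≢ z → ⊥
      three-bits false false _     p _ _ = p refl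
      three-bits true  true  _     p _ _ = p refl
      three-bits false true  false _ _ r = r refl
      three-bits true  false true  _ _ r = r refl
      three-bits _     false false _ q _ = q refl
      three-bits _     true  true  _ q _ = q refl

-- The rank of the dual subgraph and the genus of the flipped embedding

unit : ∀ {n} → Fin n → Cube n
unit = δ

·-xor : ∀ {m n} (M : Matrix m n) x y i → (M · (λ j → x j xor y j)) i ≡ (M · x) i xor (M · y) i
·-xor M x y i = trans (∑-cong λ j → Boolₚ.∧-distribˡ-xor (M i j) (x j) (y j)) (∑-xor (λ j → M i j ∧ x j) (λ j → M i j ∧ y j))

·-scale : ∀ {m n} (M : Matrix m n) b x i → (M · (λ j → b ∧ x j)) i ≡ b ∧ (M · x) i
·-scale M b x i = trans (∑-cong λ j → solve 3 (λ m b x → m :* (b :* x) := b :* (m :* x)) refl (M i j) b (x j)) (∑-∧ˡ b (λ j → M i j ∧ x j))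

·-unit : ∀ {m n} (M : Matrix m n) i j → (M · unit j) i ≡ M i j
·-unit M i j = trans (∑-cong λ l → ∧-comm (M i l) (δ j l)) (∑-δ j (M i))

module DualMatrix (G : Graph) (three : ThreeConnected G) (cubic : Regular G 3) (ρ₀ : RotationSystem G)
                  (F : ℕ) (faceCount₀ : HasFaceCount G ρ₀ F)
                  (euler : 2 * (Graph.n G + F) + 4 * 0 ≡ degreeSum G + 4)
                  (S : Dart G → Bool) (S-rev : ∀ d → S (rev G d) ≡ S d) where
  open Darts G
  open EnumSum darts
  open Sphere G three cubic ρ₀ F faceCount₀ euler

  private
    term : Fin F → Fin F → Dart G → Bool
    term f g d = δ (face d) f ∧ (S d ∧ δ (face (rev G d)) g)

    term-true : ∀ {f g d} → term f g d ≡ true → face d ≡ f × S d ≡ true × face (rev G d) ≡ g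
    term-true h = let p , qr = ∧-true h ; q , r = ∧-true qr in δ-≡ p , q , δ-≡ r

  abstract
    -- A sum over darts, so that it combines with the other sums; by `dual-simple` at most one term
    -- is nonzero, so it is also the adjacency matrix.
    A : Matrix F F
    A f g = ∑ᴱ λ d → δ (face d) f ∧ (S d ∧ δ (face (rev G d)) g)

    A-dart : ∀ {f g} → A f g ≡ true → ∃ λ d → face d ≡ f × S d ≡ true × face (rev G d) ≡ g
    A-dart h = let d , eq = ∑ᴱ-true h in d , term-true eq

    dart-A : ∀ {f g} d → S d ≡ true → face d ≡ f → face (rev G d) ≡ g → A f g ≡ true
    dart-A d Sd refl refl = trans
      (∑ᴱ-single {term (face d) (face (rev G d))} d λ d′ d′≢d → ≢true⇒≡false λ h →
        let p , _ , r = term-true {d = d′} h in d′≢d (dual-simple d′ d p r))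
      (cong₂ _∧_ (δ-refl (face d)) (cong₂ _∧_ Sd (δ-refl (face (rev G d)))))

    A-value : ∀ b f → (A · b) f ≡ ∑ᴱ λ d → δ (face d) f ∧ (S d ∧ b (face (rev G d)))
    A-value b f = begin
      ∑ (λ g → ∑ᴱ (term f g) ∧ b g)
        ≡⟨ ∑-cong (λ g → trans (∧-comm (∑ᴱ (term f g)) (b g)) (sym (∑ᴱ-∧ˡ (b g) (term f g)))) ⟩
      ∑ (λ g → ∑ᴱ λ d → b g ∧ term f g d)
        ≡⟨ sym (∑ᴱ-swap (λ d g → b g ∧ term f g d)) ⟩
      ∑ᴱ (λ d → ∑ λ g → b g ∧ term f g d)
        ≡⟨ ∑ᴱ-cong (λ d → begin
             ∑ (λ g → b g ∧ term f g d)
               ≡⟨ ∑-cong (λ g → solve 4 (λ b x s y → b :* (x :* (s :* y)) := (x :* s) :* (y :* b)) refl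
                    (b g) (δ (face d) f) (S d) (δ (face (rev G d)) g)) ⟩
             ∑ (λ g → (δ (face d) f ∧ S d) ∧ (δ (face (rev G d)) g ∧ b g))
               ≡⟨ ∑-∧ˡ (δ (face d) f ∧ S d) (λ g → δ (face (rev G d)) g ∧ b g) ⟩
             (δ (face d) f ∧ S d) ∧ ∑ (λ g → δ (face (rev G d)) g ∧ b g)
               ≡⟨ cong ((δ (face d) f ∧ S d) ∧_) (∑-δ (face (rev G d)) b) ⟩
             (δ (face d) f ∧ S d) ∧ b (face (rev G d))
               ≡⟨ Boolₚ.∧-assoc (δ (face d) f) (S d) (b (face (rev G d))) ⟩
             δ (face d) f ∧ (S d ∧ b (face (rev G d))) ∎) ⟩
      ∑ᴱ (λ d → δ (face d) f ∧ (S d ∧ b (face (rev G d)))) ∎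
      where open ≡-Reasoning

  A-loop : ∀ f → A f f ≡ false
  A-loop f = ≢true⇒≡false λ h → let d , p , _ , q = A-dart h in no-loop d (trans p (sym q))

  A-sym : ∀ f g → A f g ≡ A g f
  A-sym f g = ≡true⇔⇒≡ (swap f g) (swap g f)
    where
    swap : ∀ f g → A f g ≡ true → A g f ≡ true
    swap f g h = let d , p , s , q = A-dart h in
      dart-A (rev G d) (trans (S-rev d) s) q (trans (cong face (rev-rev d)) p)

  -- Rank 2 of an alternating matrix, witnessed by a hyperbolic pair: column `g` is the combination
  -- of columns `p` and `q` whose coefficients are its entries in rows `q` and `p`.
  RankTwo : Fin F → Fin F → Set
  RankTwo p q = A p q ≡ true × (∀ f g → A f g ≡ (A q g ∧ A f p) xor (A p g ∧ A f q))

module Genus (G : Graph) (three : ThreeConnected G) (cubic : Regular G 3) (ρ₀ : RotationSystem G)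
             (F : ℕ) (faceCount₀ : HasFaceCount G ρ₀ F)
             (euler : 2 * (Graph.n G + F) + 4 * 0 ≡ degreeSum G + 4)
             (S : Dart G → Bool) (S-rev : ∀ d → S (rev G d) ≡ S d)
             (X : Fin (Graph.n G) → Bool) (S-cut : ∀ d → S d ≡ Darts.crosses G X d)
             (ρ : RotationSystem G) (isFlip : Flips.IsFlip G cubic ρ₀ ρ X)
             (F₁ : ℕ) (faces₁ : Classes (faceStep G ρ) F₁) (d₀ : Dart G) where
  open Darts G
  open Cubic cubic
  open EnumSum darts
  open Sphere G three cubic ρ₀ F faceCount₀ euler
  open DualMatrix G three cubic ρ₀ F faceCount₀ euler S S-rev

  private
    module C₁ = Classes faces₁

    φ₁ : Dart G → Dart G
    φ₁ = faceStep G ρ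

  ∂ : Cube F → Dart G → Bool
  ∂ b d = b (face d) xor b (face (rev G d))

  -- A walker around a face of ρ has the face of ρ₀ on her left outside X and on her right inside X.
  side : Cube F → Dart G → Bool
  side b d = if X (tail G d) then b (face (rev G d)) else b (face d)

  -- Outside `X` the turn at `head d` is that of `ρ₀` and keeps the left face of `d`; inside `X` it
  -- is the opposite turn and keeps the right face. The value therefore changes along `d` only where
  -- `d` crosses the cut.
  side-step : ∀ b d → side b (φ₁ d) ≡ (if X (head d) then b (face (rev G d)) else b (face d))
  side-step b d = trans (cong (λ v → if X v then b (face (rev G (φ₁ d))) else b (face (φ₁ d))) (σ-tail ρ (rev G d))) go
    where
    go : (if X (head d) then b (face (rev G (φ₁ d))) else b (face (φ₁ d))) ≡
         (if X (head d) then b (face (rev G d)) else b (face d))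
    go with X (head d) | isFlip (rev G d)
    ... | false | eq = cong b (trans (cong face eq) (face-φ d))
    ... | true  | eq = cong b (trans (cong (face ∘ rev G) eq)
      (trans (sym (face-φ (rev G (σ⁻¹ ρ₀ (rev G d))))) (cong face (trans (cong (σ ρ₀) (rev-rev _)) (σσ⁻¹ ρ₀ (rev G d))))))

  side-rev : ∀ b d → side b (rev G d) ≡ (if X (head d) then b (face d) else b (face (rev G d)))
  side-rev b d = cong (λ x → if X (head d) then b (face x) else b (face (rev G d))) (rev-rev d)

  private
    -- Invariance of `y` along one face step, with all values abstracted: a change of side is
    -- compensated by the change of `a`.
    flow : ∀ x x′ u u′ p p′ → (x xor x′) ∧ (u xor u′) ≡ p xor p′ →
           p′ xor (if x′ then u′ else u) ≡ p xor (if x then u′ else u)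
    flow false false u u′ p p′ h = cong (_xor u) (sym (xor≡false⇒≡ {p} {p′} (sym h)))
    flow true  true  u u′ p p′ h = cong (_xor u′) (sym (xor≡false⇒≡ {p} {p′} (sym h)))
    flow false true  u u′ false p′ refl = solve 2 (λ u u′ → (u :+ u′) :+ u′ := u) refl u u′
    flow false true  u u′ true  p′ h = trans (cong (_xor u′) (trans (sym (Boolₚ.not-involutive p′)) (cong not (sym h))))
      (solve 2 (λ u u′ → con true :+ (u :+ u′) :+ u′ := con true :+ u) refl u u′)
    flow true  false u u′ false p′ refl = solve 2 (λ u u′ → (u :+ u′) :+ u := u′) refl u u′
    flow true  false u u′ true  p′ h = trans (cong (_xor u) (trans (sym (Boolₚ.not-involutive p′)) (cong not (sym h))))
      (solve 2 (λ u u′ → con true :+ (u :+ u′) :+ u := con true :+ u′) refl u u′)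

    side-difference : ∀ b d → side b d xor side b (rev G d) ≡ ∂ b d xor (S d ∧ ∂ b d)
    side-difference b d = trans (cong (side b d xor_) (side-rev b d))
      (trans (lemma (X (tail G d)) (X (head d)) (b (face d)) (b (face (rev G d))))
             (cong (λ x → ∂ b d xor (x ∧ ∂ b d)) (sym (S-cut d))))
      where
      lemma : ∀ x x′ u u′ → (if x then u′ else u) xor (if x′ then u else u′) ≡ (u xor u′) xor ((x xor x′) ∧ (u xor u′))
      lemma false false u u′ = sym (Boolₚ.xor-identityʳ (u xor u′))
      lemma true  true  u u′ = trans (Boolₚ.xor-comm u′ u) (sym (Boolₚ.xor-identityʳ (u xor u′)))
      lemma false true  u u′ = trans (xor-self u) (sym (xor-self (u xor u′)))
      lemma true  false u u′ = trans (xor-self u′) (sym (xor-self (u xor u′)))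

  -- The face functions c of ρ correspond to the kernel vectors b of the dual matrix.
  record Related (c : Cube F₁) (b : Cube F) : Set where
    field
      a      : Fin n → Bool
      -- `a-cut` determines `a` up to a constant; fixing the constant here is what makes the
      -- relation injective in both directions.
      base   : a (tail G d₀) ≡ false
      value  : ∀ d → c (C₁.cls d) ≡ a (tail G d) xor side b d
      a-cut  : ∀ d → S d ∧ ∂ b d ≡ crosses a d

    difference : ∀ d → c (C₁.cls d) xor c (C₁.cls (rev G d)) ≡ ∂ b d
    difference d = begin
      c (C₁.cls d) xor c (C₁.cls (rev G d))
        ≡⟨ cong₂ _xor_ (value d) (value (rev G d)) ⟩
      (a (tail G d) xor side b d) xor (a (head d) xor side b (rev G d))
        ≡⟨ solve 4 (λ p x q y → (p :+ x) :+ (q :+ y) := (p :+ q) :+ (x :+ y)) refl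
             (a (tail G d)) (side b d) (a (head d)) (side b (rev G d)) ⟩
      crosses a d xor (side b d xor side b (rev G d))
        ≡⟨ cong₂ _xor_ (sym (a-cut d)) (side-difference b d) ⟩
      (S d ∧ ∂ b d) xor (∂ b d xor (S d ∧ ∂ b d))
        ≡⟨ solve 2 (λ x y → x :+ (y :+ x) := y) refl (S d ∧ ∂ b d) (∂ b d) ⟩
      ∂ b d ∎
      where open ≡-Reasoning

  private
    S-closed : ∀ f → ∑ᴱ (λ d → δ (face d) f ∧ S d) ≡ false
    S-closed f = trans (∑ᴱ-cong λ d → cong (δ (face d) f ∧_) (S-cut d)) (cut⇒face-closed X f)

    -- The value `b f` of the face itself is counted once for each edge of `S` at `f`, an even
    -- number since `S` is a cut; only the values of the neighbours remain.
    boundary-S∂ : ∀ b f → ∑ᴱ (λ d → δ (face d) f ∧ (S d ∧ ∂ b d)) ≡ (A · b) f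
    boundary-S∂ b f = begin
      ∑ᴱ (λ d → δ (face d) f ∧ (S d ∧ ∂ b d))
        ≡⟨ ∑ᴱ-cong (λ d → trans
             (solve 4 (λ x s u v → x :* (s :* (u :+ v)) := (x :* (u :* s)) :+ (x :* (s :* v))) refl
               (δ (face d) f) (S d) (b (face d)) (b (face (rev G d))))
             (cong (_xor (δ (face d) f ∧ (S d ∧ b (face (rev G d))))) (at d))) ⟩
      ∑ᴱ (λ d → (b f ∧ (δ (face d) f ∧ S d)) xor (δ (face d) f ∧ (S d ∧ b (face (rev G d)))))
        ≡⟨ ∑ᴱ-xor (λ d → b f ∧ (δ (face d) f ∧ S d)) (λ d → δ (face d) f ∧ (S d ∧ b (face (rev G d)))) ⟩
      ∑ᴱ (λ d → b f ∧ (δ (face d) f ∧ S d)) xor ∑ᴱ (λ d → δ (face d) f ∧ (S d ∧ b (face (rev G d))))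
        ≡⟨ cong₂ _xor_ (trans (∑ᴱ-∧ˡ (b f) (λ d → δ (face d) f ∧ S d)) (trans (cong (b f ∧_) (S-closed f)) (∧-zeroʳ (b f))))
                       (sym (A-value b f)) ⟩
      (A · b) f ∎
      where
      open ≡-Reasoning
      at : ∀ d → δ (face d) f ∧ (b (face d) ∧ S d) ≡ b f ∧ (δ (face d) f ∧ S d)
      at d with face d ≟F f
      ... | yes refl = refl
      ... | no _     = sym (∧-zeroʳ (b f))

  related⇒kernel : ∀ {c b} → Related c b → Kernel A b
  related⇒kernel {b = b} r f = trans (sym (boundary-S∂ b f))
    (trans (∑ᴱ-cong λ d → cong (δ (face d) f ∧_) (Related.a-cut r d)) (cut⇒face-closed (Related.a r) f))

  private module FromKernel (b : Cube F) (kb : Kernel A b) where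

    symm : ∀ d → S (rev G d) ∧ ∂ b (rev G d) ≡ S d ∧ ∂ b d
    symm d = cong₂ _∧_ (S-rev d) (trans (cong (λ x → b (face (rev G d)) xor b (face x)) (rev-rev d)) (Boolₚ.xor-comm (b (face (rev G d))) (b (face d))))

    solution : ∃ λ (a : Fin n → Bool) → (∀ d → S d ∧ ∂ b d ≡ crosses a d) × a (tail G d₀) ≡ false
    solution = face-closed⇒cut (λ d → S d ∧ ∂ b d) symm (λ f → trans (boundary-S∂ b f) (kb f)) d₀ false

    a : Fin n → Bool
    a = proj₁ solution

    y : Dart G → Bool
    y d = a (tail G d) xor side b d

    y-invariant : ∀ d → y (φ₁ d) ≡ y d
    y-invariant d = trans (cong₂ (λ v x → a v xor x) (σ-tail ρ (rev G d)) (side-step b d))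
      (flow (X (tail G d)) (X (head d)) (b (face d)) (b (face (rev G d))) (a (tail G d)) (a (head d))
        (trans (cong (_∧ ∂ b d) (sym (S-cut d))) (proj₁ (proj₂ solution) d)))

  kernel⇒related : ∀ b → Kernel A b → ∃ λ c → Related c b
  kernel⇒related b kb = y ∘ C₁.rep , record
    { a = a ; base = proj₂ (proj₂ solution) ; value = λ d → sym (C₁.invariant-rep y y-invariant d) ; a-cut = proj₁ (proj₂ solution) }
    where open FromKernel b kb

  -- Since `y (rev G d)` equals `y (σ ρ d)`, the differences of `y` across edges sum to zero at
  -- every vertex, so they come from a face function `b` of `ρ₀`. After `side b` is subtracted, `y`
  -- is invariant under `σ ρ` and descends to a vertex function, the required `a`.
  faces⇒related : ∀ c → ∃ λ b → Related c b
  faces⇒related c = b , record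
    { a     = λ v → h (vdart v)
    ; base  = trans (sym (by-tail d₀)) (trans (cong (y d₀ xor_) side-d₀) (xor-self (y d₀)))
    ; value = λ d → trans (solve 2 (λ y s → y := (y :+ s) :+ s) refl (y d) (side b d)) (cong (_xor side b d) (by-tail d))
    ; a-cut = λ d → sym (begin
        h (vdart (tail G d)) xor h (vdart (head d))
          ≡⟨ cong₂ _xor_ (sym (by-tail d)) (sym (by-tail (rev G d))) ⟩
        (y d xor side b d) xor (y (rev G d) xor side b (rev G d))
          ≡⟨ solve 4 (λ p x q z → (p :+ x) :+ (q :+ z) := (p :+ q) :+ (x :+ z)) refl (y d) (side b d) (y (rev G d)) (side b (rev G d)) ⟩
        (y d xor y (rev G d)) xor (side b d xor side b (rev G d))
          ≡⟨ cong₂ _xor_ (z≡∂ d) (side-difference b d) ⟩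
        ∂ b d xor (∂ b d xor (S d ∧ ∂ b d))
          ≡⟨ solve 2 (λ x s → x :+ (x :+ s) := s) refl (∂ b d) (S d ∧ ∂ b d) ⟩
        S d ∧ ∂ b d ∎)
    }
    where
    open ≡-Reasoning
    y : Dart G → Bool
    y d = c (C₁.cls d)
    y-rev : ∀ d → y (rev G d) ≡ y (σ ρ d)
    y-rev d = trans (cong c (sym (C₁.cls-π (rev G d)))) (cong (y ∘ σ ρ) (rev-rev d))
    closed : ∀ v → ∑ᴱ (λ d → δ (tail G d) v ∧ (y d xor y (rev G d))) ≡ false
    closed v = begin
      ∑ᴱ (λ d → δ (tail G d) v ∧ (y d xor y (rev G d)))
        ≡⟨ ∑ᴱ-cong (λ d → trans (Boolₚ.∧-distribˡ-xor (δ (tail G d) v) (y d) (y (rev G d)))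
             (cong₂ (λ u x → (δ (tail G d) v ∧ y d) xor (δ u v ∧ x)) (sym (σ-tail ρ d)) (y-rev d))) ⟩
      ∑ᴱ (λ d → k d xor k (σ ρ d))
        ≡⟨ ∑ᴱ-xor k (k ∘ σ ρ) ⟩
      ∑ᴱ k xor ∑ᴱ (k ∘ σ ρ)
        ≡⟨ cong (∑ᴱ k xor_) (∑ᴱ-permute (σ ρ) (σ⁻¹ ρ) (σσ⁻¹ ρ) (σ⁻¹σ ρ) k) ⟩
      ∑ᴱ k xor ∑ᴱ k
        ≡⟨ xor-self (∑ᴱ k) ⟩
      false ∎
      where
      k : Dart G → Bool
      k d = δ (tail G d) v ∧ y d
    -- The dart whose own face is the one that `side` reads at `d₀`; prescribing `b` there makes `a`
    -- vanish at the base.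
    d₀′ : Dart G
    d₀′ = if X (tail G d₀) then rev G d₀ else d₀
    solution : ∃ λ (b : Fin F → Bool) → (∀ d → y d xor y (rev G d) ≡ b (face d) xor b (face (rev G d))) × b (face d₀′) ≡ y d₀
    solution = vertex-closed⇒coboundary (λ d → y d xor y (rev G d))
      (λ d → trans (cong (λ x → y (rev G d) xor y x) (rev-rev d)) (Boolₚ.xor-comm (y (rev G d)) (y d)))
      closed d₀′ (y d₀)
    b : Cube F
    b = proj₁ solution
    z≡∂ : ∀ d → y d xor y (rev G d) ≡ ∂ b d
    z≡∂ = proj₁ (proj₂ solution)
    side-d₀ : side b d₀ ≡ y d₀
    side-d₀ = trans (lemma (X (tail G d₀))) (proj₂ (proj₂ solution))
      where
      lemma : ∀ x → (if x then b (face (rev G d₀)) else b (face d₀)) ≡ b (face (if x then rev G d₀ else d₀))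
      lemma false = refl
      lemma true  = refl
    h : Dart G → Bool
    h d = y d xor side b d
    h-invariant : ∀ d → h (σ ρ d) ≡ h d
    h-invariant d = trans
      (cong₂ _xor_ (sym (y-rev d)) (trans (cong (side b ∘ σ ρ) (sym (rev-rev d)))
        (trans (side-step b (rev G d)) (cong (λ x → if X (tail G d) then b (face x) else b (face (rev G d))) (rev-rev d)))))
      (lemma (X (tail G d)) (y d) (y (rev G d)) (b (face d)) (b (face (rev G d))) (z≡∂ d))
      where
      lemma : ∀ x p p′ u u′ → p xor p′ ≡ u xor u′ → p′ xor (if x then u else u′) ≡ p xor (if x then u′ else u)
      lemma x false .(u xor u′) u u′ refl = flip-side x u u′
        where
        flip-side : ∀ x u u′ → (u xor u′) xor (if x then u else u′) ≡ (if x then u′ else u)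
        flip-side false u u′ = solve 2 (λ u u′ → (u :+ u′) :+ u′ := u) refl u u′
        flip-side true  u u′ = solve 2 (λ u u′ → (u :+ u′) :+ u := u′) refl u u′
      lemma x true p′ u u′ eq = trans (cong (_xor (if x then u else u′)) (trans (sym (Boolₚ.not-involutive p′)) (cong not eq))) (flip-side x u u′)
        where
        flip-side : ∀ x u u′ → not (u xor u′) xor (if x then u else u′) ≡ not (if x then u′ else u)
        flip-side false u u′ = solve 2 (λ u u′ → (con true :+ (u :+ u′)) :+ u′ := con true :+ u) refl u u′
        flip-side true  u u′ = solve 2 (λ u u′ → (con true :+ (u :+ u′)) :+ u := con true :+ u′) refl u u′
    by-tail : ∀ d → h d ≡ h (vdart (tail G d))
    by-tail = Classes.invariant-rep (Rotation.vertices ρ) h h-invariant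

  private
    same-cut : ∀ {a a′ : Fin n → Bool} → (∀ d → crosses a d ≡ crosses a′ d) → ∀ u v → a u xor a′ u ≡ a v xor a′ v
    same-cut {a} {a′} h = constant (λ v → a v xor a′ v) λ d →
      trans (solve 4 (λ p q r s → (p :+ q) :+ (r :+ s) := (p :+ r) :+ (q :+ s)) refl (a (tail G d)) (a′ (tail G d)) (a (head d)) (a′ (head d)))
        (trans (cong (_xor crosses a′ d) (h d)) (xor-self (crosses a′ d)))

  related-injectiveˡ : ∀ {c c′ b b′} → Related c b → Related c′ b′ → b ≗ b′ → c ≗ c′
  related-injectiveˡ {c} {c′} {b} {b′} r r′ eq i = subst (λ j → c j ≡ c′ j) (C₁.cls-rep i)
    (trans (R.value d) (trans (cong₂ _xor_ (a≗ (tail G d)) side-eq) (sym (R′.value d))))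
    where
    module R  = Related r
    module R′ = Related r′
    d : Dart G
    d = C₁.rep i
    ∂-eq : ∀ d → ∂ b d ≡ ∂ b′ d
    ∂-eq d = cong₂ _xor_ (eq (face d)) (eq (face (rev G d)))
    a≗ : R.a ≗ R′.a
    a≗ v = xor≡false⇒≡ (trans (same-cut {R.a} {R′.a} (λ d → trans (sym (R.a-cut d)) (trans (cong (S d ∧_) (∂-eq d)) (R′.a-cut d))) v (tail G d₀))
                              (cong₂ _xor_ R.base R′.base))
    side-eq : side b d ≡ side b′ d
    side-eq = cong₂ (λ x y → if X (tail G d) then x else y) (eq (face (rev G d))) (eq (face d))

  -- By `difference`, `c` determines `∂ b` and hence `b` up to a constant, which the normalisation
  -- at `d₀` fixes.
  related-injectiveʳ : ∀ {c c′ b b′} → Related c b → Related c′ b′ → c ≗ c′ → b ≗ b′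
  related-injectiveʳ {c} {c′} {b} {b′} r r′ eq f = xor≡false⇒≡ (trans (b-const f (face d₀)) zero-at-base)
    where
    module R  = Related r
    module R′ = Related r′
    b-const : ∀ f g → b f xor b′ f ≡ b g xor b′ g
    b-const = face-constant (λ f → b f xor b′ f) λ d → xor≡false⇒≡
      (trans (solve 4 (λ p q r s → (p :+ q) :+ (r :+ s) := (p :+ r) :+ (q :+ s)) refl (b (face d)) (b′ (face d)) (b (face (rev G d))) (b′ (face (rev G d))))
        (trans (cong₂ _xor_ (sym (R.difference d)) (sym (R′.difference d)))
          (trans (cong (_xor (c′ (C₁.cls d) xor c′ (C₁.cls (rev G d)))) (cong₂ _xor_ (eq _) (eq _))) (xor-self (c′ (C₁.cls d) xor c′ (C₁.cls (rev G d)))))))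
    side-d₀ : side b d₀ xor side b′ d₀ ≡ false
    side-d₀ = trans (cong₂ _xor_ (drop R.base (R.value d₀)) (drop R′.base (R′.value d₀)))
      (trans (cong (_xor c′ (C₁.cls d₀)) (eq _)) (xor-self (c′ (C₁.cls d₀))))
      where
      drop : ∀ {x y z} → x ≡ false → z ≡ x xor y → y ≡ z
      drop refl h = sym h
    zero-at-base : b (face d₀) xor b′ (face d₀) ≡ false
    zero-at-base = trans (lemma (X (tail G d₀))) side-d₀
      where
      lemma : ∀ x → b (face d₀) xor b′ (face d₀) ≡
                    (if x then b (face (rev G d₀)) else b (face d₀)) xor (if x then b′ (face (rev G d₀)) else b′ (face d₀))
      lemma false = refl
      lemma true  = b-const (face d₀) (face (rev G d₀))

  module _ {p q : Fin F} (pq : A p q ≡ true) where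

    private
      qp : A q p ≡ true
      qp = trans (A-sym q p) pq

      adjust : Cube F → Bool → Bool → Cube F
      adjust b x y f = (b f xor (x ∧ unit p f)) xor (y ∧ unit q f)

      A-adjust : ∀ b x y f → (A · adjust b x y) f ≡ ((A · b) f xor (x ∧ A f p)) xor (y ∧ A f q)
      A-adjust b x y f = trans (·-xor A (λ f → b f xor (x ∧ unit p f)) (λ f → y ∧ unit q f) f)
        (cong₂ _xor_ (trans (·-xor A b (λ f → x ∧ unit p f) f) (cong ((A · b) f xor_) (scaled x p))) (scaled y q))
        where
        scaled : ∀ x p → (A · (λ f → x ∧ unit p f)) f ≡ x ∧ A f p
        scaled x p = trans (·-scale A x (unit p) f) (cong (x ∧_) (·-unit A f p))

      rest : Cube (2 + F₁) → Cube F₁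
      rest x i = x (suc (suc i))

      -- Adds the plane spanned by the units at `p` and `q` to the kernel vectors coming from face
      -- functions of `ρ`. As `A p q` is true, applying `A` reads the two coefficients back at `q`
      -- and `p`.
      Ψ : Cube (2 + F₁) → Cube F
      Ψ x = adjust (proj₁ (faces⇒related (rest x))) (x 0F) (x 1F)

      A-Ψ : ∀ x f → (A · Ψ x) f ≡ (x 0F ∧ A f p) xor (x 1F ∧ A f q)
      A-Ψ x f = let b , r = faces⇒related (rest x) in
        trans (A-adjust b (x 0F) (x 1F) f) (cong (λ z → (z xor (x 0F ∧ A f p)) xor (x 1F ∧ A f q)) (related⇒kernel r f))

      A-Ψ-p : ∀ x → (A · Ψ x) p ≡ x 1F
      A-Ψ-p x = trans (A-Ψ x p) (trans (cong₂ (λ u v → (x 0F ∧ u) xor (x 1F ∧ v)) (A-loop p) pq)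
        (cong₂ _xor_ (∧-zeroʳ (x 0F)) (∧-identityʳ (x 1F))))

      A-Ψ-q : ∀ x → (A · Ψ x) q ≡ x 0F
      A-Ψ-q x = trans (A-Ψ x q) (trans (cong₂ (λ u v → (x 0F ∧ u) xor (x 1F ∧ v)) qp (A-loop q))
        (trans (cong₂ _xor_ (∧-identityʳ (x 0F)) (∧-zeroʳ (x 1F))) (Boolₚ.xor-identityʳ (x 0F))))

      Ψ-injective : CubeInjective Ψ
      Ψ-injective x y eq = go
        where
        eq₀ : x 0F ≡ y 0F
        eq₀ = trans (sym (A-Ψ-q x)) (trans (·-congʳ A eq q) (A-Ψ-q y))
        eq₁ : x 1F ≡ y 1F
        eq₁ = trans (sym (A-Ψ-p x)) (trans (·-congʳ A eq p) (A-Ψ-p y))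
        rel-x = faces⇒related (rest x)
        rel-y = faces⇒related (rest y)
        b-eq : proj₁ rel-x ≗ proj₁ rel-y
        b-eq f = xor-cancelʳ (trans (eq f) (cong₂ (λ u v → (proj₁ rel-y f xor (u ∧ unit p f)) xor (v ∧ unit q f)) (sym eq₀) (sym eq₁)))
          where
          xor-cancelʳ : ∀ {a b u v} → (a xor u) xor v ≡ (b xor u) xor v → a ≡ b
          xor-cancelʳ {a} {b} {u} {v} h = trans (solve 3 (λ a u v → a := (((a :+ u) :+ v) :+ v) :+ u) refl a u v)
            (trans (cong (λ z → (z xor v) xor u) h) (solve 3 (λ a u v → (((a :+ u) :+ v) :+ v) :+ u := a) refl b u v))
        go : x ≗ y
        go zero          = eq₀
        go (suc zero)    = eq₁
        go (suc (suc i)) = related-injectiveˡ (proj₂ rel-x) (proj₂ rel-y) b-eq i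

    -- By counting, `Ψ` is onto, so the unit at `g` is a kernel vector plus multiples of the units
    -- at `p` and `q`; applying `A` writes column `g` through columns `p` and `q`.
    two-fewer⇒rank-two : F ≡ 2 + F₁ → RankTwo p q
    two-fewer⇒rank-two F≡ = pq , λ f g →
      let x , hit = cube-injective⇒surjective Ψ Ψ-injective (ℕₚ.≤-reflexive F≡) (unit g)
          row : ∀ f → A f g ≡ (A · Ψ x) f
          row f = trans (sym (·-unit A f g)) (sym (·-congʳ A hit f))
      in trans (row f) (trans (A-Ψ x f)
           (cong₂ (λ u v → (u ∧ A f p) xor (v ∧ A f q)) (sym (trans (row q) (A-Ψ-q x))) (sym (trans (row p) (A-Ψ-p x)))))

    -- `Ψ` gives one inequality. For the other, `project` corrects `b` at `p` and `q` to a kernel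
    -- vector, and `Θ` records the two corrections next to the face function of `ρ` related to it.
    rank-two⇒two-fewer : RankTwo p q → F ≡ 2 + F₁
    rank-two⇒two-fewer (_ , rank) = ℕₚ.≤-antisym (cube-injective⇒≤ Θ Θ-injective) (cube-injective⇒≤ Ψ Ψ-injective)
      where
      open ≡-Reasoning
      project : Cube F → Cube F
      project b = adjust b ((A · b) q) ((A · b) p)
      A-expand : ∀ b f → (A · b) f ≡ ((A · b) q ∧ A f p) xor ((A · b) p ∧ A f q)
      A-expand b f = begin
        (A · b) f
          ≡⟨ ∑-cong (λ g → trans (cong (_∧ b g) (rank f g))
               (solve 5 (λ u v w x y → ((u :* v) :+ (w :* x)) :* y := (v :* (u :* y)) :+ (x :* (w :* y))) refl
                 (A q g) (A f p) (A p g) (A f q) (b g))) ⟩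
        ∑ (λ g → (A f p ∧ (A q g ∧ b g)) xor (A f q ∧ (A p g ∧ b g)))
          ≡⟨ ∑-xor (λ g → A f p ∧ (A q g ∧ b g)) (λ g → A f q ∧ (A p g ∧ b g)) ⟩
        ∑ (λ g → A f p ∧ (A q g ∧ b g)) xor ∑ (λ g → A f q ∧ (A p g ∧ b g))
          ≡⟨ cong₂ _xor_ (trans (∑-∧ˡ (A f p) (λ g → A q g ∧ b g)) (∧-comm (A f p) ((A · b) q)))
                         (trans (∑-∧ˡ (A f q) (λ g → A p g ∧ b g)) (∧-comm (A f q) ((A · b) p))) ⟩
        ((A · b) q ∧ A f p) xor ((A · b) p ∧ A f q) ∎
      project-kernel : ∀ b → Kernel A (project b)
      project-kernel b f = trans (A-adjust b _ _ f) (trans (cong (λ z → (z xor ((A · b) q ∧ A f p)) xor ((A · b) p ∧ A f q)) (A-expand b f))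
        (solve 2 (λ x y → ((x :+ y) :+ x) :+ y := con false) refl ((A · b) q ∧ A f p) ((A · b) p ∧ A f q)))
      lift : ∀ b → ∃ λ c → Related c (project b)
      lift b = kernel⇒related (project b) (project-kernel b)
      Θ : Cube F → Cube (2 + F₁)
      Θ b = prepend ((A · b) q) (prepend ((A · b) p) (proj₁ (lift b)))
      Θ-injective : CubeInjective Θ
      Θ-injective b b′ eq f = begin
        b f
          ≡⟨ restore (b f) ((A · b) q ∧ unit p f) ((A · b) p ∧ unit q f) ⟩
        (project b f xor ((A · b) q ∧ unit p f)) xor ((A · b) p ∧ unit q f)
          ≡⟨ cong₂ (λ u v → (u xor (proj₁ v ∧ unit p f)) xor (proj₂ v ∧ unit q f))
               (related-injectiveʳ (proj₂ (lift b)) (proj₂ (lift b′)) (λ i → eq (suc (suc i))) f) (cong₂ _,_ (eq 0F) (eq 1F)) ⟩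
        (project b′ f xor ((A · b′) q ∧ unit p f)) xor ((A · b′) p ∧ unit q f)
          ≡⟨ sym (restore (b′ f) ((A · b′) q ∧ unit p f) ((A · b′) p ∧ unit q f)) ⟩
        b′ f ∎
        where
        restore : ∀ a u v → a ≡ (((a xor u) xor v) xor u) xor v
        restore = solve 3 (λ a u v → a := (((a :+ u) :+ v) :+ u) :+ v) refl

  -- If `S` were empty, `A` would vanish and every `b` would lie in its kernel, forcing `F ≤ F₁`.
  edge-exists : F ≡ 2 + F₁ → ∃ λ d → S d ≡ true
  edge-exists F≡ with any? (λ i → S (Enum.el darts i) Boolₚ.≟ true)
  ... | yes (i , h) = Enum.el darts i , h
  ... | no ¬h = contradiction (cube-injective⇒≤ (λ b → proj₁ (all-related b)) λ b b′ → related-injectiveʳ (proj₂ (all-related b)) (proj₂ (all-related b′)))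
                  (ℕₚ.<⇒≱ (subst (F₁ <_) (sym F≡) (ℕₚ.m≤n⇒m≤1+n ℕₚ.≤-refl)))
    where
    S≡false : ∀ d → S d ≡ false
    S≡false d = ≢true⇒≡false λ h → ¬h (Enum.ix darts d , trans (cong S (Enum.el-ix darts d)) h)
    all-related : ∀ b → ∃ λ c → Related c b
    all-related b = kernel⇒related b λ f → trans (A-value b f) (∑ᴱ-zero λ d →
      trans (cong (λ s → δ (face d) f ∧ (s ∧ b (face (rev G d)))) (S≡false d)) (∧-zeroʳ (δ (face d) f)))

-- Complete multipartite subgraphs of the dual

odd : ℕ → Bool
odd zero    = false
odd (suc n) = not (odd n)

∑-const : ∀ n b → ∑ {n} (λ _ → b) ≡ odd n ∧ b
∑-const zero    b = ∑-empty _
∑-const (suc n) b = trans (∑-suc _) (trans (cong (b xor_) (∑-const n b)) (lemma b (odd n)))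
  where
  lemma : ∀ b o → b xor (o ∧ b) ≡ not o ∧ b
  lemma false false = refl
  lemma false true  = refl
  lemma true  false = refl
  lemma true  true  = refl

∑-countTrue : ∀ {n} (p : Fin n → Bool) → ∑ p ≡ odd (countTrue p)
∑-countTrue {zero}  p = ∑-empty p
∑-countTrue {suc n} p = trans (∑-suc p) (trans (cong (p zero xor_) (∑-countTrue (p ∘ suc))) (lemma (p zero)))
  where
  lemma : ∀ b → b xor odd (countTrue (p ∘ suc)) ≡ odd ((if b then 1 else 0) + countTrue (p ∘ suc))
  lemma false = refl
  lemma true  = refl

countTrue-xor : ∀ {n} (p q : Fin n → Bool) → (∀ i → p i ≡ true → q i ≡ true → ⊥) →
                countTrue (λ i → p i xor q i) ≡ countTrue p + countTrue q
countTrue-xor {zero}  p q disjoint = refl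
countTrue-xor {suc n} p q disjoint with p zero in p₀ | q zero in q₀ | countTrue-xor (p ∘ suc) (q ∘ suc) (disjoint ∘ suc)
... | false | false | ih = ih
... | true  | false | ih = cong suc ih
... | false | true  | ih = trans (cong suc ih) (sym (ℕₚ.+-suc _ _))
... | true  | true  | ih = ⊥-elim (disjoint zero p₀ q₀)

odd-+ : ∀ m n → odd (m + n) ≡ odd m xor odd n
odd-+ zero    n = refl
odd-+ (suc m) n = trans (cong not (odd-+ m n)) (lemma (odd m) (odd n))
  where
  lemma : ∀ a b → not (a xor b) ≡ not a xor b
  lemma false b = refl
  lemma true  b = Boolₚ.not-involutive b

odd-double : ∀ m → odd (2 * m) ≡ false
odd-double m = trans (cong (λ k → odd (m + k)) (ℕₚ.+-identityʳ m)) (trans (odd-+ m m) (xor-self (odd m)))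

odd-double-pred : ∀ m → 1 ≤ m → odd (2 * m ∸ 1) ≡ true
odd-double-pred (suc m) _ = trans (cong odd (ℕₚ.+-suc m (m + 0))) (cong not (odd-double m))

even⇒double : ∀ n → 1 ≤ n → odd n ≡ false → ∃ λ m → 1 ≤ m × n ≡ 2 * m
even⇒double (suc (suc zero))    _ h = 1 , s≤s z≤n , refl
even⇒double (suc (suc (suc n))) _ h with even⇒double (suc n) (s≤s z≤n) (trans (sym (Boolₚ.not-involutive _)) h)
... | m , _ , eq = suc m , s≤s z≤n , trans (cong (λ k → suc (suc k)) eq) (cong suc (sym (ℕₚ.+-suc m (m + 0))))

odd⇒double-pred : ∀ n → odd n ≡ true → ∃ λ m → 1 ≤ m × n ≡ 2 * m ∸ 1
odd⇒double-pred n h with even⇒double (suc n) (s≤s z≤n) (cong not h)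
... | m , 1≤m , eq = m , 1≤m , cong (_∸ 1) eq

-- The three families, with a record of which label class plays which part.
data Sizes (a b c : ℕ) : Set where
  octahedral : a ≡ 2 → b ≡ 2 → c ≡ 2 → Sizes a b c
  bipartiteˡ : c ≡ 0 → a ≡ 2 → (∃ λ m → 1 ≤ m × b ≡ 2 * m) → Sizes a b c
  bipartiteʳ : c ≡ 0 → b ≡ 2 → (∃ λ m → 1 ≤ m × a ≡ 2 * m) → Sizes a b c
  tripartite₁ : b ≡ 1 → c ≡ 1 → (∃ λ m → 1 ≤ m × a ≡ 2 * m ∸ 1) → Sizes a b c
  tripartite₂ : a ≡ 1 → c ≡ 1 → (∃ λ m → 1 ≤ m × b ≡ 2 * m ∸ 1) → Sizes a b c
  tripartite₃ : a ≡ 1 → b ≡ 1 → (∃ λ m → 1 ≤ m × c ≡ 2 * m ∸ 1) → Sizes a b c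

-- The last three hypotheses forbid a K₃,₃ between one class and the union of the other two. Triples
-- without a clause contradict the parities or the nonemptiness of the first two classes.
classify : ∀ a b c → 1 ≤ a → 1 ≤ b → odd a ≡ odd c → odd b ≡ odd c →
           (3 ≤ a → 3 ≤ b + c → ⊥) → (3 ≤ b → 3 ≤ a + c → ⊥) → (3 ≤ c → 3 ≤ a + b → ⊥) → Sizes a b c
classify 2 b 0 _ 1≤b _ ob _ _ _ = bipartiteˡ refl refl (even⇒double b 1≤b ob)
classify (suc (suc (suc a))) 2 0 1≤a _ oa _ _ _ _ = bipartiteʳ refl refl (even⇒double _ 1≤a oa)
classify (suc (suc (suc a))) (suc (suc (suc b))) 0 _ _ _ _ h _ _ =
  ⊥-elim (h (s≤s (s≤s (s≤s z≤n))) (s≤s (s≤s (s≤s z≤n))))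
classify 1 b 1 _ _ _ ob _ _ _ = tripartite₂ refl refl (odd⇒double-pred b ob)
classify (suc (suc (suc a))) 1 1 _ _ oa _ _ _ _ = tripartite₁ refl refl (odd⇒double-pred _ oa)
classify (suc (suc (suc a))) (suc (suc (suc b))) 1 _ _ _ _ h _ _ =
  ⊥-elim (h (s≤s (s≤s (s≤s z≤n))) (s≤s (s≤s (s≤s z≤n))))
classify 2 2 2 _ _ _ _ _ _ _ = octahedral refl refl refl
classify (suc (suc (suc a))) (suc b) 2 _ _ _ _ h _ _ =
  ⊥-elim (h (s≤s (s≤s (s≤s z≤n))) (s≤s (subst (2 ≤_) (ℕₚ.+-comm 2 b) (s≤s (s≤s z≤n)))))
classify 2 (suc (suc (suc b))) 2 _ _ _ _ _ h _ = ⊥-elim (h (s≤s (s≤s (s≤s z≤n))) (s≤s (s≤s (s≤s z≤n))))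
classify 1 1 (suc (suc (suc c))) _ _ oa _ _ _ _ = tripartite₃ refl refl (odd⇒double-pred _ (sym oa))
classify (suc (suc a)) (suc b) (suc (suc (suc c))) _ _ _ _ _ _ h =
  ⊥-elim (h (s≤s (s≤s (s≤s z≤n))) (s≤s (s≤s (subst (1 ≤_) (sym (ℕₚ.+-suc a b)) (s≤s z≤n)))))
classify 1 (suc (suc b)) (suc (suc (suc c))) _ _ _ _ _ _ h = ⊥-elim (h (s≤s (s≤s (s≤s z≤n))) (s≤s (s≤s (s≤s z≤n))))

-- The alternating form on F2², true exactly on pairs of distinct nonzero vectors.
det : Bool → Bool → Bool → Bool → Bool
det a b c d = (a ∧ d) xor (b ∧ c)

module EdgeSets (G : Graph) (E : EdgeSet G) where
  open Darts G

  selected : Dart G → Bool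
  selected d = S E (tail G d) (head d)

  selected-rev : ∀ d → selected (rev G d) ≡ selected d
  selected-rev d = S-sym E (head d) (tail G d)

module MultipartiteDual (G : Graph) (three : ThreeConnected G) (cubic : Regular G 3) (ρ₀ : RotationSystem G)
                        (F : ℕ) (faceCount₀ : HasFaceCount G ρ₀ F)
                        (euler : 2 * (Graph.n G + F) + 4 * 0 ≡ degreeSum G + 4)
                        (E : EdgeSet G) where
  open Darts G
  open EnumSum darts
  open FaceSteps G ρ₀
  open Sphere G three cubic ρ₀ F faceCount₀ euler
  open EdgeSets G E
  open DualMatrix G three cubic ρ₀ F faceCount₀ euler selected selected-rev
  open Classes faces using (rep; cls-rep; cls-reach)

  private
    sameFace⇒ : ∀ {f d} → SameFace G ρ₀ (rep f) d → f ≡ face d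
    sameFace⇒ {f} r = trans (sym (cls-rep f)) (cls-reach r)

    ⇒sameFace : ∀ {f d} → f ≡ face d → SameFace G ρ₀ (rep f) d
    ⇒sameFace {f} eq = same faces (trans (cls-rep f) eq)

  -- An intermediate form of the isomorphism, with the parts as indicator functions on faces, which
  -- is how label classes arise.
  record Partition {k} (sizes : Vec ℕ k) : Set where
    field
      P        : Fin k → Fin F → Bool
      size     : ∀ i → countTrue (P i) ≡ lookup sizes i
      disjoint : ∀ {i j f} → P i f ≡ true → P j f ≡ true → i ≡ j
      edge     : ∀ d → selected d ≡ true → ∃ λ i → ∃ λ j → i ≢ j × P i (face d) ≡ true × P j (face (rev G d)) ≡ true
      complete : ∀ {i j f g} → i ≢ j → P i f ≡ true → P j g ≡ true →
                 ∃ λ d → selected d ≡ true × face d ≡ f × face (rev G d) ≡ g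

  partition⇒iso : ∀ {k} {sizes : Vec ℕ k} → Partition sizes → DualSubgraphIso G ρ₀ E sizes
  partition⇒iso {k} {sizes} partition =
    rep ∘ vertex ,
    (λ x y r → vertex-injective x y (trans (sameFace⇒ r) (cls-rep (vertex y)))) ,
    (λ u v e → let i , j , i≢j , p , q = edge (sdart G E u v e) (T⇒true e)
                   x , x-eq = part-vertex p
                   y , y-eq = part-vertex q
               in (i , x) , (j , y) , i≢j , ⇒sameFace x-eq , ⇒sameFace y-eq) ,
    (λ x y x≢y → let d , s , p , q = complete x≢y (vertex-part x) (vertex-part y)
                 in tail G d , head d , true⇒T s , ⇒sameFace (trans (sym p) (cong face (dart-≡ refl refl))) ,
                    ⇒sameFace (trans (sym q) (cong (face ∘ rev G) (dart-≡ refl refl)))) ,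
    λ x y u v e u′ v′ e′ p q p′ q′ →
      let eq = dual-simple (sdart G E u v e) (sdart G E u′ v′ e′)
                 (trans (sym (sameFace⇒ p)) (sameFace⇒ p′)) (trans (sym (sameFace⇒ q)) (sameFace⇒ q′))
      in cong (tail G) eq , cong head eq
    where
    open Partition partition
    members : ∀ i → Enum (Σ (Fin F) (T ∘ P i)) (lookup sizes i)
    members i = subst (Enum _) (size i) (enum-filter (P i))
    vertex : KV G sizes → Fin F
    vertex (i , j) = proj₁ (Enum.el (members i) j)
    vertex-part : ∀ x → P (proj₁ x) (vertex x) ≡ true
    vertex-part (i , j) = T⇒true (proj₂ (Enum.el (members i) j))
    part-vertex : ∀ {i f} → P i f ≡ true → ∃ λ j → vertex (i , j) ≡ f
    part-vertex {i} {f} p = Enum.ix (members i) (f , true⇒T p) , cong proj₁ (Enum.el-ix (members i) (f , true⇒T p))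
    vertex-injective : ∀ x y → vertex x ≡ vertex y → x ≡ y
    vertex-injective (i , j) (i′ , j′) eq
      with disjoint (vertex-part (i , j)) (subst (λ f → P i′ f ≡ true) (sym eq) (vertex-part (i′ , j′)))
    ... | refl = cong (i ,_) (Enum.el-injective (members i) (pair-≡ eq))
      where
      pair-≡ : ∀ {x y : Σ (Fin F) (T ∘ P i)} → proj₁ x ≡ proj₁ y → x ≡ y
      pair-≡ {f , t} {.f , t′} refl = cong (f ,_) (T-irrelevant t t′)

  -- Part `i` is labelled by the vector (`L₁ i`, `L₂ i`). Different parts get independent labels,
  -- and `even₁`, `even₂` say that the labels of all vertices add up to zero.
  module FromIso {k} (sizes : Vec ℕ k) (iso : DualSubgraphIso G ρ₀ E sizes)
                 (L₁ L₂ : Fin k → Bool) (independent : ∀ i j → i ≢ j → det (L₁ i) (L₂ i) (L₁ j) (L₂ j) ≡ true)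
                 (even₁ : ∑ (λ i → odd (lookup sizes i) ∧ L₁ i) ≡ false)
                 (even₂ : ∑ (λ i → odd (lookup sizes i) ∧ L₂ i) ≡ false)
                 (x₀ y₀ : KV G sizes) (x₀≢y₀ : proj₁ x₀ ≢ proj₁ y₀) where
    vertex : KV G sizes → Fin F
    vertex x = face (proj₁ iso x)

    private
      vertex-injective : ∀ {x y} → vertex x ≡ vertex y → x ≡ y
      vertex-injective {x} {y} eq = proj₁ (proj₂ iso) x y (same faces eq)

      edge : ∀ d → selected d ≡ true → ∃ λ x → ∃ λ y → proj₁ x ≢ proj₁ y × vertex x ≡ face d × vertex y ≡ face (rev G d)
      edge d s = let x , y , x≢y , p , q = proj₁ (proj₂ (proj₂ iso)) (tail G d) (head d) (true⇒T s)
                 in x , y , x≢y , trans (cls-reach p) (cong face (dart-≡ refl refl)) ,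
                    trans (cls-reach q) (cong (face ∘ rev G) (dart-≡ refl refl))

      complete : ∀ x y → proj₁ x ≢ proj₁ y → A (vertex x) (vertex y) ≡ true
      complete x y x≢y = let u , v , e , p , q = proj₁ (proj₂ (proj₂ (proj₂ iso))) x y x≢y
                         in dart-A (sdart G E u v e) (T⇒true e) (sym (cls-reach p)) (sym (cls-reach q))

      -- Spreads labels from parts to faces: at most one term survives, and faces outside the
      -- subgraph get zero.
      label : (Fin k → Bool) → Fin F → Bool
      label L g = ∑ λ i → ∑ {lookup sizes i} λ j → δ (vertex (i , j)) g ∧ L i

      label-vertex : ∀ L x → label L (vertex x) ≡ L (proj₁ x)
      label-vertex L (i , j) = trans
        (∑-single i λ i′ i′≢i → ∑-zero λ j′ → cong (_∧ L i′) (δ-≢ λ eq → i′≢i (cong proj₁ (vertex-injective eq))))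
        (trans (∑-single j λ j′ j′≢j → cong (_∧ L i) (δ-≢ λ eq → j′≢j (second (vertex-injective eq))))
          (cong (_∧ L i) (δ-refl (vertex (i , j)))))
        where
        second : ∀ {j′} → _≡_ {A = KV G sizes} (i , j′) (i , j) → j′ ≡ j
        second refl = refl

      label-off : ∀ L g → (∀ x → vertex x ≢ g) → label L g ≡ false
      label-off L g off = ∑-zero λ i → ∑-zero λ j → cong (_∧ L i) (δ-≢ (off (i , j)))

      ∑-label : ∀ L → ∑ (label L) ≡ ∑ λ i → odd (lookup sizes i) ∧ L i
      ∑-label L = trans (∑-swap (λ g i → ∑ {lookup sizes i} λ j → δ (vertex (i , j)) g ∧ L i))
        (∑-cong λ i → trans (∑-swap (λ g j → δ (vertex (i , j)) g ∧ L i))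
          (trans (∑-cong λ j → ∑-δ (vertex (i , j)) (λ _ → L i)) (∑-const (lookup sizes i) (L i))))

      vertex? : ∀ g → Dec (∃ λ x → vertex x ≡ g)
      vertex? g with any? (λ i → any? (λ j → vertex (i , j) ≟F g))
      ... | yes (i , j , eq) = yes ((i , j) , eq)
      ... | no ¬p = no λ ((i , j) , eq) → ¬p (i , j , eq)

      l₁ l₂ : Fin F → Bool
      l₁ = label L₁
      l₂ = label L₂

      A-off : ∀ {f g} → (∀ x y → vertex x ≡ f → vertex y ≡ g → proj₁ x ≡ proj₁ y) → A f g ≡ false
      A-off h = ≢true⇒≡false λ a → let d , p , s , q = A-dart a
                                       x , y , x≢y , p′ , q′ = edge d s
                                   in x≢y (h x y (trans p′ p) (trans q′ q))

      A-det : ∀ f g → A f g ≡ det (l₁ f) (l₂ f) (l₁ g) (l₂ g)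
      A-det f g with vertex? f | vertex? g
      ... | no ¬f | _ = trans (A-off λ x y p q → ⊥-elim (¬f (x , p)))
        (sym (cong₂ (λ a b → det a b (l₁ g) (l₂ g)) (label-off L₁ f λ x p → ¬f (x , p)) (label-off L₂ f λ x p → ¬f (x , p))))
      ... | _ | no ¬g = trans (A-off λ x y p q → ⊥-elim (¬g (y , q)))
        (sym (trans (cong₂ (λ a b → det (l₁ f) (l₂ f) a b) (label-off L₁ g λ x p → ¬g (x , p)) (label-off L₂ g λ x p → ¬g (x , p)))
          (cong₂ _xor_ (∧-zeroʳ (l₁ f)) (∧-zeroʳ (l₂ f)))))
      ... | yes (x , refl) | yes (y , refl) = trans (at (proj₁ x ≟F proj₁ y))
        (sym (trans (cong₂ (λ a b → det a b (l₁ (vertex y)) (l₂ (vertex y))) (label-vertex L₁ x) (label-vertex L₂ x))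
                    (cong₂ (det (L₁ (proj₁ x)) (L₂ (proj₁ x))) (label-vertex L₁ y) (label-vertex L₂ y))))
        where
        det-self : ∀ a b → det a b a b ≡ false
        det-self a b = trans (cong ((a ∧ b) xor_) (∧-comm b a)) (xor-self (a ∧ b))
        at : Dec (proj₁ x ≡ proj₁ y) → A (vertex x) (vertex y) ≡ det (L₁ (proj₁ x)) (L₂ (proj₁ x)) (L₁ (proj₁ y)) (L₂ (proj₁ y))
        at (no x≢y) = trans (complete x y x≢y) (sym (independent _ _ x≢y))
        at (yes eq) = trans
          (A-off λ x′ y′ p q → trans (cong proj₁ (vertex-injective p)) (trans eq (cong proj₁ (sym (vertex-injective q)))))
          (sym (trans (cong (λ i → det (L₁ (proj₁ x)) (L₂ (proj₁ x)) (L₁ i) (L₂ i)) (sym eq)) (det-self (L₁ (proj₁ x)) (L₂ (proj₁ x)))))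

    -- By bilinearity, the degree of `f` mod 2 is the determinant of its label with the sum of all
    -- labels, which is zero.
    closed : ∀ f → ∑ᴱ (λ d → δ (face d) f ∧ selected d) ≡ false
    closed f = begin
      ∑ᴱ (λ d → δ (face d) f ∧ selected d)
        ≡⟨ ∑ᴱ-cong (λ d → cong (δ (face d) f ∧_) (sym (∧-identityʳ (selected d)))) ⟩
      ∑ᴱ (λ d → δ (face d) f ∧ (selected d ∧ true))
        ≡⟨ sym (A-value (λ _ → true) f) ⟩
      ∑ (λ g → A f g ∧ true)
        ≡⟨ ∑-cong (λ g → trans (∧-identityʳ (A f g)) (A-det f g)) ⟩
      ∑ (λ g → (l₁ f ∧ l₂ g) xor (l₂ f ∧ l₁ g))
        ≡⟨ ∑-xor (λ g → l₁ f ∧ l₂ g) (λ g → l₂ f ∧ l₁ g) ⟩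
      ∑ (λ g → l₁ f ∧ l₂ g) xor ∑ (λ g → l₂ f ∧ l₁ g)
        ≡⟨ cong₂ _xor_ (trans (∑-∧ˡ (l₁ f) l₂) (trans (cong (l₁ f ∧_) (trans (∑-label L₂) even₂)) (∧-zeroʳ (l₁ f))))
                       (trans (∑-∧ˡ (l₂ f) l₁) (trans (cong (l₂ f ∧_) (trans (∑-label L₁) even₁)) (∧-zeroʳ (l₂ f)))) ⟩
      false ∎
      where open ≡-Reasoning

    -- The Grassmann-Plücker relation among the labels of `p`, `q`, `f`, `g`, where the labels of
    -- `p` and `q` have determinant 1.
    rankTwo : RankTwo (vertex x₀) (vertex y₀)
    rankTwo = complete x₀ y₀ x₀≢y₀ , λ f g → begin
      A f g
        ≡⟨ cong (_∧ A f g) (sym (complete x₀ y₀ x₀≢y₀)) ⟩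
      A p q ∧ A f g
        ≡⟨ cong₂ _∧_ (A-det p q) (A-det f g) ⟩
      det (l₁ p) (l₂ p) (l₁ q) (l₂ q) ∧ det (l₁ f) (l₂ f) (l₁ g) (l₂ g)
        ≡⟨ plücker (l₁ p) (l₂ p) (l₁ q) (l₂ q) (l₁ f) (l₂ f) (l₁ g) (l₂ g) ⟩
      (det (l₁ q) (l₂ q) (l₁ g) (l₂ g) ∧ det (l₁ f) (l₂ f) (l₁ p) (l₂ p)) xor
      (det (l₁ p) (l₂ p) (l₁ g) (l₂ g) ∧ det (l₁ f) (l₂ f) (l₁ q) (l₂ q))
        ≡⟨ sym (cong₂ _xor_ (cong₂ _∧_ (A-det q g) (A-det f p)) (cong₂ _∧_ (A-det p g) (A-det f q))) ⟩
      (A q g ∧ A f p) xor (A p g ∧ A f q) ∎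
      where
      open ≡-Reasoning
      p = vertex x₀
      q = vertex y₀
      plücker : ∀ p₁ p₂ q₁ q₂ f₁ f₂ g₁ g₂ → det p₁ p₂ q₁ q₂ ∧ det f₁ f₂ g₁ g₂ ≡
                (det q₁ q₂ g₁ g₂ ∧ det f₁ f₂ p₁ p₂) xor (det p₁ p₂ g₁ g₂ ∧ det f₁ f₂ q₁ q₂)
      plücker = solve 8 (λ p₁ p₂ q₁ q₂ f₁ f₂ g₁ g₂ →
        ((p₁ :* q₂) :+ (p₂ :* q₁)) :* ((f₁ :* g₂) :+ (f₂ :* g₁)) :=
        (((q₁ :* g₂) :+ (q₂ :* g₁)) :* ((f₁ :* p₂) :+ (f₂ :* p₁))) :+
        (((p₁ :* g₂) :+ (p₂ :* g₁)) :* ((f₁ :* q₂) :+ (f₂ :* q₁)))) refl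

countTrue-empty : ∀ {n} (p : Fin n → Bool) → countTrue p ≡ 0 → ∀ i → p i ≢ true
countTrue-empty p eq i h with subst Fin eq (Enum.ix (enum-filter p) (i , true⇒T h))
... | ()

countTrue-nonempty : ∀ {n} (p : Fin n → Bool) i → p i ≡ true → 1 ≤ countTrue p
countTrue-nonempty p i h = ℕₚ.≤-trans (s≤s z≤n) (Finₚ.toℕ<n (Enum.ix (enum-filter p) (i , true⇒T h)))

choose : ∀ {n k} (p : Fin n → Bool) → k ≤ countTrue p →
         ∃ λ (h : Fin k → Fin n) → (∀ {i j} → h i ≡ h j → i ≡ j) × (∀ i → p (h i) ≡ true)
choose {n} {k} p k≤ = (λ i → proj₁ (pick i)) ,
  (λ eq → Finₚ.inject≤-injective k≤ k≤ _ _ (Enum.el-injective (enum-filter p) (pair-≡ eq))) ,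
  (λ i → T⇒true (proj₂ (pick i)))
  where
  pick : Fin k → Σ (Fin n) (T ∘ p)
  pick i = Enum.el (enum-filter p) (inject≤ i k≤)
  pair-≡ : ∀ {x y : Σ (Fin n) (T ∘ p)} → proj₁ x ≡ proj₁ y → x ≡ y
  pair-≡ {i , t} {.i , t′} refl = cong (i ,_) (T-irrelevant t t′)

-- The parts of the dual subgraph are the level sets of a labelling of its faces by the nonzero vectors (1,0), (0,1), (1,1).
point : Fin 3 → Bool → Bool → Bool
point 0F true  false = true
point 1F false true  = true
point 2F true  true  = true
point _  _     _     = false

point-split : ∀ a b c d → det a b c d ≡ true → ∃ λ i → ∃ λ j → i ≢ j × point i a b ≡ true × point j c d ≡ true
point-split true  false false true  _ = 0F , 1F , (λ ()) , refl , refl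
point-split true  false true  true  _ = 0F , 2F , (λ ()) , refl , refl
point-split false true  true  false _ = 1F , 0F , (λ ()) , refl , refl
point-split false true  true  true  _ = 1F , 2F , (λ ()) , refl , refl
point-split true  true  true  false _ = 2F , 0F , (λ ()) , refl , refl
point-split true  true  false true  _ = 2F , 1F , (λ ()) , refl , refl

point-unique : ∀ i j a b → point i a b ≡ true → point j a b ≡ true → i ≡ j
point-unique 0F 0F _ _ _ _ = refl
point-unique 1F 1F _ _ _ _ = refl
point-unique 2F 2F _ _ _ _ = refl
point-unique 0F 1F true false _ ()
point-unique 0F 2F true false _ ()
point-unique 1F 0F false true _ ()
point-unique 1F 2F false true _ ()
point-unique 2F 0F true true _ ()
point-unique 2F 1F true true _ ()

point-det : ∀ i j a b c d → i ≢ j → point i a b ≡ true → point j c d ≡ true → det a b c d ≡ true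
point-det 0F 0F _ _ _ _ i≢j _ _ = contradiction refl i≢j
point-det 1F 1F _ _ _ _ i≢j _ _ = contradiction refl i≢j
point-det 2F 2F _ _ _ _ i≢j _ _ = contradiction refl i≢j
point-det 0F 1F true false false true _ _ _ = refl
point-det 0F 2F true false true true _ _ _ = refl
point-det 1F 0F false true true false _ _ _ = refl
point-det 1F 2F false true true true _ _ _ = refl
point-det 2F 0F true true true false _ _ _ = refl
point-det 2F 1F true true false true _ _ _ = refl

-- From rank two to the three families.

module FromRank (G : Graph) (three : ThreeConnected G) (cubic : Regular G 3) (ρ₀ : RotationSystem G)
                (F : ℕ) (faceCount₀ : HasFaceCount G ρ₀ F)
                (euler : 2 * (Graph.n G + F) + 4 * 0 ≡ degreeSum G + 4)
                (E : EdgeSet G) where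
  open Darts G
  open EnumSum darts
  open Sphere G three cubic ρ₀ F faceCount₀ euler
  open EdgeSets G E
  open DualMatrix G three cubic ρ₀ F faceCount₀ euler selected selected-rev
  open MultipartiteDual G three cubic ρ₀ F faceCount₀ euler E using (Partition; partition⇒iso)

  module _ (closed : ∀ f → ∑ᴱ (λ d → δ (face d) f ∧ selected d) ≡ false) (p q : Fin F) (rankTwo : RankTwo p q) where
    private
      -- The face `q` gets the label (1,0) and `p` gets (0,1), so classes `0F` and `1F` are
      -- nonempty; class `2F` may be empty, which is the bipartite case.
      l₁ l₂ : Fin F → Bool
      l₁ f = A f p
      l₂ f = A f q

      A-det : ∀ f g → A f g ≡ det (l₁ f) (l₂ f) (l₁ g) (l₂ g)
      A-det f g = trans (proj₂ rankTwo f g) (cong₂ _xor_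
        (trans (∧-comm (A q g) (A f p)) (cong (A f p ∧_) (A-sym q g)))
        (trans (∧-comm (A p g) (A f q)) (cong (A f q ∧_) (A-sym p g))))

      class : Fin 3 → Fin F → Bool
      class i f = point i (l₁ f) (l₂ f)

      count : Fin 3 → ℕ
      count i = countTrue (class i)

      class-A : ∀ {i j f g} → i ≢ j → class i f ≡ true → class j g ≡ true → A f g ≡ true
      class-A {i} {j} {f} {g} i≢j u v = trans (A-det f g) (point-det i j (l₁ f) (l₂ f) (l₁ g) (l₂ g) i≢j u v)

      row-sum : ∀ g → ∑ (λ f → A f g) ≡ false
      row-sum g = trans (∑-cong λ f → trans (A-sym f g) (sym (∧-identityʳ (A g f))))
        (trans (A-value (λ _ → true) g) (trans (∑ᴱ-cong λ d → cong (δ (face d) g ∧_) (∧-identityʳ (selected d))) (closed g)))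

      -- Column `g` sums to the degree of `g`, which is even; if the column is the indicator of two
      -- classes, their sizes agree mod 2.
      same-parity : ∀ i j g → (∀ f → A f g ≡ class i f xor class j f) → odd (count i) ≡ odd (count j)
      same-parity i j g h = xor≡false⇒≡ (trans (cong₂ _xor_ (sym (∑-countTrue (class i))) (sym (∑-countTrue (class j))))
        (trans (sym (∑-xor (class i) (class j))) (trans (sym (∑-cong h)) (row-sum g))))

      parity₀₂ : odd (count 0F) ≡ odd (count 2F)
      parity₀₂ = same-parity 0F 2F p λ f → lemma (l₁ f) (l₂ f)
        where
        lemma : ∀ a b → a ≡ point 0F a b xor point 2F a b
        lemma false false = refl
        lemma false true  = refl
        lemma true  false = refl
        lemma true  true  = refl

      parity₁₂ : odd (count 1F) ≡ odd (count 2F)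
      parity₁₂ = same-parity 1F 2F q λ f → lemma (l₁ f) (l₂ f)
        where
        lemma : ∀ a b → b ≡ point 1F a b xor point 2F a b
        lemma false false = refl
        lemma false true  = refl
        lemma true  false = refl
        lemma true  true  = refl

      -- Three faces of one class and three of the other two span a K₃,₃ in the dual.
      small : ∀ i j k → i ≢ j → i ≢ k → j ≢ k → 3 ≤ count i → 3 ≤ count j + count k → ⊥
      small i j k i≢j i≢k j≢k 3≤i 3≤jk with choose (class i) 3≤i | choose (λ f → class j f xor class k f)
          (subst (3 ≤_) (sym (countTrue-xor (class j) (class k) λ f u v → j≢k (point-unique j k (l₁ f) (l₂ f) u v))) 3≤jk)
      ... | fs , fs-inj , fs-class | gs , gs-inj , gs-class =
        NoK₃₃.no-K₃₃ G three cubic ρ₀ F faceCount₀ euler fs gs fs-inj gs-inj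
          (λ a b → proj₁ (dart a b)) (λ a b → proj₁ (proj₂ (dart a b))) (λ a b → proj₂ (proj₂ (proj₂ (dart a b))))
        where
        either : ∀ {x y} → x xor y ≡ true → x ≡ true ⊎ y ≡ true
        either {true}  _ = inj₁ refl
        either {false} h = inj₂ h
        dart : ∀ a b → ∃ λ d → face d ≡ fs a × selected d ≡ true × face (rev G d) ≡ gs b
        dart a b = A-dart ([ class-A i≢j (fs-class a) , class-A i≢k (fs-class a) ]′ (either (gs-class b)))

      sizes : Sizes (count 0F) (count 1F) (count 2F)
      sizes = classify _ _ _
        (countTrue-nonempty (class 0F) q (cong₂ (point 0F) (trans (A-sym q p) (proj₁ rankTwo)) (A-loop q)))
        (countTrue-nonempty (class 1F) p (cong₂ (point 1F) (A-loop p) (proj₁ rankTwo)))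
        parity₀₂ parity₁₂
        (small 0F 1F 2F (λ ()) (λ ()) (λ ()))
        (small 1F 0F 2F (λ ()) (λ ()) (λ ()))
        (small 2F 0F 1F (λ ()) (λ ()) (λ ()))

      -- `π` names the class used for each part, in the order of `sizes`; by the covering condition
      -- a class left out is empty.
      arrange : ∀ {k} (sizes : Vec ℕ k) (π : Fin k → Fin 3) → (∀ i j → π i ≡ π j → i ≡ j) →
                (∀ i f → class i f ≡ true → ∃ λ j → π j ≡ i) →
                (∀ i → count (π i) ≡ lookup sizes i) → DualSubgraphIso G ρ₀ E sizes
      arrange sizes π π-injective cover size = partition⇒iso {sizes = sizes} record
        { P        = class ∘ π
        ; size     = size
        ; disjoint = λ {i} {j} {f} u v → π-injective i j (point-unique (π i) (π j) (l₁ f) (l₂ f) u v)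
        ; edge     = λ d s → edge d (trans (sym (A-det (face d) (face (rev G d)))) (dart-A d s refl refl))
        ; complete = λ {i} {j} i≢j u v → let d , p , s , q = A-dart (class-A (i≢j ∘ π-injective i j) u v) in d , s , p , q
        }
        where
        edge : ∀ d → det (l₁ (face d)) (l₂ (face d)) (l₁ (face (rev G d))) (l₂ (face (rev G d))) ≡ true →
               ∃ λ i → ∃ λ j → i ≢ j × class (π i) (face d) ≡ true × class (π j) (face (rev G d)) ≡ true
        edge d h with point-split _ _ _ _ h
        ... | i , j , i≢j , u , v with cover i (face d) u | cover j (face (rev G d)) v
        ...   | i′ , refl | j′ , refl = i′ , j′ , (λ eq → i≢j (cong π eq)) , u , v

      arrange₃ : ∀ (sizes : Vec ℕ 3) (π : Fin 3 → Fin 3) → (∀ i j → π i ≡ π j → i ≡ j) → (∀ i → ∃ λ j → π j ≡ i) →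
                 count (π 0F) ≡ lookup sizes 0F → count (π 1F) ≡ lookup sizes 1F → count (π 2F) ≡ lookup sizes 2F →
                 DualSubgraphIso G ρ₀ E sizes
      arrange₃ sizes π inj surj s₀ s₁ s₂ = arrange sizes π inj (λ i _ _ → surj i) λ { 0F → s₀ ; 1F → s₁ ; 2F → s₂ }

      arrange₂ : ∀ (sizes : Vec ℕ 2) (π : Fin 2 → Fin 3) → (∀ i j → π i ≡ π j → i ≡ j) →
                 (∀ i → i ≡ 2F ⊎ ∃ λ j → π j ≡ i) → count 2F ≡ 0 →
                 count (π 0F) ≡ lookup sizes 0F → count (π 1F) ≡ lookup sizes 1F → DualSubgraphIso G ρ₀ E sizes
      arrange₂ sizes π inj surj empty s₀ s₁ = arrange sizes π inj cover λ { 0F → s₀ ; 1F → s₁ }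
        where
        cover : ∀ i f → class i f ≡ true → ∃ λ j → π j ≡ i
        cover i f u with surj i
        ... | inj₁ refl = contradiction u (countTrue-empty (class 2F) empty f)
        ... | inj₂ hit  = hit

      injective? : ∀ {k} (π : Fin k → Fin 3) → Dec (∀ i j → π i ≡ π j → i ≡ j)
      injective? π = all? λ i → all? λ j → (π i ≟F π j) →-dec (i ≟F j)

      surjective? : (π : Fin 3 → Fin 3) → Dec (∀ i → ∃ λ j → π j ≡ i)
      surjective? π = all? λ i → any? λ j → π j ≟F i

      from-sizes : Sizes (count 0F) (count 1F) (count 2F) → GoodDualSubgraph G ρ₀ E
      from-sizes (octahedral a b c) = inj₁ (arrange₃ (2 ∷ 2 ∷ 2 ∷ []) id (from-yes (injective? id)) (from-yes (surjective? id)) a b c)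
      from-sizes (bipartiteˡ c a (m , 1≤m , b)) = inj₂ (inj₁ (m , 1≤m , arrange₂ (2 ∷ 2 * m ∷ []) π (from-yes (injective? π)) (λ { 0F → inj₂ (0F , refl) ; 1F → inj₂ (1F , refl) ; 2F → inj₁ refl }) c a b))
        where
        π : Fin 2 → Fin 3
        π = lookup (0F ∷ 1F ∷ [])
      from-sizes (bipartiteʳ c b (m , 1≤m , a)) = inj₂ (inj₁ (m , 1≤m , arrange₂ (2 ∷ 2 * m ∷ []) π (from-yes (injective? π)) (λ { 0F → inj₂ (1F , refl) ; 1F → inj₂ (0F , refl) ; 2F → inj₁ refl }) c b a))
        where
        π : Fin 2 → Fin 3
        π = lookup (1F ∷ 0F ∷ [])
      from-sizes (tripartite₁ b c (m , 1≤m , a)) = inj₂ (inj₂ (m , 1≤m , arrange₃ (1 ∷ 1 ∷ 2 * m ∸ 1 ∷ []) π (from-yes (injective? π)) (from-yes (surjective? π)) b c a))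
        where
        π : Fin 3 → Fin 3
        π = lookup (1F ∷ 2F ∷ 0F ∷ [])
      from-sizes (tripartite₂ a c (m , 1≤m , b)) = inj₂ (inj₂ (m , 1≤m , arrange₃ (1 ∷ 1 ∷ 2 * m ∸ 1 ∷ []) π (from-yes (injective? π)) (from-yes (surjective? π)) a c b))
        where
        π : Fin 3 → Fin 3
        π = lookup (0F ∷ 2F ∷ 1F ∷ [])
      from-sizes (tripartite₃ a b (m , 1≤m , c)) = inj₂ (inj₂ (m , 1≤m , arrange₃ (1 ∷ 1 ∷ 2 * m ∸ 1 ∷ []) id (from-yes (injective? id)) (from-yes (surjective? id)) a b c))

    good : GoodDualSubgraph G ρ₀ E
    good = from-sizes sizes

-- The bijection between toroidal embeddings and dual subgraphs.

module Correspondence (G : Graph) (three : ThreeConnected G) (cubic : Regular G 3) (ρ₀ : RotationSystem G)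
                      (F : ℕ) (faceCount₀ : HasFaceCount G ρ₀ F)
                      (euler : 2 * (Graph.n G + F) + 4 * 0 ≡ degreeSum G + 4) where
  open Darts G
  open Cubic cubic using (vdart)
  open EnumSum darts
  open Sphere G three cubic ρ₀ F faceCount₀ euler
  open Flips G cubic ρ₀
  open EdgeSets G

  private
    d₀ : Dart G
    d₀ = vdart (fromℕ< {0} (ℕₚ.≤-trans (s≤s z≤n) (proj₁ three)))

    genus-one⇒two-fewer : ∀ F₁ → 2 * (n + F₁) + 4 * 1 ≡ degreeSum G + 4 → F ≡ 2 + F₁
    genus-one⇒two-fewer F₁ euler₁ = ℕₚ.+-cancelˡ-≡ n F (2 + F₁) (ℕₚ.*-cancelˡ-≡ (n + F) (n + (2 + F₁)) 2 (begin
      2 * (n + F)             ≡⟨ sym (ℕₚ.+-identityʳ (2 * (n + F))) ⟩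
      2 * (n + F) + 4 * 0     ≡⟨ trans euler (sym euler₁) ⟩
      -- `4 * 1` is read as `2 * 2`, so that a factor 2 can be cancelled.
      2 * (n + F₁) + 2 * 2    ≡⟨ sym (ℕₚ.*-distribˡ-+ 2 (n + F₁) 2) ⟩
      2 * (n + F₁ + 2)        ≡⟨ cong (2 *_) (trans (ℕₚ.+-assoc n F₁ 2) (cong (n +_) (ℕₚ.+-comm F₁ 2))) ⟩
      2 * (n + (2 + F₁))      ∎))
      where open ≡-Reasoning

    two-fewer⇒genus-one : ∀ F₁ → F ≡ 2 + F₁ → 2 * (n + F₁) + 4 * 1 ≡ degreeSum G + 4
    two-fewer⇒genus-one F₁ F≡ = begin
      2 * (n + F₁) + 2 * 2    ≡⟨ sym (ℕₚ.*-distribˡ-+ 2 (n + F₁) 2) ⟩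
      2 * (n + F₁ + 2)        ≡⟨ cong (2 *_) (trans (ℕₚ.+-assoc n F₁ 2) (cong (n +_) (trans (ℕₚ.+-comm F₁ 2) (sym F≡)))) ⟩
      2 * (n + F)             ≡⟨ sym (ℕₚ.+-identityʳ (2 * (n + F))) ⟩
      2 * (n + F) + 4 * 0     ≡⟨ euler ⟩
      degreeSum G + 4         ∎
      where open ≡-Reasoning

  cutSet : (Fin n → Bool) → EdgeSet G
  cutSet X = record
    { S     = λ u v → adj u v ∧ (X u xor X v)
    ; S-sym = λ u v → cong₂ _∧_ (adj-sym u v) (Boolₚ.xor-comm (X u) (X v))
    ; S-sub = λ u v t → true⇒T (proj₁ (∧-true (T⇒true t)))
    }

  selected-cutSet : ∀ X d → selected (cutSet X) d ≡ crosses X d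
  selected-cutSet X ((u , v) , e) = cong (_∧ (X u xor X v)) (T⇒true e)

  same-edges : ∀ E E′ → (∀ d → selected E d ≡ selected E′ d) → SameEdges G E E′
  same-edges E E′ h u v = by-adj (adj u v Boolₚ.≟ true)
    where
    outside : adj u v ≢ true → ∀ E → S E u v ≡ false
    outside ¬uv E = ≢true⇒≡false λ s → ¬uv (T⇒true (S-sub E u v (true⇒T s)))
    by-adj : Dec (adj u v ≡ true) → S E u v ≡ S E′ u v
    by-adj (yes uv) = h ((u , v) , true⇒T uv)
    by-adj (no ¬uv) = trans (outside ¬uv E) (sym (outside ¬uv E′))

  module _ (ρ : RotationSystem G) (F₁ : ℕ) (faceCount₁ : HasFaceCount G ρ F₁)
           (euler₁ : 2 * (n + F₁) + 4 * 1 ≡ degreeSum G + 4) where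
    private
      X : Fin n → Bool
      X = flipped ρ

      E : EdgeSet G
      E = cutSet X

      open DualMatrix G three cubic ρ₀ F faceCount₀ euler (selected E) (selected-rev E) using (A; dart-A; RankTwo)
      module Γ = Genus G three cubic ρ₀ F faceCount₀ euler (selected E) (selected-rev E) X (selected-cutSet X)
                       ρ (flipped-isFlip ρ) F₁ (FaceSteps.classes-from G ρ faceCount₁) d₀

      F≡ : F ≡ 2 + F₁
      F≡ = genus-one⇒two-fewer F₁ euler₁

      cut-dart : Dart G
      cut-dart = proj₁ (Γ.edge-exists F≡)

      rankTwo : RankTwo (face cut-dart) (face (rev G cut-dart))
      rankTwo = Γ.two-fewer⇒rank-two (dart-A cut-dart (proj₂ (Γ.edge-exists F≡)) refl refl) F≡

    torus⇒good : GoodDualSubgraph G ρ₀ (cutSet (flipped ρ))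
    torus⇒good = FromRank.good G three cubic ρ₀ F faceCount₀ euler E
      (λ f → trans (∑ᴱ-cong λ d → cong (δ (face d) f ∧_) (selected-cutSet X d)) (cut⇒face-closed X f))
      (face cut-dart) (face (rev G cut-dart)) rankTwo

  module _ (E : EdgeSet G) where
    open DualMatrix G three cubic ρ₀ F faceCount₀ euler (selected E) (selected-rev E) using (RankTwo)

    closed⇒torus : (∀ f → ∑ᴱ (λ d → δ (face d) f ∧ selected E d) ≡ false) → ∀ p q → RankTwo p q →
                   Σ (Σ (RotationSystem G) λ ρ → HasGenus G ρ 1) λ a → SameEdges G (cutSet (flipped (proj₁ a))) E
    closed⇒torus closed p q rankTwo =
      (ρ , proj₁ orbits₁ , FaceSteps.faceCount G ρ (proj₂ orbits₁) ,
        two-fewer⇒genus-one (proj₁ orbits₁) (Γ.rank-two⇒two-fewer (proj₁ rankTwo) rankTwo)) ,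
      same-edges (cutSet (flipped ρ)) E λ d → trans (selected-cutSet (flipped ρ) d)
        -- `flipped` recomputes a flipped set from the rotation built out of `X`; both sets describe
        -- the same rotation and so have the same cut.
        (trans (equivalent⇒same-cut {ρ} {ρ} {flipped ρ} {X} (flipped-isFlip ρ) (flipRotation-isFlip X) (inj₁ λ _ → refl) d)
               (sym (proj₁ (proj₂ cut) d)))
      where
      cut : ∃ λ (X : Fin n → Bool) → (∀ d → selected E d ≡ crosses X d) × X (tail G d₀) ≡ true
      cut = face-closed⇒cut (selected E) (selected-rev E) closed d₀ true
      X : Fin n → Bool
      X = proj₁ cut
      ρ : RotationSystem G
      ρ = flipRotation X
      orbits₁ : ∃ λ F₁ → Classes (faceStep G ρ) F₁
      orbits₁ = FaceSteps.orbits G ρ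
      module Γ = Genus G three cubic ρ₀ F faceCount₀ euler (selected E) (selected-rev E) X (proj₁ (proj₂ cut))
                       ρ (flipRotation-isFlip X) (proj₁ orbits₁) (proj₂ orbits₁) d₀

    private
      ∑₂ : ∀ f → ∑ {2} f ≡ f 0F xor (f 1F xor false)
      ∑₂ f = trans (∑-suc f) (cong (f 0F xor_) (trans (∑-suc _) (cong (f 1F xor_) (∑-empty _))))

      ∑₃ : ∀ f → ∑ {3} f ≡ f 0F xor (f 1F xor (f 2F xor false))
      ∑₃ f = trans (∑-suc f) (cong (f 0F xor_) (∑₂ (λ i → f (suc i))))

      Independent : ∀ {k} → Vec Bool k → Vec Bool k → Set
      Independent L₁ L₂ = ∀ i j → i ≢ j → det (lookup L₁ i) (lookup L₂ i) (lookup L₁ j) (lookup L₂ j) ≡ true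

      independent? : ∀ {k} (L₁ L₂ : Vec Bool k) → Dec (Independent L₁ L₂)
      independent? L₁ L₂ = all? λ i → all? λ j → ¬? (i ≟F j) →-dec (_ Boolₚ.≟ true)

      iso⇒torus : ∀ {k} (sizes : Vec ℕ k) → DualSubgraphIso G ρ₀ E sizes → (L₁ L₂ : Vec Bool k) → Independent L₁ L₂ →
                  ∑ (λ i → odd (lookup sizes i) ∧ lookup L₁ i) ≡ false → ∑ (λ i → odd (lookup sizes i) ∧ lookup L₂ i) ≡ false →
                  (x₀ y₀ : KV G sizes) → proj₁ x₀ ≢ proj₁ y₀ →
                  Σ (Σ (RotationSystem G) λ ρ → HasGenus G ρ 1) λ a → SameEdges G (cutSet (flipped (proj₁ a))) E
      iso⇒torus sizes iso L₁ L₂ ind even₁ even₂ x₀ y₀ x₀≢y₀ = closed⇒torus I.closed (I.vertex x₀) (I.vertex y₀) I.rankTwo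
        where module I = MultipartiteDual.FromIso G three cubic ρ₀ F faceCount₀ euler E sizes iso (lookup L₁) (lookup L₂) ind even₁ even₂ x₀ y₀ x₀≢y₀

    good⇒torus : GoodDualSubgraph G ρ₀ E →
                 Σ (Σ (RotationSystem G) λ ρ → HasGenus G ρ 1) λ a → SameEdges G (cutSet (flipped (proj₁ a))) E
    good⇒torus (inj₁ iso) = iso⇒torus (2 ∷ 2 ∷ 2 ∷ []) iso L₁ L₂ (from-yes (independent? L₁ L₂)) (∑₃ _) (∑₃ _)
      (0F , 0F) (1F , 0F) λ ()
      where
      L₁ L₂ : Vec Bool 3
      L₁ = true ∷ false ∷ true ∷ []
      L₂ = false ∷ true ∷ true ∷ []
    -- Matching `suc m` exhibits a vertex in the second part. Both parts are even, so the labels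
    -- (1,0) and (0,1) each add up to zero.
    good⇒torus (inj₂ (inj₁ (suc m , 1≤m , iso))) = iso⇒torus (2 ∷ 2 * suc m ∷ []) iso L₁ L₂ (from-yes (independent? L₁ L₂))
      (trans (∑₂ _) (cong (λ o → (o ∧ false) xor false) (odd-double (suc m))))
      (trans (∑₂ _) (cong (λ o → (o ∧ true) xor false) (odd-double (suc m))))
      (0F , 0F) (1F , 0F) λ ()
      where
      L₁ L₂ : Vec Bool 2
      L₁ = true ∷ false ∷ []
      L₂ = false ∷ true ∷ []
    -- All parts are odd, so the label sum is (1,0) + (0,1) + (1,1), which is zero over F2.
    good⇒torus (inj₂ (inj₂ (m , 1≤m , iso))) = iso⇒torus (1 ∷ 1 ∷ 2 * m ∸ 1 ∷ []) iso L₁ L₂ (from-yes (independent? L₁ L₂))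
      (trans (∑₃ _) (cong (λ o → true xor (false xor ((o ∧ true) xor false))) (odd-double-pred m 1≤m)))
      (trans (∑₃ _) (cong (λ o → false xor (true xor ((o ∧ true) xor false))) (odd-double-pred m 1≤m)))
      (0F , 0F) (1F , 0F) λ ()
      where
      L₁ L₂ : Vec Bool 3
      L₁ = true ∷ false ∷ true ∷ []
      L₂ = false ∷ true ∷ true ∷ []

  correspondence : OneToOne (Σ (RotationSystem G) λ ρ → HasGenus G ρ 1)
                            (Σ (EdgeSet G) λ E → GoodDualSubgraph G ρ₀ E)
                            (λ a b → EquivEmb G (proj₁ a) (proj₁ b))
                            (λ a b → SameEdges G (proj₁ a) (proj₁ b))
  correspondence =
    (λ (ρ , F₁ , faceCount₁ , euler₁) → cutSet (flipped ρ) , torus⇒good ρ F₁ faceCount₁ euler₁) ,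
    (λ (ρ , _) (ρ′ , _) equiv → same-edges (cutSet (flipped ρ)) (cutSet (flipped ρ′)) λ d →
      trans (selected-cutSet (flipped ρ) d) (trans
        (equivalent⇒same-cut {ρ} {ρ′} {flipped ρ} {flipped ρ′} (flipped-isFlip ρ) (flipped-isFlip ρ′) equiv d)
        (sym (selected-cutSet (flipped ρ′) d)))) ,
    (λ (ρ , _) (ρ′ , _) same-E →
      same-cut⇒equivalent {ρ} {ρ′} {flipped ρ} {flipped ρ′} (flipped-isFlip ρ) (flipped-isFlip ρ′) (proj₁ (proj₂ three)) λ d →
        trans (sym (selected-cutSet (flipped ρ) d)) (trans (same-E (tail G d) (head d)) (selected-cutSet (flipped ρ′) d))) ,
    λ (E , good) → good⇒torus E good

theorem2 : (G : Graph) → ThreeConnected G → Regular G 3 →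
    (ρ₀ : RotationSystem G) → HasGenus G ρ₀ 0 →
    OneToOne (Σ (RotationSystem G) λ ρ → HasGenus G ρ 1)
    (Σ (EdgeSet G) λ E → GoodDualSubgraph G ρ₀ E)
    (λ a b → EquivEmb G (proj₁ a) (proj₁ b))
    (λ a b → SameEdges G (proj₁ a) (proj₁ b))
theorem2 G three cubic ρ₀ (F , faceCount₀ , euler) = Correspondence.correspondence G three cubic ρ₀ F faceCount₀ euler
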